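{- Let $n \ge 5$ be an odd integer. Then the Kronecker product $C_n \otimes C_n$ has diameter $n-1$, is not distance-regular, and has exactly $\frac{n+3}{2}$ distinct distance eigenvalues. Since $\frac{n+3}{2} < n$, the graph $C_n\otimes C_n$ has fewer than $d+1$ distinct distance eigenvalues, where $d = n-1$ is its diameter. Consequently the graphs $C_n \otimes C_n$, $n\ge 5$ odd, form an infinite family of non-distance-regular connected graphs of diameter $d$ with fewer than $d+1$ distinct distance eigenvalues.
   Context: $C_n$ denotes the cycle on $n$ vertices. For graphs $G$ and $H$, the Kronecker (direct) product $G\otimes H$ has vertex set $V(G)\times V(H)$, with $(x,y)\sim(x',y')$ if $x\sim x'$ in $G$ and $y\sim y'$ in $H$. For a connected graph $G$ with vertices $v_1,\dots,v_N$, $d(u,v)$ denotes the length of a shortest path between $u$ and $v$; the distance matrix is $D(G)=(d(v_i,v_j))_{N\times N}$, and the distance eigenvalues of $G$ are the eigenvalues of $D(G)$. For a vertex $x$, let $G_i(x)$ be the set of vertices at distance $i$ from $x$. A connected graph $G$ is distance-regular if it is regular and, for each $i$, there are constants $c_i$ and $b_i$ such that for any two vertices $x,y$ at distance $i$ there are precisely $c_i$ neighbors of $y$ in $G_{i-1}(x)$ and $b_i$ neighbors of $y$ in $G_{i+1}(x)$. -}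

module Defs where

open import Data.Nat as ℕ using (ℕ; zero; suc; z≤n; s≤s)
import Data.Nat.Properties as ℕ
open import Data.Integer using (+_)
open import Data.Rational as ℚ using (ℚ; 0ℚ; 1ℚ; ½; ∣_∣)
import Data.Rational.Properties as ℚ
open import Data.Rational.Solver using (module +-*-Solver)
import Data.Fin as Fin
open import Data.Fin using (Fin; toℕ)
open import Data.Fin.Properties using (*↔×; any?)
open import Data.List using (List; map; allFin; filter; length)
open import Data.Vec.Functional using (foldr)
open import Data.Product using (Σ-syntax; ∃; ∃-syntax; _×_; _,_; proj₁; proj₂)
open import Data.Product.Function.NonDependent.Propositional using (_×-↔_)
open import Data.Sum using (_⊎_; inj₁; inj₂; swap)
open import Function using (_∘_; _↔_; _⇔_; Inverse)
open import Function.Construct.Composition using (_↔-∘_)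
open import Function.Construct.Symmetry using (↔-sym)
open import Function.Properties.Inverse using (↔-refl; ↔⇒↣)
open import Level using (0ℓ)
open import Relation.Binary using (DecidableEquality)
open import Relation.Binary.PropositionalEquality
open import Relation.Nullary using (¬_; Dec; yes; no; contradiction)
open import Relation.Nullary.Decidable using (_×-dec_; _⊎-dec_; map′; via-injection)
open import Relation.Unary using (Pred; Decidable)

-- ℝ is the set of Cauchy sequences of rationals, with ≈ (the difference
-- is a null sequence) as equality.  x # y is the constructively positive
-- form of x ≠ y: the difference is eventually bounded away from 0.

IsCauchy : (ℕ → ℚ) → Set
IsCauchy x = ∀ ε → 0ℚ ℚ.< ε →
  ∃[ N ] ∀ m n → N ℕ.≤ m → N ℕ.≤ n → ∣ x m ℚ.- x n ∣ ℚ.< ε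

record ℝ : Set where
  constructor mkℝ
  field
    seq    : ℕ → ℚ
    cauchy : IsCauchy seq

open ℝ public

infix 4 _≈_ _#_

record _≈_ (x y : ℝ) : Set where
  constructor mk≈
  field
    close : ∀ ε → 0ℚ ℚ.< ε →
      ∃[ N ] ∀ n → N ℕ.≤ n → ∣ seq x n ℚ.- seq y n ∣ ℚ.< ε

record _#_ (x y : ℝ) : Set where
  constructor mk#
  field
    apart : ∃[ ε ] 0ℚ ℚ.< ε ×
      ∃[ N ] ∀ n → N ℕ.≤ n → ε ℚ.≤ ∣ seq x n ℚ.- seq y n ∣

open _≈_ public
open _#_ public

half-pos : ∀ {ε} → 0ℚ ℚ.< ε → 0ℚ ℚ.< ε ℚ.* ½
half-pos {ε} 0<ε = subst (ℚ._< ε ℚ.* ½) (ℚ.*-zeroˡ ½) (ℚ.*-monoˡ-<-pos ½ 0<ε)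

half+half : ∀ ε → ε ℚ.* ½ ℚ.+ ε ℚ.* ½ ≡ ε
half+half ε = trans (sym (ℚ.*-distribˡ-+ ε ½ ½)) (ℚ.*-identityʳ ε)

shrink : ∀ B ε → 0ℚ ℚ.< B → 0ℚ ℚ.< ε → ∃[ δ ] 0ℚ ℚ.< δ × B ℚ.* δ ≡ ε ℚ.* ½
shrink B ε 0<B 0<ε = δ , 0<δ , eq
  where
  instance
    posB = ℚ.positive 0<B
    nzB  = ℚ.pos⇒nonZero B
    posI = ℚ.1/pos⇒pos B
    posE = ℚ.positive (half-pos 0<ε)
  δ = ℚ.1/ B ℚ.* (ε ℚ.* ½)
  0<δ : 0ℚ ℚ.< δ
  0<δ = ℚ.positive⁻¹ δ {{ℚ.pos*pos⇒pos (ℚ.1/ B) (ε ℚ.* ½)}}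
  eq : B ℚ.* δ ≡ ε ℚ.* ½
  eq = trans (sym (ℚ.*-assoc B (ℚ.1/ B) (ε ℚ.* ½)))
         (trans (cong (ℚ._* (ε ℚ.* ½)) (ℚ.*-inverseʳ B)) (ℚ.*-identityˡ _))

0<1+∣_∣ : ∀ p → 0ℚ ℚ.< 1ℚ ℚ.+ ∣ p ∣
0<1+∣ p ∣ = ℚ.+-mono-<-≤ {0ℚ} {1ℚ} {0ℚ} (ℚ.positive⁻¹ 1ℚ) (ℚ.0≤∣p∣ p)

Bounded : (ℕ → ℚ) → Set
Bounded x = ∃[ B ] 0ℚ ℚ.< B × ∃[ N ] ∀ n → N ℕ.≤ n → ∣ x n ∣ ℚ.≤ B

bounded : ∀ {x} → IsCauchy x → Bounded x
bounded {x} cx with cx 1ℚ (ℚ.positive⁻¹ 1ℚ)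
... | N , h = 1ℚ ℚ.+ ∣ x N ∣ , 0<1+∣ x N ∣ , N , λ n N≤n → begin
    ∣ x n ∣                         ≡⟨ cong ∣_∣ (split (x n) (x N)) ⟩
    ∣ (x n ℚ.- x N) ℚ.+ x N ∣       ≤⟨ ℚ.∣p+q∣≤∣p∣+∣q∣ (x n ℚ.- x N) (x N) ⟩
    ∣ x n ℚ.- x N ∣ ℚ.+ ∣ x N ∣     ≤⟨ ℚ.+-monoˡ-≤ ∣ x N ∣ (ℚ.<⇒≤ (h n N N≤n ℕ.≤-refl)) ⟩
    1ℚ ℚ.+ ∣ x N ∣                  ∎
  where
  open ℚ.≤-Reasoning
  open +-*-Solver
  split : ∀ a b → a ≡ (a ℚ.- b) ℚ.+ b
  split = solve 2 (λ a b → a := (a :- b) :+ b) refl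

abstract
  const-cauchy : ∀ q → IsCauchy (λ _ → q)
  const-cauchy q ε 0<ε = 0 , λ _ _ _ _ →
    subst (ℚ._< ε) (sym (cong ∣_∣ (ℚ.+-inverseʳ q))) 0<ε

  +-cauchy : ∀ {x y} → IsCauchy x → IsCauchy y → IsCauchy (λ n → x n ℚ.+ y n)
  +-cauchy {x} {y} cx cy ε 0<ε
    with cx (ε ℚ.* ½) (half-pos 0<ε) | cy (ε ℚ.* ½) (half-pos 0<ε)
  ... | N₁ , h₁ | N₂ , h₂ = N₁ ℕ.⊔ N₂ , λ m n N≤m N≤n → begin-strict
      ∣ (x m ℚ.+ y m) ℚ.- (x n ℚ.+ y n) ∣
        ≡⟨ cong ∣_∣ (split (x m) (y m) (x n) (y n)) ⟩
      ∣ (x m ℚ.- x n) ℚ.+ (y m ℚ.- y n) ∣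
        ≤⟨ ℚ.∣p+q∣≤∣p∣+∣q∣ (x m ℚ.- x n) (y m ℚ.- y n) ⟩
      ∣ x m ℚ.- x n ∣ ℚ.+ ∣ y m ℚ.- y n ∣
        <⟨ ℚ.+-mono-< (h₁ m n (ℕ.m⊔n≤o⇒m≤o N₁ N₂ N≤m) (ℕ.m⊔n≤o⇒m≤o N₁ N₂ N≤n))
                      (h₂ m n (ℕ.m⊔n≤o⇒n≤o N₁ N₂ N≤m) (ℕ.m⊔n≤o⇒n≤o N₁ N₂ N≤n)) ⟩
      ε ℚ.* ½ ℚ.+ ε ℚ.* ½
        ≡⟨ half+half ε ⟩
      ε ∎
    where
    open ℚ.≤-Reasoning
    open +-*-Solver
    split : ∀ a b c d → (a ℚ.+ b) ℚ.- (c ℚ.+ d) ≡ (a ℚ.- c) ℚ.+ (b ℚ.- d)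
    split = solve 4 (λ a b c d → (a :+ b) :- (c :+ d) := (a :- c) :+ (b :- d)) refl

  product-bound : ∀ a b c d {A B δ η ε} → 0ℚ ℚ.< A → 0ℚ ℚ.< B →
    ∣ a ∣ ℚ.≤ A → ∣ d ∣ ℚ.≤ B → ∣ b ℚ.- d ∣ ℚ.< δ → ∣ a ℚ.- c ∣ ℚ.< η →
    A ℚ.* δ ≡ ε ℚ.* ½ → B ℚ.* η ≡ ε ℚ.* ½ → ∣ a ℚ.* b ℚ.- c ℚ.* d ∣ ℚ.< ε
  product-bound a b c d {A} {B} {δ} {η} {ε} 0<A 0<B a≤A d≤B dy dx Aδ Bη = begin-strict
    ∣ a ℚ.* b ℚ.- c ℚ.* d ∣
      ≡⟨ cong ∣_∣ (split a b c d) ⟩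
    ∣ a ℚ.* (b ℚ.- d) ℚ.+ d ℚ.* (a ℚ.- c) ∣
      ≤⟨ ℚ.∣p+q∣≤∣p∣+∣q∣ (a ℚ.* (b ℚ.- d)) (d ℚ.* (a ℚ.- c)) ⟩
    ∣ a ℚ.* (b ℚ.- d) ∣ ℚ.+ ∣ d ℚ.* (a ℚ.- c) ∣
      <⟨ ℚ.+-mono-< (part a (b ℚ.- d) 0<A a≤A dy) (part d (a ℚ.- c) 0<B d≤B dx) ⟩
    A ℚ.* δ ℚ.+ B ℚ.* η
      ≡⟨ cong₂ ℚ._+_ Aδ Bη ⟩
    ε ℚ.* ½ ℚ.+ ε ℚ.* ½
      ≡⟨ half+half ε ⟩
    ε ∎
    where
    open ℚ.≤-Reasoning
    open +-*-Solver
    split : ∀ a b c d → a ℚ.* b ℚ.- c ℚ.* d ≡ a ℚ.* (b ℚ.- d) ℚ.+ d ℚ.* (a ℚ.- c)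
    split = solve 4 (λ a b c d → a :* b :- c :* d := a :* (b :- d) :+ d :* (a :- c)) refl
    part : ∀ a b {C γ} → 0ℚ ℚ.< C → ∣ a ∣ ℚ.≤ C → ∣ b ∣ ℚ.< γ → ∣ a ℚ.* b ∣ ℚ.< C ℚ.* γ
    part a b {C} {γ} 0<C a≤C b<γ = begin-strict
      ∣ a ℚ.* b ∣      ≡⟨ ℚ.∣p*q∣≡∣p∣*∣q∣ a b ⟩
      ∣ a ∣ ℚ.* ∣ b ∣  ≤⟨ ℚ.*-monoʳ-≤-nonNeg ∣ b ∣ {{ℚ.∣-∣-nonNeg b}} a≤C ⟩
      C ℚ.* ∣ b ∣      <⟨ ℚ.*-monoʳ-<-pos C {{ℚ.positive 0<C}} b<γ ⟩
      C ℚ.* γ          ∎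

  *-cauchy : ∀ {x y} → IsCauchy x → IsCauchy y → IsCauchy (λ n → x n ℚ.* y n)
  *-cauchy {x} {y} cx cy ε 0<ε = go (bounded cx) (bounded cy)
    where
    Goal : Set
    Goal = ∃[ N ] ∀ m n → N ℕ.≤ m → N ℕ.≤ n → ∣ x m ℚ.* y m ℚ.- x n ℚ.* y n ∣ ℚ.< ε
    go : Bounded x → Bounded y → Goal
    go (A , 0<A , N₁ , hA) (B , 0<B , N₂ , hB) =
      go′ (shrink A ε 0<A 0<ε) (shrink B ε 0<B 0<ε)
      where
      go′ : ∃[ δ ] 0ℚ ℚ.< δ × A ℚ.* δ ≡ ε ℚ.* ½ → ∃[ η ] 0ℚ ℚ.< η × B ℚ.* η ≡ ε ℚ.* ½ → Goal
      go′ (δ , 0<δ , Aδ) (η , 0<η , Bη) = go″ (cy δ 0<δ) (cx η 0<η)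
        where
        go″ : ∃[ N ] (∀ m n → N ℕ.≤ m → N ℕ.≤ n → ∣ y m ℚ.- y n ∣ ℚ.< δ) →
              ∃[ N ] (∀ m n → N ℕ.≤ m → N ℕ.≤ n → ∣ x m ℚ.- x n ∣ ℚ.< η) → Goal
        go″ (N₃ , hy) (N₄ , hx) = (N₁ ℕ.⊔ N₂) ℕ.⊔ (N₃ ℕ.⊔ N₄) , λ m n N≤m N≤n →
          product-bound (x m) (y m) (x n) (y n) 0<A 0<B
            (hA m (ℕ.m⊔n≤o⇒m≤o N₁ N₂ (left N≤m)))
            (hB n (ℕ.m⊔n≤o⇒n≤o N₁ N₂ (left N≤n)))
            (hy m n (ℕ.m⊔n≤o⇒m≤o N₃ N₄ (right N≤m)) (ℕ.m⊔n≤o⇒m≤o N₃ N₄ (right N≤n)))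
            (hx m n (ℕ.m⊔n≤o⇒n≤o N₃ N₄ (right N≤m)) (ℕ.m⊔n≤o⇒n≤o N₃ N₄ (right N≤n)))
            Aδ Bη
          where
          left : ∀ {k} → (N₁ ℕ.⊔ N₂) ℕ.⊔ (N₃ ℕ.⊔ N₄) ℕ.≤ k → N₁ ℕ.⊔ N₂ ℕ.≤ k
          left = ℕ.m⊔n≤o⇒m≤o (N₁ ℕ.⊔ N₂) (N₃ ℕ.⊔ N₄)
          right : ∀ {k} → (N₁ ℕ.⊔ N₂) ℕ.⊔ (N₃ ℕ.⊔ N₄) ℕ.≤ k → N₃ ℕ.⊔ N₄ ℕ.≤ k
          right = ℕ.m⊔n≤o⇒n≤o (N₁ ℕ.⊔ N₂) (N₃ ℕ.⊔ N₄)

infixl 6 _+ℝ_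
infixl 7 _*ℝ_

_+ℝ_ : ℝ → ℝ → ℝ
x +ℝ y = mkℝ (λ n → seq x n ℚ.+ seq y n) (+-cauchy {seq x} {seq y} (cauchy x) (cauchy y))

_*ℝ_ : ℝ → ℝ → ℝ
x *ℝ y = mkℝ (λ n → seq x n ℚ.* seq y n) (*-cauchy {seq x} {seq y} (cauchy x) (cauchy y))

fromℚ : ℚ → ℝ
fromℚ q = mkℝ (λ _ → q) (const-cauchy q)

fromℕ : ℕ → ℝ
fromℕ k = fromℚ (+ k ℚ./ 1)

0ℝ : ℝ
0ℝ = fromℚ 0ℚ

sum : ∀ {N} → (Fin N → ℝ) → ℝ
sum = foldr _+ℝ_ 0ℝ

Matrix : ℕ → Set
Matrix N = Fin N → Fin N → ℝ

_*ᵥ_ : ∀ {N} → Matrix N → (Fin N → ℝ) → (Fin N → ℝ)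
(M *ᵥ v) i = sum (λ j → M i j *ℝ v j)

-- v is a nonzero vector: some coordinate is apart from 0.
IsEigenvalue : ∀ {N} → Matrix N → ℝ → Set
IsEigenvalue {N} M μ =
  Σ[ v ∈ (Fin N → ℝ) ] (∃[ i ] v i # 0ℝ) × (∀ i → (M *ᵥ v) i ≈ μ *ℝ v i)

-- μ lists, without repetition, exactly the reals satisfying P; pairwise # is
-- the constructive form of pairwise distinctness.
HasExactlyDistinct : ℕ → (ℝ → Set) → Set
HasExactlyDistinct k P =
  Σ[ μ ∈ (Fin k → ℝ) ]
    (∀ i j → i ≢ j → μ i # μ j) ×
    (∀ i → P (μ i)) ×
    (∀ x → P x → ∃[ i ] x ≈ μ i)

record Graph : Set₁ where
  infix 4 _∼_ _∼?_
  field
    V      : Set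
    order  : ℕ
    enum   : Fin order ↔ V
    _∼_    : V → V → Set
    _∼?_   : ∀ u v → Dec (u ∼ v)
    ∼-sym  : ∀ {u v} → u ∼ v → v ∼ u
    ∼-irr  : ∀ {v} → ¬ (v ∼ v)

  vertex : Fin order → V
  vertex = Inverse.to enum

  vertices : List V
  vertices = map vertex (allFin order)

  _≟_ : DecidableEquality V
  _≟_ = via-injection (↔⇒↣ (↔-sym enum)) Fin._≟_

  count : ∀ {P : Pred V 0ℓ} → Decidable P → ℕ
  count P? = length (filter P? vertices)

  degree : V → ℕ
  degree v = count (v ∼?_)

  data Walk : V → V → ℕ → Set where
    []  : ∀ {v} → Walk v v 0
    _∷_ : ∀ {u v w k} → u ∼ v → Walk v w k → Walk u w (suc k)

  Connected : Set
  Connected = ∀ u v → ∃ (Walk u v)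

  walk? : ∀ u v k → Dec (Walk u v k)
  walk? u v zero = map′ (λ { refl → [] }) (λ { [] → refl }) (u ≟ v)
  walk? u v (suc k) =
    map′ (λ (i , a , p) → a ∷ p)
         (λ { (_∷_ {v = w} a p) → Inverse.from enum w
            , subst (u ∼_) (sym (Inverse.strictlyInverseˡ enum w)) a
            , subst (λ z → Walk z v k) (sym (Inverse.strictlyInverseˡ enum w)) p })
         (any? (λ i → (u ∼? vertex i) ×-dec walk? (vertex i) v k))

least : ∀ {P : Pred ℕ 0ℓ} → Decidable P → ∃ P → ∃[ k ] P k × (∀ j → P j → k ℕ.≤ j)
least P? (n , p) = search P? n p
  where
  search : ∀ {P : Pred ℕ 0ℓ} → Decidable P → ∀ n → P n →
    ∃[ k ] P k × (∀ j → P j → k ℕ.≤ j)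
  search P? zero p = 0 , p , λ _ _ → z≤n
  search P? (suc n) p with P? 0
  ... | yes p₀ = 0 , p₀ , λ _ _ → z≤n
  ... | no ¬p₀ with search (P? ∘ suc) n p
  ... | k , q , min =
    suc k , q , λ { zero p₀ → contradiction p₀ ¬p₀ ; (suc j) r → s≤s (min j r) }

module Metric (G : Graph) (conn : Graph.Connected G) where
  open Graph G

  -- A shortest walk repeats no vertex, so it is a shortest path.
  dist : V → V → ℕ
  dist u v = proj₁ (least (walk? u v) (conn u v))

  HasDiameter : ℕ → Set
  HasDiameter d = (∀ u v → dist u v ℕ.≤ d) × (∃[ u ] ∃[ v ] dist u v ≡ d)

  distanceMatrix : Matrix order
  distanceMatrix i j = fromℕ (dist (vertex i) (vertex j))

  IsDistanceEigenvalue : ℝ → Set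
  IsDistanceEigenvalue = IsEigenvalue distanceMatrix

  Regular : Set
  Regular = ∃[ k ] ∀ v → degree v ≡ k

  -- z ∈ G_{i-1}(x) is written as dist x z + 1 = i, so that G_{-1}(x) is empty.
  DistanceRegular : Set
  DistanceRegular = Regular ×
    (∀ i → ∃[ c ] ∃[ b ] ∀ x y → dist x y ≡ i →
      count (λ z → (y ∼? z) ×-dec (suc (dist x z) ℕ.≟ i)) ≡ c ×
      count (λ z → (y ∼? z) ×-dec (dist x z ℕ.≟ suc i)) ≡ b)

  NotDistanceRegularWithFewDistanceEigenvalues : Set
  NotDistanceRegularWithFewDistanceEigenvalues =
    ¬ DistanceRegular ×
    ∃[ d ] HasDiameter d ×
      ∃[ k ] HasExactlyDistinct k IsDistanceEigenvalue × k ℕ.< d ℕ.+ 1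

infix 4 _≅_

_≅_ : Graph → Graph → Set
G ≅ H = Σ[ f ∈ (Graph.V G ↔ Graph.V H) ]
  (∀ u v → Graph._∼_ G u v ⇔ Graph._∼_ H (Inverse.to f u) (Inverse.to f v))

infixl 7 _⊗_

_⊗_ : Graph → Graph → Graph
G ⊗ H = record
  { V     = G.V × H.V
  ; order = G.order ℕ.* H.order
  ; enum  = (G.enum ×-↔ H.enum) ↔-∘ *↔×
  ; _∼_   = λ (x , y) (x′ , y′) → x G.∼ x′ × y H.∼ y′
  ; _∼?_  = λ (x , y) (x′ , y′) → (x G.∼? x′) ×-dec (y H.∼? y′)
  ; ∼-sym = λ (p , q) → G.∼-sym p , H.∼-sym q
  ; ∼-irr = λ (p , _) → G.∼-irr p
  }
  where
  module G = Graph G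
  module H = Graph H

-- Next i j says that j = i + 1 modulo n.
Next : ∀ {n} → Fin n → Fin n → Set
Next {n} i j = (suc (toℕ i) ≡ toℕ j) ⊎ (suc (toℕ i) ≡ n × toℕ j ≡ 0)

next? : ∀ {n} (i j : Fin n) → Dec (Next i j)
next? {n} i j =
  (suc (toℕ i) ℕ.≟ toℕ j) ⊎-dec ((suc (toℕ i) ℕ.≟ n) ×-dec (toℕ j ℕ.≟ 0))

next-irr : ∀ {n} → 3 ℕ.≤ n → (i : Fin n) → ¬ Next i i
next-irr 3≤n i (inj₁ e) = ℕ.1+n≢n e
next-irr 3≤n i (inj₂ (e , z)) = one (trans (cong suc (sym z)) e) 3≤n
  where
  one : ∀ {n} → 1 ≡ n → ¬ (3 ℕ.≤ n)
  one refl (s≤s ())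

C : (n : ℕ) → 3 ℕ.≤ n → Graph
C n 3≤n = record
  { V     = Fin n
  ; order = n
  ; enum  = ↔-refl
  ; _∼_   = λ i j → Next i j ⊎ Next j i
  ; _∼?_  = λ i j → next? i j ⊎-dec next? j i
  ; ∼-sym = swap
  ; ∼-irr = λ { {i} (inj₁ p) → next-irr 3≤n i p ; {i} (inj₂ p) → next-irr 3≤n i p }
  }

C⊗C : (n : ℕ) → 5 ℕ.≤ n → Graph
C⊗C n 5≤n = C n 3≤n ⊗ C n 3≤n
  where
  3≤n : 3 ℕ.≤ n
  3≤n = ℕ.≤-trans (ℕ.m≤n+m 3 2) 5≤n

{-# OPTIONS --safe #-}
-- For odd n = 2m + 1 the change of coordinates u = (x + y)/2, w = (x - y)/2
-- modulo n turns C n ⊗ C n into the torus C n □ C n, whose distance is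
-- δ(u) + δ(w) with δ the distance of the n-cycle.  Products of the n-periodic
-- functions cos(2πjk/n) therefore diagonalise the distance matrix: the
-- frequencies (0 , 0), (j , 0) or (0 , j), and (j , l) with j, l ≠ 0 give the
-- eigenvalues 2nΛ₀, nΛⱼ and 0, where Λⱼ = Λ₋ⱼ and Λⱼ = -1/(2 + 2cos(2πjm/n)).
--
-- Everything about the cosines follows from c = 2cos(2π/n) by the recurrence
-- t (k+1) = c t k - t (k-1).  The number c is obtained as the largest root of
-- the Dirichlet kernel p m, where p 0 = 1, p 1 = x + 1 and
-- p (k+1) = x p k - p (k-1): it is the limit of a bisection on the condition
-- that p 0, …, p m are all positive, so that p k (c) > 0 for k < m.
--
-- Distance-regularity fails at distance 2: on the torus, (2 , 0) has one
-- neighbour closer to the origin and (1 , 1) has two.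
module Submission where

open import Algebra.Bundles using (CommutativeRing)
import Algebra.Properties.Semiring.Sum
import Algebra.Solver.Ring
import Algebra.Solver.Ring.AlmostCommutativeRing as ACR
open import Data.Nat as ℕ using (ℕ; zero; suc)
import Data.Nat.Divisibility as ℕ
import Data.Nat.DivMod as ℕ
import Data.Nat.Properties as ℕ
import Data.Nat.Solver as ℕ
open import Data.Integer as ℤ using (ℤ; +_; -[1+_])
import Data.Integer.DivMod as ℤ
import Data.Integer.Properties as ℤ
import Data.Integer.Solver as ℤ
open import Data.Rational as ℚ using (ℚ; 0ℚ; 1ℚ; ½; ∣_∣)
import Data.Rational.Properties as ℚ
import Data.Rational.Solver as ℚ
open import Data.Rational.Unnormalised as ℚᵘ using (mkℚᵘ; *≡*)
import Data.Rational.Unnormalised.Properties as ℚᵘ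
open import Data.Fin as Fin using (Fin; toℕ; fromℕ<)
open import Data.Fin.Permutation using (↔⇒≡)
import Data.Fin.Properties as Fin
open import Data.List using ([]; _∷_; filter; length)
open import Data.List.Membership.Propositional using (_∈_)
open import Data.List.Membership.Propositional.Properties using (∈-map⁺; ∈-allFin; ∈-filter⁺; ∈-filter⁻)
open import Data.List.Relation.Unary.All using ([]; _∷_)
open import Data.List.Relation.Unary.AllPairs using ([]; _∷_)
open import Data.List.Relation.Unary.Any using (here; there)
open import Data.List.Relation.Unary.Unique.Propositional using (Unique)
import Data.List.Relation.Unary.Unique.Propositional.Properties as Unique
import Data.Maybe as Maybe
open import Data.Product using (∃-syntax; Σ-syntax; _×_; _,_; proj₁; proj₂)
open import Data.Sum using (_⊎_; inj₁; inj₂)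
open import Function using (_∘_; _↔_; Inverse; mk↔ₛ′)
open import Function.Construct.Composition using (_↔-∘_)
open import Function.Construct.Symmetry using (↔-sym)
open import Level using (0ℓ)
import Relation.Binary.Reasoning.Setoid
open import Relation.Binary.PropositionalEquality as ≡ using (_≡_; _≢_; cong; cong₂; subst)
open import Relation.Binary.Definitions using (tri<; tri≈; tri>)
open import Relation.Nullary using (¬_; Dec; yes; no; contradiction)
open import Relation.Nullary.Decidable using (_×-dec_; dec⇒maybe; from-yes)
open import Relation.Unary using (Pred; Decidable)

-- The obstacle is constructive. Equality of Cauchy reals is undecidable, and both "distinct
-- eigenvalues" and "nonzero vector" mean apartness, so each nonvanishing has to come from a product
-- that is visibly apart from zero or from an explicit rational bound. Trigonometry is therefore
-- replaced by polynomial identities in `c`: `p m ≈ 0` makes `t` periodic modulo `n`, and `p k`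
-- being apart from zero for `k < m` makes `n` the exact period, through (t a - t b)² = (2 - t (a +
-- b)) (2 - t (a - b)). The values Λⱼ are separated through their reciprocals, which are cosines up
-- to sign and a constant.
--
-- That the list of eigenvalues is complete is shown by Fourier inversion at one vertex. If an
-- eigenvector `v` is apart from zero at `P`, the cosine kernels centred at `P` sum to a nonzero
-- multiple of `v P`; so some coefficient of `v` is apart from zero, and cancelling it identifies
-- the eigenvalue. Centring the kernels at `P` is why cosines alone suffice.

parity : ∀ k → ∃[ j ] (k ≡ j ℕ.+ j ⊎ k ≡ suc (j ℕ.+ j))
parity zero = 0 , inj₁ ≡.refl
parity (suc k) with parity k
... | j , inj₁ e = j , inj₂ (cong suc e)
... | j , inj₂ e = suc j , inj₁ (≡.trans (cong suc e) (cong suc (≡.sym (ℕ.+-suc j j))))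

-- Arithmetic modulo the odd number `n = 2m + 1`

module Cyclic (m : ℕ) where

  open ≡ using (refl; sym; trans; module ≡-Reasoning)

  n : ℕ
  n = suc (m ℕ.+ m)

  infix 4 _≋_

  -- The quotient is kept as data: matching on `offset` turns a congruence into an integer identity
  -- for the ring solver.
  record _≋_ (a b : ℤ) : Set where
    constructor mod
    field
      quot   : ℤ
      offset : a ≡ b ℤ.+ quot ℤ.* + n

  open ℤ.+-*-Solver

  ≋-reflexive : ∀ {a b} → a ≡ b → a ≋ b
  ≋-reflexive {a} refl = mod (+ 0) (sym (ℤ.+-identityʳ a))

  ≋-refl : ∀ {a} → a ≋ a
  ≋-refl = ≋-reflexive refl

  ≋-sym : ∀ {a b} → a ≋ b → b ≋ a
  ≋-sym {a} {b} (mod q refl) = mod (ℤ.- q) (lem b q (+ n))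
    where
    lem : ∀ b q n → b ≡ b ℤ.+ q ℤ.* n ℤ.+ (ℤ.- q) ℤ.* n
    lem = solve 3 (λ b q n → b := b :+ q :* n :+ (:- q) :* n) refl

  ≋-trans : ∀ {a b c} → a ≋ b → b ≋ c → a ≋ c
  ≋-trans {c = c} (mod q refl) (mod r refl) = mod (q ℤ.+ r) (lem c q r (+ n))
    where
    lem : ∀ c q r n → c ℤ.+ r ℤ.* n ℤ.+ q ℤ.* n ≡ c ℤ.+ (q ℤ.+ r) ℤ.* n
    lem = solve 4 (λ c q r n → c :+ r :* n :+ q :* n := c :+ (q :+ r) :* n) refl

  ≋-+ : ∀ {a b c d} → a ≋ b → c ≋ d → a ℤ.+ c ≋ b ℤ.+ d
  ≋-+ {b = b} {d = d} (mod q refl) (mod r refl) = mod (q ℤ.+ r) (lem b d q r (+ n))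
    where
    lem : ∀ b d q r n → b ℤ.+ q ℤ.* n ℤ.+ (d ℤ.+ r ℤ.* n) ≡ b ℤ.+ d ℤ.+ (q ℤ.+ r) ℤ.* n
    lem = solve 5 (λ b d q r n → b :+ q :* n :+ (d :+ r :* n) := b :+ d :+ (q :+ r) :* n) refl

  ≋-* : ∀ k {a b} → a ≋ b → k ℤ.* a ≋ k ℤ.* b
  ≋-* k {b = b} (mod q refl) = mod (k ℤ.* q) (lem k b q (+ n))
    where
    lem : ∀ k b q n → k ℤ.* (b ℤ.+ q ℤ.* n) ≡ k ℤ.* b ℤ.+ k ℤ.* q ℤ.* n
    lem = solve 4 (λ k b q n → k :* (b :+ q :* n) := k :* b :+ k :* q :* n) refl

  ≋-neg : ∀ {a b} → a ≋ b → ℤ.- a ≋ ℤ.- b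
  ≋-neg {b = b} (mod q refl) = mod (ℤ.- q) (lem b q (+ n))
    where
    lem : ∀ b q n → ℤ.- (b ℤ.+ q ℤ.* n) ≡ ℤ.- b ℤ.+ (ℤ.- q) ℤ.* n
    lem = solve 3 (λ b q n → :- (b :+ q :* n) := :- b :+ (:- q) :* n) refl

  ≋-- : ∀ {a b c d} → a ≋ b → c ≋ d → a ℤ.- c ≋ b ℤ.- d
  ≋-- p q = ≋-+ p (≋-neg q)

  +n≋ : ∀ a → a ℤ.+ + n ≋ a
  +n≋ a = mod (+ 1) (cong (λ w → a ℤ.+ w) (sym (ℤ.*-identityˡ (+ n))))

  ≋-small : ∀ {a b} → a ≋ b → ℤ.∣ a ℤ.- b ∣ ℕ.< n → a ≡ b
  ≋-small {a} {b} (mod q refl) lt = trans (cong (λ z → b ℤ.+ z ℤ.* + n) q≡0) (ℤ.+-identityʳ b)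
    where
    lem : ∀ b q n → b ℤ.+ q ℤ.* n ℤ.- b ≡ q ℤ.* n
    lem = solve 3 (λ b q n → b :+ q :* n :- b := q :* n) refl
    size : ℤ.∣ q ∣ ℕ.* n ℕ.< n
    size = subst (ℕ._< n) (trans (cong ℤ.∣_∣ (lem b q (+ n))) (ℤ.abs-* q (+ n))) lt
    small : ∀ k → k ℕ.* n ℕ.< n → k ≡ 0
    small zero    _ = refl
    small (suc k) h = contradiction (ℕ.m≤m+n n (k ℕ.* n)) (ℕ.<⇒≱ h)
    q≡0 : q ≡ + 0
    q≡0 = ℤ.∣i∣≡0⇒i≡0 (small ℤ.∣ q ∣ size)

  ≋-unique : ∀ {a b} → ℤ.∣ a ∣ ℕ.≤ m → ℤ.∣ b ∣ ℕ.≤ m → a ≋ b → a ≡ b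
  ≋-unique {a} {b} ha hb e = ≋-small e (ℕ.s≤s (ℕ.≤-trans (ℤ.∣i-j∣≤∣i∣+∣j∣ a b) (ℕ.+-mono-≤ ha hb)))

  ι : Fin n → ℤ
  ι i = + toℕ i

  [_] : ℤ → Fin n
  [ z ] = fromℕ< (ℤ.n%ℕd<d z n)

  ι[_] : ∀ z → ι [ z ] ≋ z
  ι[ z ] = ≋-sym (mod (z ℤ./ℕ n) (trans (ℤ.a≡a%ℕn+[a/ℕn]*n z n)
    (cong (λ k → + k ℤ.+ (z ℤ./ℕ n) ℤ.* + n) (sym (Fin.toℕ-fromℕ< (ℤ.n%ℕd<d z n))))))

  ∣a-b∣<n : ∀ a b → a ℕ.< n → b ℕ.< n → ℤ.∣ + a ℤ.- + b ∣ ℕ.< n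
  ∣a-b∣<n a b a<n b<n = subst (λ z → ℤ.∣ z ∣ ℕ.< n) (sym (ℤ.m-n≡m⊖n a b))
    (ℕ.≤-<-trans (ℤ.∣m⊝n∣≤m⊔n a b) (ℕ.⊔-pres-<m a<n b<n))

  ι-injective : ∀ {i j} → ι i ≋ ι j → i ≡ j
  ι-injective {i} {j} e = Fin.toℕ-injective (ℤ.+-injective
    (≋-small e (∣a-b∣<n (toℕ i) (toℕ j) (Fin.toℕ<n i) (Fin.toℕ<n j))))

  ≢0 : ∀ {k} → 0 ℕ.< k → k ℕ.< n → ¬ (+ k ≋ + 0)
  ≢0 {k} 0<k k<n e = ℕ.<⇒≢ 0<k (sym (ℤ.+-injective (≋-small e
    (subst (λ z → ℤ.∣ z ∣ ℕ.< n) (sym (ℤ.+-identityʳ (+ k))) k<n))))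

  -- The representative between `- m` and `m`. These 2m + 1 integers form a full residue system,
  -- reached by reducing `z + m` to the range from 0 to 2m and shifting back.
  centre : ℤ → ℤ
  centre z = ι [ z ℤ.+ + m ] ℤ.- + m

  centre≋ : ∀ z → centre z ≋ z
  centre≋ z = ≋-trans (≋-- ι[ z ℤ.+ + m ] (≋-refl {+ m})) (≋-reflexive (lem z (+ m)))
    where
    lem : ∀ z m → z ℤ.+ m ℤ.- m ≡ z
    lem = solve 2 (λ z m → z :+ m :- m := z) refl

  ∣centre∣≤m : ∀ z → ℤ.∣ centre z ∣ ℕ.≤ m
  ∣centre∣≤m z = subst (λ w → ℤ.∣ w ∣ ℕ.≤ m) (sym (ℤ.m-n≡m⊖n k m)) (bound (ℕ.s≤s⁻¹ (Fin.toℕ<n [ z ℤ.+ + m ])))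
    where
    k = toℕ [ z ℤ.+ + m ]
    bound : ∀ {k} → k ℕ.≤ m ℕ.+ m → ℤ.∣ k ℤ.⊖ m ∣ ℕ.≤ m
    bound {k} le with k ℕ.≤? m
    ... | yes k≤m = subst (ℕ._≤ m) (sym (ℤ.∣⊖∣-≤ k≤m)) (ℕ.m∸n≤m m k)
    ... | no k≰m  = subst (ℕ._≤ m) (sym (cong ℤ.∣_∣ (ℤ.⊖-≥ (ℕ.<⇒≤ (ℕ.≰⇒> k≰m)))))
                      (ℕ.m≤n+o⇒m∸n≤o k m le)

  δ : ℤ → ℕ
  δ z = ℤ.∣ centre z ∣

  δ-cong : ∀ {a b} → a ≋ b → δ a ≡ δ b
  δ-cong {a} {b} e = cong ℤ.∣_∣ (≋-unique (∣centre∣≤m a) (∣centre∣≤m b)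
    (≋-trans (centre≋ a) (≋-trans e (≋-sym (centre≋ b)))))

  δ-small : ∀ a → ℤ.∣ a ∣ ℕ.≤ m → δ a ≡ ℤ.∣ a ∣
  δ-small a h = cong ℤ.∣_∣ (≋-unique (∣centre∣≤m a) h (centre≋ a))

  -- With `δ-cong` this makes `δ` the least absolute value in a residue class, the fact behind the
  -- lower bound on distances.
  δ≤∣_∣ : ∀ a → δ a ℕ.≤ ℤ.∣ a ∣
  δ≤∣ a ∣ with ℤ.∣ a ∣ ℕ.≤? m
  ... | yes h = ℕ.≤-reflexive (δ-small a h)
  ... | no h  = ℕ.≤-trans (∣centre∣≤m a) (ℕ.<⇒≤ (ℕ.≰⇒> h))

  δ-neg : ∀ a → δ (ℤ.- a) ≡ δ a
  δ-neg a = begin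
    δ (ℤ.- a)            ≡⟨ δ-cong (≋-neg (≋-sym (centre≋ a))) ⟩
    δ (ℤ.- centre a)     ≡⟨ δ-small (ℤ.- centre a) (subst (ℕ._≤ m) (sym (ℤ.∣-i∣≡∣i∣ (centre a))) (∣centre∣≤m a)) ⟩
    ℤ.∣ ℤ.- centre a ∣   ≡⟨ ℤ.∣-i∣≡∣i∣ (centre a) ⟩
    δ a                  ∎
    where open ≡-Reasoning

  -- Since 2 (m + 1) = n + 1, multiplication by `suc m` inverts doubling modulo `n`.
  half : ℤ → ℤ
  half z = + suc m ℤ.* z

  half-double : ∀ z → half (z ℤ.+ z) ≋ z
  half-double z = mod z (trans (cong (ℤ._* (z ℤ.+ z)) (ℤ.pos-+ 1 m))
    (trans (lem z (+ m)) (cong (λ w → z ℤ.+ z ℤ.* w) (sym n≡))))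
    where
    n≡ : + n ≡ + 1 ℤ.+ (+ m ℤ.+ + m)
    n≡ = trans (ℤ.pos-+ 1 (m ℕ.+ m)) (cong (λ w → + 1 ℤ.+ w) (ℤ.pos-+ m m))
    lem : ∀ z m → (+ 1 ℤ.+ m) ℤ.* (z ℤ.+ z) ≡ z ℤ.+ z ℤ.* (+ 1 ℤ.+ (m ℤ.+ m))
    lem = solve 2 (λ z m → (con (+ 1) :+ m) :* (z :+ z) := z :+ z :* (con (+ 1) :+ (m :+ m))) refl

  double-injective : ∀ {a b} → a ℤ.+ a ≋ b ℤ.+ b → a ≋ b
  double-injective {a} {b} e =
    ≋-trans (≋-sym (half-double a)) (≋-trans (≋-* (+ suc m) e) (half-double b))

-- Commutative rings with an apartness from zero

record ApartnessRing : Set₁ where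
  field
    ring : CommutativeRing 0ℓ 0ℓ

  open CommutativeRing ring hiding (ring) public

  field
    fromℤ : CommutativeRing.rawRing ℤ.+-*-commutativeRing
              ACR.-Raw-AlmostCommutative⟶ ACR.fromCommutativeRing ring

  open ACR._-Raw-AlmostCommutative⟶_ fromℤ public

  ν : ℕ → Carrier
  ν k = ⟦ + k ⟧

  field
    NonZero     : Carrier → Set
    nz-cong     : ∀ {x y} → x ≈ y → NonZero x → NonZero y
    nz-*        : ∀ {x y} → NonZero x → NonZero y → NonZero (x * y)
    nz-*⁻ˡ      : ∀ {x y} → NonZero (x * y) → NonZero x
    -- Locality of the apartness: through `nz-sum` it picks a nonzero term out of a nonzero sum.
    nz-+⁻       : ∀ {x y} → NonZero (x + y) → NonZero x ⊎ NonZero y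
    ¬nz-0       : ¬ NonZero 0#
    -- The only trace of the order of the reals. It makes positive integers nonzero and separates
    -- the positive eigenvalue from the negative ones.
    nz-kz²+1    : ∀ k z → NonZero (ν k * (z * z) + 1#)
    nz-cancel   : ∀ {x y} → NonZero x → x * y ≈ 0# → y ≈ 0#

  open Algebra.Properties.Semiring.Sum semiring public
  open Relation.Binary.Reasoning.Setoid setoid public
  module Solver = Algebra.Solver.Ring (CommutativeRing.rawRing ℤ.+-*-commutativeRing)
    (ACR.fromCommutativeRing ring) fromℤ
    (λ x y → Maybe.map (λ e → reflexive (cong ⟦_⟧ e)) (dec⇒maybe (x ℤ.≟ y)))

  nz-neg : ∀ {x} → NonZero x → NonZero (- x)
  nz-neg {x} h = nz-*⁻ˡ {y = - 1#} (nz-cong (lem x 1# (*-identityʳ x)) h)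
    where
    lem : ∀ x e → x * e ≈ x → x ≈ - x * - e
    lem x e h = trans (sym h) (solve 2 (λ x e → x :* e := :- x :* :- e) refl x e)
      where open Solver

  nz-ν : ∀ k → NonZero (ν (suc k))
  nz-ν k = nz-cong (begin
    ν k * (1# * 1#) + 1#  ≈⟨ +-congʳ (trans (*-congˡ (*-identityˡ 1#)) (*-identityʳ (ν k))) ⟩
    ν k + 1#              ≈⟨ +-congˡ 1-homo ⟨
    ν k + ν 1             ≈⟨ +-comm (ν k) (ν 1) ⟩
    ν 1 + ν k             ≈⟨ +-homo (+ 1) (+ k) ⟨
    ν (suc k)             ∎) (nz-kz²+1 k 1#)

  nz-sum : ∀ {k} (f : Fin k → Carrier) → NonZero (sum f) → ∃[ i ] NonZero (f i)
  nz-sum {zero}  f h = contradiction h ¬nz-0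
  nz-sum {suc k} f h with nz-+⁻ h
  ... | inj₁ h₀ = Fin.zero , h₀
  ... | inj₂ h₁ = let (i , hᵢ) = nz-sum (f ∘ Fin.suc) h₁ in Fin.suc i , hᵢ

  x-y≈0⇒x≈y : ∀ {x y} → x - y ≈ 0# → x ≈ y
  x-y≈0⇒x≈y {x} {y} h = begin
    x          ≈⟨ solve 2 (λ x y → x := (x :- y) :+ y) refl x y ⟩
    x - y + y  ≈⟨ +-congʳ h ⟩
    0# + y     ≈⟨ +-identityˡ y ⟩
    y          ∎
    where open Solver

  x≈y⇒x-y≈0 : ∀ {x y} → x ≈ y → x - y ≈ 0#
  x≈y⇒x-y≈0 {x} {y} h = trans (+-congʳ h) (-‿inverseʳ y)

  ν-suc : ∀ k → ν (suc k) ≈ ν 1 + ν k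
  ν-suc k = +-homo (+ 1) (+ k)

  -- Sums

  ∑-cong : ∀ {k} {f g : Fin k → Carrier} → (∀ i → f i ≈ g i) → sum f ≈ sum g
  ∑-cong = sum-cong-≋

  ∑-zero : ∀ {k} {f : Fin k → Carrier} → (∀ i → f i ≈ 0#) → sum f ≈ 0#
  ∑-zero {k} h = trans (∑-cong h) (sum-replicate-zero k)

  ∑-const : ∀ k x → sum {k} (λ _ → x) ≈ ν k * x
  ∑-const zero x = sym (trans (*-congʳ 0-homo) (zeroˡ x))
  ∑-const (suc k) x = begin
    x + sum {k} (λ _ → x)  ≈⟨ +-congˡ (∑-const k x) ⟩
    x + ν k * x            ≈⟨ solve 2 (λ x k → x :+ k :* x := (con (+ 1) :+ k) :* x) refl x (ν k) ⟩
    (ν 1 + ν k) * x        ≈⟨ *-congʳ (ν-suc k) ⟨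
    ν (suc k) * x          ∎
    where open Solver

  ∑-single : ∀ {k} (f : Fin k → Carrier) i → (∀ j → j ≢ i → f j ≈ 0#) → sum f ≈ f i
  ∑-single f Fin.zero h = trans (+-congˡ (∑-zero λ j → h (Fin.suc j) λ ())) (+-identityʳ (f Fin.zero))
  ∑-single f (Fin.suc i) h = begin
    f Fin.zero + sum (f ∘ Fin.suc)  ≈⟨ +-congʳ (h Fin.zero λ ()) ⟩
    0# + sum (f ∘ Fin.suc)          ≈⟨ +-identityˡ _ ⟩
    sum (f ∘ Fin.suc)               ≈⟨ ∑-single (f ∘ Fin.suc) i (λ j j≢i → h (Fin.suc j) (j≢i ∘ Fin.suc-injective)) ⟩
    f (Fin.suc i)                   ∎

  ∑∑-* : ∀ {k l} (f : Fin k → Carrier) (g : Fin l → Carrier) →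
    sum (λ i → sum (λ j → f i * g j)) ≈ sum f * sum g
  ∑∑-* f g = begin
    sum (λ i → sum (λ j → f i * g j))  ≈⟨ ∑-cong (λ i → *-distribˡ-sum (f i) g) ⟨
    sum (λ i → f i * sum g)            ≈⟨ *-distribʳ-sum (sum g) f ⟨
    sum f * sum g                      ∎

  ∑-last : ∀ k (g : ℕ → Carrier) → sum {suc k} (g ∘ toℕ) ≈ sum {k} (g ∘ toℕ) + g k
  ∑-last zero    g = +-comm (g 0) 0#
  ∑-last (suc k) g = begin
    g 0 + sum {suc k} (g ∘ suc ∘ toℕ)          ≈⟨ +-congˡ (∑-last k (g ∘ suc)) ⟩
    g 0 + (sum {k} (g ∘ suc ∘ toℕ) + g (suc k)) ≈⟨ +-assoc _ _ _ ⟨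
    sum {suc k} (g ∘ toℕ) + g (suc k)           ∎

  ∑-++ : ∀ k l (f : Fin (k ℕ.+ l) → Carrier) →
    sum f ≈ sum (λ i → f (i Fin.↑ˡ l)) + sum (λ j → f (k Fin.↑ʳ j))
  ∑-++ zero    l f = sym (+-identityˡ (sum f))
  ∑-++ (suc k) l f = trans (+-congˡ (∑-++ k l (f ∘ Fin.suc))) (sym (+-assoc _ _ _))

  ∑-remQuot : ∀ k l (F : Fin k × Fin l → Carrier) →
    sum {k ℕ.* l} (F ∘ Fin.remQuot l) ≈ sum (λ i → sum (λ j → F (i , j)))
  ∑-remQuot zero    l F = refl
  ∑-remQuot (suc k) l F = begin
    sum (F ∘ Fin.remQuot l)
      ≈⟨ ∑-++ l (k ℕ.* l) (F ∘ Fin.remQuot {suc k} l) ⟩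
    sum (λ j → F (Fin.remQuot {suc k} l (j Fin.↑ˡ (k ℕ.* l)))) + sum (λ i → F (Fin.remQuot {suc k} l (l Fin.↑ʳ i)))
      ≈⟨ +-cong (∑-cong λ j → reflexive (cong F (first j)))
                (∑-cong λ i → reflexive (cong F (rest i))) ⟩
    sum (λ j → F (Fin.zero , j)) + sum (F ∘ next ∘ Fin.remQuot {k} l)
      ≈⟨ +-congˡ (∑-remQuot k l (F ∘ next)) ⟩
    sum (λ j → F (Fin.zero , j)) + sum (λ i → sum (λ j → F (Fin.suc i , j))) ∎
    where
    next : Fin k × Fin l → Fin (suc k) × Fin l
    next (i , j) = Fin.suc i , j
    first : ∀ j → Fin.remQuot {suc k} l (j Fin.↑ˡ (k ℕ.* l)) ≡ (Fin.zero , j)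
    first j rewrite Fin.splitAt-↑ˡ l j (k ℕ.* l) = ≡.refl
    rest : ∀ i → Fin.remQuot {suc k} l (l Fin.↑ʳ i) ≡ next (Fin.remQuot {k} l i)
    rest i rewrite Fin.splitAt-↑ʳ l (k ℕ.* l) i = ≡.refl

  -- Composing `π` with the standard enumeration of pairs gives a bijection of index sets, under
  -- which sums are invariant.
  ∑-↔ : ∀ {N k l} (π : Fin N ↔ (Fin k × Fin l)) (F : Fin k × Fin l → Carrier) →
    sum (F ∘ Inverse.to π) ≈ sum (λ i → sum (λ j → F (i , j)))
  ∑-↔ {N} {k} {l} π F = begin
    sum (F ∘ Inverse.to π)
      ≈⟨ ∑-cong (λ i → reflexive (cong F (Inverse.strictlyInverseˡ Fin.*↔× (Inverse.to π i)))) ⟨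
    sum (F ∘ Fin.remQuot l ∘ Inverse.from Fin.*↔× ∘ Inverse.to π)
      ≈⟨ sum-permute (F ∘ Fin.remQuot l) (↔-sym Fin.*↔× ↔-∘ π) ⟨
    sum {k ℕ.* l} (F ∘ Fin.remQuot l)
      ≈⟨ ∑-remQuot k l F ⟩
    sum (λ i → sum (λ j → F (i , j))) ∎

-- Cosines generated by a root of the Dirichlet kernel

module ApartnessAlgebra (A : ApartnessRing) where

  open ApartnessRing A

  -- A rotation of order n = 2m + 1: c = 2 cos (2π/n) as a root of the Dirichlet
  -- kernel p m, where p k = sin ((2k+1)θ/2) / sin (θ/2) and c = 2 cos θ.
  module Rotation (m-1 : ℕ) (c : Carrier)
    (p : ℕ → Carrier)
    (p₀ : p 0 ≈ 1#) (p₁ : p 1 ≈ c + 1#) (pₖ : ∀ k → p (2 ℕ.+ k) ≈ c * p (1 ℕ.+ k) - p k)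
    (pₘ≈0 : p (suc m-1) ≈ 0#) (p≉0 : ∀ k → k ℕ.< suc m-1 → NonZero (p k))
    (p+2≉0 : NonZero (p m-1 + ν 2))
    where

    m : ℕ
    m = suc m-1

    open Cyclic m

    -- t z = 2 cos (zθ)
    tℕ : ℕ → Carrier
    tℕ zero          = ν 2
    tℕ (suc zero)    = c
    tℕ (suc (suc k)) = c * tℕ (suc k) - tℕ k

    t : ℤ → Carrier
    t z = tℕ ℤ.∣ z ∣

    t-≡ : ∀ {a b} → a ≡ b → t a ≈ t b
    t-≡ e = reflexive (cong t e)

    t-neg : ∀ a → t (ℤ.- a) ≈ t a
    t-neg a = reflexive (cong tℕ (ℤ.∣-i∣≡∣i∣ a))

    t-step : ∀ z → t (ℤ.suc z) + t (ℤ.pred z) ≈ c * t z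
    t-step (+ zero) = solve 1 (λ c → c :+ c := c :* con (+ 2)) refl c
      where open Solver
    t-step (+ suc k) = solve 3 (λ c x y → c :* x :- y :+ y := c :* x) refl c (tℕ (suc k)) (tℕ k)
      where open Solver
    t-step -[1+ zero ] = solve 1 (λ c → con (+ 2) :+ (c :* c :- con (+ 2)) := c :* c) refl c
      where open Solver
    t-step -[1+ suc k ] = solve 3 (λ c x y → y :+ (c :* x :- y) := c :* x) refl c (tℕ (2 ℕ.+ k)) (tℕ (suc k))
      where open Solver

    t-suc : ∀ z → t (ℤ.suc z) ≈ c * t z - t (ℤ.pred z)
    t-suc z = trans (solve 2 (λ x y → x := x :+ y :- y) refl (t (ℤ.suc z)) (t (ℤ.pred z))) (+-congʳ (t-step z))
      where open Solver

    t-pred : ∀ z → t (ℤ.pred z) ≈ c * t z - t (ℤ.suc z)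
    t-pred z = trans (solve 2 (λ x y → y := x :+ y :- x) refl (t (ℤ.suc z)) (t (ℤ.pred z))) (+-congʳ (t-step z))
      where open Solver

    -- Product-to-sum formula for cosines. Its case `k = 1` is the recurrence `t-step`, and the
    -- induction uses the two preceding cases.
    t-*ℕ : ∀ a k → t a * tℕ k ≈ t (a ℤ.+ + k) + t (a ℤ.- + k)
    t-*ℕ a zero = begin
      t a * ν 2                      ≈⟨ solve 1 (λ x → x :* con (+ 2) := x :+ x) refl (t a) ⟩
      t a + t a                      ≈⟨ +-cong (t-≡ (ℤ.+-identityʳ a)) (t-≡ (ℤ.+-identityʳ a)) ⟨
      t (a ℤ.+ + 0) + t (a ℤ.- + 0)  ∎
      where open Solver
    t-*ℕ a (suc zero) = begin
      t a * c                        ≈⟨ *-comm (t a) c ⟩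
      c * t a                        ≈⟨ t-step a ⟨
      t (ℤ.suc a) + t (ℤ.pred a)     ≈⟨ +-cong (t-≡ (ℤ.+-comm (+ 1) a)) (t-≡ (ℤ.+-comm (ℤ.- + 1) a)) ⟩
      t (a ℤ.+ + 1) + t (a ℤ.- + 1)  ∎
    t-*ℕ a (suc (suc k)) = begin
      t a * (c * tℕ (suc k) - tℕ k)
        ≈⟨ solve 4 (λ x c y z → x :* (c :* y :- z) := c :* (x :* y) :- x :* z) refl (t a) c (tℕ (suc k)) (tℕ k) ⟩
      c * (t a * tℕ (suc k)) - t a * tℕ k
        ≈⟨ +-cong (*-congˡ (t-*ℕ a (suc k))) (-‿cong (t-*ℕ a k)) ⟩
      c * (t u + t v) - (t (a ℤ.+ + k) + t (a ℤ.- + k))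
        ≈⟨ +-congʳ (distribˡ c (t u) (t v)) ⟩
      c * t u + c * t v - (t (a ℤ.+ + k) + t (a ℤ.- + k))
        ≈⟨ +-congʳ (+-cong (t-step u) (t-step v)) ⟨
      (t (ℤ.suc u) + t (ℤ.pred u)) + (t (ℤ.suc v) + t (ℤ.pred v)) - (t (a ℤ.+ + k) + t (a ℤ.- + k))
        ≈⟨ +-congʳ (+-cong (+-cong (t-≡ (e₁ a (+ k))) (t-≡ (e₂ a (+ k)))) (+-cong (t-≡ (e₃ a (+ k))) (t-≡ (e₄ a (+ k))))) ⟩
      (t (a ℤ.+ + (2 ℕ.+ k)) + t (a ℤ.+ + k)) + (t (a ℤ.- + k) + t (a ℤ.- + (2 ℕ.+ k))) - (t (a ℤ.+ + k) + t (a ℤ.- + k))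
        ≈⟨ solve 4 (λ w x y z → (w :+ x) :+ (y :+ z) :- (x :+ y) := w :+ z) refl
             (t (a ℤ.+ + (2 ℕ.+ k))) (t (a ℤ.+ + k)) (t (a ℤ.- + k)) (t (a ℤ.- + (2 ℕ.+ k))) ⟩
      t (a ℤ.+ + (2 ℕ.+ k)) + t (a ℤ.- + (2 ℕ.+ k)) ∎
      where
      u = a ℤ.+ + suc k
      v = a ℤ.- + suc k
      open Solver
      module Z = ℤ.+-*-Solver
      e₁ : ∀ a k → + 1 ℤ.+ (a ℤ.+ (+ 1 ℤ.+ k)) ≡ a ℤ.+ (+ 2 ℤ.+ k)
      e₁ = Z.solve 2 (λ a k → Z.con (+ 1) Z.:+ (a Z.:+ (Z.con (+ 1) Z.:+ k)) Z.:= a Z.:+ (Z.con (+ 2) Z.:+ k)) ≡.refl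
      e₂ : ∀ a k → ℤ.- + 1 ℤ.+ (a ℤ.+ (+ 1 ℤ.+ k)) ≡ a ℤ.+ k
      e₂ = Z.solve 2 (λ a k → Z.con (ℤ.- + 1) Z.:+ (a Z.:+ (Z.con (+ 1) Z.:+ k)) Z.:= a Z.:+ k) ≡.refl
      e₃ : ∀ a k → + 1 ℤ.+ (a ℤ.- (+ 1 ℤ.+ k)) ≡ a ℤ.- k
      e₃ = Z.solve 2 (λ a k → Z.con (+ 1) Z.:+ (a Z.:- (Z.con (+ 1) Z.:+ k)) Z.:= a Z.:- k) ≡.refl
      e₄ : ∀ a k → ℤ.- + 1 ℤ.+ (a ℤ.- (+ 1 ℤ.+ k)) ≡ a ℤ.- (+ 2 ℤ.+ k)
      e₄ = Z.solve 2 (λ a k → Z.con (ℤ.- + 1) Z.:+ (a Z.:- (Z.con (+ 1) Z.:+ k)) Z.:= a Z.:- (Z.con (+ 2) Z.:+ k)) ≡.refl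

    t-* : ∀ a b → t a * t b ≈ t (a ℤ.+ b) + t (a ℤ.- b)
    t-* a (+ k)    = t-*ℕ a k
    t-* a -[1+ k ] = trans (t-*ℕ a (suc k)) (+-comm _ _)

    -- With half angles, both sides are the square of 4 sin ((a+b)θ/2) sin ((a-b)θ/2). Apartness of
    -- two cosines thus reduces to that of `ν 2 - t z`.
    t-difference² : ∀ a b → (t a - t b) * (t a - t b) ≈ (ν 2 - t (a ℤ.+ b)) * (ν 2 - t (a ℤ.- b))
    t-difference² a b = begin
      (t a - t b) * (t a - t b)
        ≈⟨ solve 2 (λ x y → (x :- y) :* (x :- y) := x :* x :+ y :* y :- con (+ 2) :* (x :* y)) refl (t a) (t b) ⟩
      t a * t a + t b * t b - ν 2 * (t a * t b)
        ≈⟨ +-cong (+-cong (t-* a a) (t-* b b)) (-‿cong (*-congˡ (t-* a b))) ⟩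
      (t (a ℤ.+ a) + t (a ℤ.- a)) + (t (b ℤ.+ b) + t (b ℤ.- b)) - ν 2 * (t (a ℤ.+ b) + t (a ℤ.- b))
        ≈⟨ +-congʳ (+-cong (+-congˡ (t-≡ (ℤ.+-inverseʳ a))) (+-congˡ (t-≡ (ℤ.+-inverseʳ b)))) ⟩
      (t (a ℤ.+ a) + ν 2) + (t (b ℤ.+ b) + ν 2) - ν 2 * (t (a ℤ.+ b) + t (a ℤ.- b))
        ≈⟨ solve 4 (λ x y z w → (x :+ con (+ 2)) :+ (y :+ con (+ 2)) :- con (+ 2) :* (z :+ w)
             := con (+ 4) :- con (+ 2) :* (z :+ w) :+ (x :+ y)) refl
             (t (a ℤ.+ a)) (t (b ℤ.+ b)) (t (a ℤ.+ b)) (t (a ℤ.- b)) ⟩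
      ν 4 - ν 2 * (t (a ℤ.+ b) + t (a ℤ.- b)) + (t (a ℤ.+ a) + t (b ℤ.+ b))
        ≈⟨ +-congˡ (+-cong (t-≡ (s₁ a b)) (t-≡ (s₂ a b))) ⟩
      ν 4 - ν 2 * (t (a ℤ.+ b) + t (a ℤ.- b)) + (t ((a ℤ.+ b) ℤ.+ (a ℤ.- b)) + t ((a ℤ.+ b) ℤ.- (a ℤ.- b)))
        ≈⟨ +-congˡ (t-* (a ℤ.+ b) (a ℤ.- b)) ⟨
      ν 4 - ν 2 * (t (a ℤ.+ b) + t (a ℤ.- b)) + t (a ℤ.+ b) * t (a ℤ.- b)
        ≈⟨ solve 2 (λ z w → con (+ 4) :- con (+ 2) :* (z :+ w) :+ z :* w := (con (+ 2) :- z) :* (con (+ 2) :- w)) refl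
             (t (a ℤ.+ b)) (t (a ℤ.- b)) ⟩
      (ν 2 - t (a ℤ.+ b)) * (ν 2 - t (a ℤ.- b)) ∎
      where
      open Solver
      module Z = ℤ.+-*-Solver
      s₁ : ∀ a b → a ℤ.+ a ≡ (a ℤ.+ b) ℤ.+ (a ℤ.- b)
      s₁ = Z.solve 2 (λ a b → a Z.:+ a Z.:= (a Z.:+ b) Z.:+ (a Z.:- b)) ≡.refl
      s₂ : ∀ a b → b ℤ.+ b ≡ (a ℤ.+ b) ℤ.- (a ℤ.- b)
      s₂ = Z.solve 2 (λ a b → b Z.:+ b Z.:= (a Z.:+ b) Z.:- (a Z.:- b)) ≡.refl

    -- Here `c - ν 2` stands for -4 sin² (θ/2), and both sides obey the same three-term recurrence.
    -- A zero of `p k` is a coincidence of two consecutive cosines.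
    t-difference : ∀ k → tℕ (suc k) - tℕ k ≈ (c - ν 2) * p k
    t-difference zero = sym (trans (*-congˡ p₀) (*-identityʳ _))
    t-difference (suc zero) = begin
      c * c - ν 2 - c            ≈⟨ solve 1 (λ c → c :* c :- con (+ 2) :- c := (c :- con (+ 2)) :* (c :+ con (+ 1))) refl c ⟩
      (c - ν 2) * (c + ν 1)      ≈⟨ *-congˡ (+-congˡ 1-homo) ⟩
      (c - ν 2) * (c + 1#)       ≈⟨ *-congˡ p₁ ⟨
      (c - ν 2) * p 1            ∎
      where open Solver
    t-difference (suc (suc k)) = begin
      (c * tℕ (2 ℕ.+ k) - tℕ (suc k)) - (c * tℕ (suc k) - tℕ k)
        ≈⟨ solve 4 (λ c x y z → (c :* x :- y) :- (c :* y :- z) := c :* (x :- y) :- (y :- z)) refl c (tℕ (2 ℕ.+ k)) (tℕ (suc k)) (tℕ k) ⟩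
      c * (tℕ (2 ℕ.+ k) - tℕ (suc k)) - (tℕ (suc k) - tℕ k)
        ≈⟨ +-cong (*-congˡ (t-difference (suc k))) (-‿cong (t-difference k)) ⟩
      c * ((c - ν 2) * p (suc k)) - (c - ν 2) * p k
        ≈⟨ solve 4 (λ c d x y → c :* (d :* x) :- d :* y := d :* (c :* x :- y)) refl c (c - ν 2) (p (suc k)) (p k) ⟩
      (c - ν 2) * (c * p (suc k) - p k)
        ≈⟨ *-congˡ (pₖ k) ⟨
      (c - ν 2) * p (2 ℕ.+ k) ∎
      where open Solver

    -- Since `p (suc k) - p k` is `tℕ (suc k)`, this is `t-difference` telescoped from 0 to `k`,
    -- proved by an induction on `p` itself.
    p-difference : ∀ k → p (suc k) - p k - ν 2 ≈ (c - ν 2) * sum {suc k} (p ∘ toℕ)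
    p-difference zero = begin
      p 1 - p 0 - ν 2           ≈⟨ +-congʳ (+-cong p₁ (-‿cong p₀)) ⟩
      c + 1# - 1# - ν 2         ≈⟨ solve 3 (λ c e d → c :+ e :- e :- d := c :- d) refl c 1# (ν 2) ⟩
      c - ν 2                   ≈⟨ *-identityʳ _ ⟨
      (c - ν 2) * 1#            ≈⟨ *-congˡ (trans (+-identityʳ _) p₀) ⟨
      (c - ν 2) * (p 0 + 0#)    ∎
      where open Solver
    p-difference (suc k) = begin
      p (2 ℕ.+ k) - p (suc k) - ν 2
        ≈⟨ +-congʳ (+-congʳ (pₖ k)) ⟩
      c * p (suc k) - p k - p (suc k) - ν 2
        ≈⟨ solve 3 (λ c x y → c :* x :- y :- x :- con (+ 2) := (x :- y :- con (+ 2)) :+ (c :- con (+ 2)) :* x) refl c (p (suc k)) (p k) ⟩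
      (p (suc k) - p k - ν 2) + (c - ν 2) * p (suc k)
        ≈⟨ +-congʳ (p-difference k) ⟩
      (c - ν 2) * sum {suc k} (p ∘ toℕ) + (c - ν 2) * p (suc k)
        ≈⟨ distribˡ _ _ _ ⟨
      (c - ν 2) * (sum {suc k} (p ∘ toℕ) + p (suc k))
        ≈⟨ *-congˡ (∑-last (suc k) p) ⟨
      (c - ν 2) * sum {2 ℕ.+ k} (p ∘ toℕ) ∎
      where open Solver

    -- At `p m ≈ 0`, `p-difference` exhibits `c - ν 2` as a factor of `- (p m-1 + ν 2)`, and a
    -- factor of a nonzero element is nonzero.
    c-2≉0 : NonZero (c - ν 2)
    c-2≉0 = nz-*⁻ˡ (nz-cong (begin
      - (p m-1 + ν 2)        ≈⟨ solve 2 (λ x z → :- (x :+ con (+ 2)) := con (+ 0) :- x :- con (+ 2)) refl (p m-1) 0# ⟩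
      ν 0 - p m-1 - ν 2      ≈⟨ +-congʳ (+-congʳ (trans 0-homo (sym pₘ≈0))) ⟩
      p m - p m-1 - ν 2      ≈⟨ p-difference m-1 ⟩
      (c - ν 2) * sum {m} (p ∘ toℕ) ∎) (nz-neg p+2≉0))
      where open Solver

    -- The reflection i ↦ 2m + 1 - i, written around its centre.
    t-reflect : ∀ k → (t (+ m ℤ.+ + k) ≈ t (+ 1 ℤ.+ + m ℤ.- + k)) ×
                      (t (+ 1 ℤ.+ + m ℤ.+ + k) ≈ t (+ m ℤ.- + k))
    t-reflect zero = trans (t-≡ (ℤ.+-identityʳ (+ m))) (trans (sym h) (t-≡ (≡.sym (ℤ.+-identityʳ (+ suc m))))) ,
                     trans (t-≡ (ℤ.+-identityʳ (+ suc m))) (trans h (t-≡ (≡.sym (ℤ.+-identityʳ (+ m)))))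
      where
      -- The vanishing of `p m` makes the two values next to the centre of reflection agree; the
      -- recurrence spreads this outwards.
      h : t (+ suc m) ≈ t (+ m)
      h = x-y≈0⇒x≈y (trans (t-difference m) (trans (*-congˡ pₘ≈0) (zeroʳ _)))
    t-reflect (suc k) =
      trans (t-≡ (e₁ (+ m) (+ k))) (trans h₁ (t-≡ (e₂ (+ m) (+ k)))) ,
      (begin
        t (+ 1 ℤ.+ + m ℤ.+ + suc k)             ≈⟨ t-≡ (e₃ (+ m) (+ k)) ⟩
        t (ℤ.suc u)                             ≈⟨ t-suc u ⟩
        c * t u - t (ℤ.pred u)                  ≈⟨ +-cong (*-congˡ h₁) (-‿cong (trans (t-≡ (e₄ (+ m) (+ k))) (trans h₀ (t-≡ (e₅ (+ m) (+ k)))))) ⟩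
        c * t v - t (ℤ.suc v)                   ≈⟨ t-pred v ⟨
        t (ℤ.pred v)                            ≈⟨ t-≡ (e₆ (+ m) (+ k)) ⟩
        t (+ m ℤ.- + suc k)                     ∎)
      where
      u = + 1 ℤ.+ + m ℤ.+ + k
      v = + m ℤ.- + k
      h₀ = proj₁ (t-reflect k)
      h₁ = proj₂ (t-reflect k)
      open ℤ.+-*-Solver
      e₁ : ∀ m k → m ℤ.+ (+ 1 ℤ.+ k) ≡ + 1 ℤ.+ m ℤ.+ k
      e₁ = solve 2 (λ m k → m :+ (con (+ 1) :+ k) := con (+ 1) :+ m :+ k) ≡.refl
      e₂ : ∀ m k → m ℤ.- k ≡ + 1 ℤ.+ m ℤ.- (+ 1 ℤ.+ k)
      e₂ = solve 2 (λ m k → m :- k := con (+ 1) :+ m :- (con (+ 1) :+ k)) ≡.refl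
      e₃ : ∀ m k → + 1 ℤ.+ m ℤ.+ (+ 1 ℤ.+ k) ≡ + 1 ℤ.+ (+ 1 ℤ.+ m ℤ.+ k)
      e₃ = solve 2 (λ m k → con (+ 1) :+ m :+ (con (+ 1) :+ k) := con (+ 1) :+ (con (+ 1) :+ m :+ k)) ≡.refl
      e₄ : ∀ m k → ℤ.- + 1 ℤ.+ (+ 1 ℤ.+ m ℤ.+ k) ≡ m ℤ.+ k
      e₄ = solve 2 (λ m k → con (ℤ.- + 1) :+ (con (+ 1) :+ m :+ k) := m :+ k) ≡.refl
      e₅ : ∀ m k → + 1 ℤ.+ m ℤ.- k ≡ + 1 ℤ.+ (m ℤ.- k)
      e₅ = solve 2 (λ m k → con (+ 1) :+ m :- k := con (+ 1) :+ (m :- k)) ≡.refl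
      e₆ : ∀ m k → ℤ.- + 1 ℤ.+ (m ℤ.- k) ≡ m ℤ.- (+ 1 ℤ.+ k)
      e₆ = solve 2 (λ m k → con (ℤ.- + 1) :+ (m :- k) := m :- (con (+ 1) :+ k)) ≡.refl

    -- Translation by `n` is the reflection of `t-reflect` composed with a change of sign. Cases are
    -- split so that the offset from the centre is a natural number.
    t-+n : ∀ z → t (z ℤ.+ + n) ≈ t z
    t-+n (+ k) = begin
      t (+ k ℤ.+ + n)                       ≈⟨ t-≡ (e₁ (+ k) (+ m)) ⟩
      t (+ 1 ℤ.+ + m ℤ.+ + (m ℕ.+ k))       ≈⟨ proj₂ (t-reflect (m ℕ.+ k)) ⟩
      t (+ m ℤ.- + (m ℕ.+ k))               ≈⟨ t-≡ (e₂ (+ m) (+ k)) ⟩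
      t (ℤ.- + k)                           ≈⟨ t-neg (+ k) ⟩
      t (+ k)                               ∎
      where
      open ℤ.+-*-Solver
      e₁ : ∀ k m → k ℤ.+ (+ 1 ℤ.+ (m ℤ.+ m)) ≡ + 1 ℤ.+ m ℤ.+ (m ℤ.+ k)
      e₁ = solve 2 (λ k m → k :+ (con (+ 1) :+ (m :+ m)) := con (+ 1) :+ m :+ (m :+ k)) ≡.refl
      e₂ : ∀ m k → m ℤ.- (m ℤ.+ k) ≡ ℤ.- k
      e₂ = solve 2 (λ m k → m :- (m :+ k) := :- k) ≡.refl
    t-+n -[1+ k ] with suc k ℕ.≤? m
    ... | yes k<m = begin
      t (ℤ.- + suc k ℤ.+ + n)               ≈⟨ t-≡ (e₁ (+ suc k) (+ m)) ⟩
      t (+ 1 ℤ.+ + m ℤ.+ (+ m ℤ.- + suc k)) ≈⟨ t-≡ (cong (λ z → + 1 ℤ.+ + m ℤ.+ z) i≡) ⟩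
      t (+ 1 ℤ.+ + m ℤ.+ + (m ℕ.∸ suc k))   ≈⟨ proj₂ (t-reflect (m ℕ.∸ suc k)) ⟩
      t (+ m ℤ.- + (m ℕ.∸ suc k))           ≈⟨ t-≡ (cong (λ z → + m ℤ.- z) i≡) ⟨
      t (+ m ℤ.- (+ m ℤ.- + suc k))         ≈⟨ t-≡ (e₂ (+ m) (+ suc k)) ⟩
      t (+ suc k)                           ∎
      where
      i≡ : + m ℤ.- + suc k ≡ + (m ℕ.∸ suc k)
      i≡ = ≡.trans (ℤ.m-n≡m⊖n m (suc k)) (ℤ.⊖-≥ k<m)
      open ℤ.+-*-Solver
      e₁ : ∀ k m → ℤ.- k ℤ.+ (+ 1 ℤ.+ (m ℤ.+ m)) ≡ + 1 ℤ.+ m ℤ.+ (m ℤ.- k)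
      e₁ = solve 2 (λ k m → :- k :+ (con (+ 1) :+ (m :+ m)) := con (+ 1) :+ m :+ (m :- k)) ≡.refl
      e₂ : ∀ m k → m ℤ.- (m ℤ.- k) ≡ k
      e₂ = solve 2 (λ m k → m :- (m :- k) := k) ≡.refl
    ... | no k≮m = begin
      t (ℤ.- + suc k ℤ.+ + n)               ≈⟨ t-≡ (e₁ (+ suc k) (+ m)) ⟩
      t (+ m ℤ.- (+ suc k ℤ.- + suc m))     ≈⟨ t-≡ (cong (λ z → + m ℤ.- z) i≡) ⟩
      t (+ m ℤ.- + (suc k ℕ.∸ suc m))       ≈⟨ proj₂ (t-reflect (suc k ℕ.∸ suc m)) ⟨
      t (+ 1 ℤ.+ + m ℤ.+ + (suc k ℕ.∸ suc m)) ≈⟨ t-≡ (cong (λ z → + 1 ℤ.+ + m ℤ.+ z) i≡) ⟨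
      t (+ 1 ℤ.+ + m ℤ.+ (+ suc k ℤ.- + suc m)) ≈⟨ t-≡ (e₂ (+ m) (+ suc k)) ⟩
      t (+ suc k)                           ∎
      where
      i≡ : + suc k ℤ.- + suc m ≡ + (suc k ℕ.∸ suc m)
      i≡ = ≡.trans (ℤ.m-n≡m⊖n (suc k) (suc m)) (ℤ.⊖-≥ (ℕ.≰⇒> k≮m))
      open ℤ.+-*-Solver
      e₁ : ∀ k m → ℤ.- k ℤ.+ (+ 1 ℤ.+ (m ℤ.+ m)) ≡ m ℤ.- (k ℤ.- (+ 1 ℤ.+ m))
      e₁ = solve 2 (λ k m → :- k :+ (con (+ 1) :+ (m :+ m)) := m :- (k :- (con (+ 1) :+ m))) ≡.refl
      e₂ : ∀ m k → + 1 ℤ.+ m ℤ.+ (k ℤ.- (+ 1 ℤ.+ m)) ≡ k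
      e₂ = solve 2 (λ m k → con (+ 1) :+ m :+ (k :- (con (+ 1) :+ m)) := k) ≡.refl

    t-+kn : ∀ k b → t (b ℤ.+ + k ℤ.* + n) ≈ t b
    t-+kn zero    b = t-≡ (ℤ.+-identityʳ b)
    t-+kn (suc k) b = begin
      t (b ℤ.+ + suc k ℤ.* + n)          ≈⟨ t-≡ (e b (+ k) (+ n)) ⟩
      t (b ℤ.+ + k ℤ.* + n ℤ.+ + n)      ≈⟨ t-+n (b ℤ.+ + k ℤ.* + n) ⟩
      t (b ℤ.+ + k ℤ.* + n)              ≈⟨ t-+kn k b ⟩
      t b                                ∎
      where
      open ℤ.+-*-Solver
      e : ∀ b k n → b ℤ.+ (+ 1 ℤ.+ k) ℤ.* n ≡ b ℤ.+ k ℤ.* n ℤ.+ n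
      e = solve 3 (λ b k n → b :+ (con (+ 1) :+ k) :* n := b :+ k :* n :+ n) ≡.refl

    t-≋ : ∀ {a b} → a ≋ b → t a ≈ t b
    t-≋ {b = b} (mod (+ k) ≡.refl)    = t-+kn k b
    t-≋ {b = b} (mod -[1+ k ] ≡.refl) = trans (sym (t-+kn (suc k) (b ℤ.+ -[1+ k ] ℤ.* + n))) (t-≡ (e b (+ suc k) (+ n)))
      where
      open ℤ.+-*-Solver
      e : ∀ b k n → b ℤ.+ (ℤ.- k) ℤ.* n ℤ.+ k ℤ.* n ≡ b
      e = solve 3 (λ b k n → b :+ (:- k) :* n :+ k :* n := b) ≡.refl

    -- The numbers `suc j` and `j` have sum 2j + 1, so `ν 2 - t (2j + 1)` divides the square of
    -- `tℕ (suc j) - tℕ j`, which is `(c - ν 2) * p j` squared.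
    2-t-odd≉0 : ∀ j → j ℕ.< m → NonZero (ν 2 - tℕ (suc (j ℕ.+ j)))
    2-t-odd≉0 j j<m = nz-*⁻ˡ (nz-cong (t-difference² (+ suc j) (+ j)) (nz-* h h))
      where
      h : NonZero (t (+ suc j) - t (+ j))
      h = nz-cong (sym (t-difference j)) (nz-* c-2≉0 (p≉0 j j<m))

    -- Reduce to a residue `r` below `n`. An even `r` is exchanged for the odd number `n - r`, where
    -- `t` has the same value.
    2-t≉0 : ∀ z → ¬ (z ≋ + 0) → NonZero (ν 2 - t z)
    2-t≉0 z z≢0 = nz-cong (+-congˡ (-‿cong (t-≋ ι[ z ]))) (go (toℕ [ z ]) (Fin.toℕ<n [ z ])
        (λ e → z≢0 (≋-trans (≋-sym ι[ z ]) (≋-reflexive (cong +_ e)))))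
      where
      double-cancel-< : ∀ j → suc (j ℕ.+ j) ℕ.< n → j ℕ.< m
      double-cancel-< j h = ℕ.≰⇒> λ m≤j → ℕ.<⇒≱ (ℕ.s<s⁻¹ h) (ℕ.+-mono-≤ m≤j m≤j)
      go : ∀ r → r ℕ.< n → r ≢ 0 → NonZero (ν 2 - tℕ r)
      go r r<n r≢0 with parity r
      ... | j , inj₂ ≡.refl = 2-t-odd≉0 j (double-cancel-< j r<n)
      ... | zero , inj₁ ≡.refl = contradiction ≡.refl r≢0
      ... | suc j , inj₁ ≡.refl = nz-cong (+-congˡ (-‿cong (begin
              tℕ (suc (i ℕ.+ i))             ≈⟨ t-≡ i≡ ⟩
              t (ℤ.- + r′ ℤ.+ + n)           ≈⟨ t-+n (ℤ.- + r′) ⟩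
              t (ℤ.- + r′)                   ≈⟨ t-neg (+ r′) ⟩
              t (+ r′)                       ∎)))
            (2-t-odd≉0 i (ℕ.s≤s (ℕ.m∸n≤m m-1 j)))
        where
        r′ = suc j ℕ.+ suc j
        i = m-1 ℕ.∸ j
        j≤m-1 : j ℕ.≤ m-1
        j≤m-1 = ℕ.s≤s⁻¹ (double-cancel-< j (ℕ.<-trans (ℕ.s≤s (ℕ.≤-reflexive (≡.sym (ℕ.+-suc j j)))) r<n))
        i≡ : + suc (i ℕ.+ i) ≡ ℤ.- + r′ ℤ.+ + n
        i≡ = ≡.trans (cong (λ w → + 1 ℤ.+ (w ℤ.+ w)) (≡.trans (≡.sym (ℤ.⊖-≥ j≤m-1)) (≡.sym (ℤ.m-n≡m⊖n m-1 j))))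
                     (e (+ m-1) (+ j))
          where
          open ℤ.+-*-Solver
          e : ∀ m j → + 1 ℤ.+ ((m ℤ.- j) ℤ.+ (m ℤ.- j))
                ≡ ℤ.- ((+ 1 ℤ.+ j) ℤ.+ (+ 1 ℤ.+ j)) ℤ.+ (+ 1 ℤ.+ ((+ 1 ℤ.+ m) ℤ.+ (+ 1 ℤ.+ m)))
          e = solve 2 (λ m j → con (+ 1) :+ ((m :- j) :+ (m :- j))
                := :- ((con (+ 1) :+ j) :+ (con (+ 1) :+ j)) :+ (con (+ 1) :+ ((con (+ 1) :+ m) :+ (con (+ 1) :+ m)))) ≡.refl

    -- Sums over a period

    Periodic : (ℤ → Carrier) → Set
    Periodic f = ∀ {a b} → a ≋ b → f a ≈ f b

    ∑ₙ : (ℤ → Carrier) → Carrier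
    ∑ₙ f = sum {n} (f ∘ ι)

    ∑ₙ-suc : ∀ f → Periodic f → ∑ₙ (f ∘ ℤ.suc) ≈ ∑ₙ f
    ∑ₙ-suc f per = begin
      ∑ₙ (f ∘ ℤ.suc)
        ≈⟨ ∑-last (m ℕ.+ m) (f ∘ +_ ∘ suc) ⟩
      sum {m ℕ.+ m} (f ∘ +_ ∘ suc ∘ toℕ) + f (+ n)
        ≈⟨ +-comm _ _ ⟩
      f (+ n) + sum {m ℕ.+ m} (f ∘ +_ ∘ suc ∘ toℕ)
        ≈⟨ +-congʳ (per (+n≋ (+ 0))) ⟩
      ∑ₙ f ∎

    ∑ₙ-shift : ∀ f → Periodic f → ∀ a → ∑ₙ (λ z → f (z ℤ.+ a)) ≈ ∑ₙ f
    ∑ₙ-shift f per a = begin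
      ∑ₙ (λ z → f (z ℤ.+ a))                ≈⟨ ∑-cong {n} (λ z → per (≋-+ (≋-refl {ι z}) ι[ a ])) ⟨
      ∑ₙ (λ z → f (z ℤ.+ + toℕ [ a ]))      ≈⟨ go (toℕ [ a ]) ⟩
      ∑ₙ f                                  ∎
      where
      go : ∀ k → ∑ₙ (λ z → f (z ℤ.+ + k)) ≈ ∑ₙ f
      go zero    = ∑-cong {n} λ z → reflexive (cong f (ℤ.+-identityʳ (ι z)))
      go (suc k) = begin
        ∑ₙ (λ z → f (z ℤ.+ + suc k))        ≈⟨ ∑-cong {n} (λ z → reflexive (cong f (e (ι z) (+ k)))) ⟩
        ∑ₙ (λ z → f (ℤ.suc z ℤ.+ + k))      ≈⟨ ∑ₙ-suc (λ z → f (z ℤ.+ + k)) (λ h → per (≋-+ h ≋-refl)) ⟩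
        ∑ₙ (λ z → f (z ℤ.+ + k))            ≈⟨ go k ⟩
        ∑ₙ f                                ∎
        where
        open ℤ.+-*-Solver
        e : ∀ z k → z ℤ.+ (+ 1 ℤ.+ k) ≡ + 1 ℤ.+ z ℤ.+ k
        e = solve 2 (λ z k → z :+ (con (+ 1) :+ k) := con (+ 1) :+ z :+ k) ≡.refl

    ∑-symmetric : ∀ k (f : ℤ → Carrier) →
      sum {suc (k ℕ.+ k)} (λ i → f (+ toℕ i ℤ.- + k)) ≈ f (+ 0) + sum {k} (λ s → f (+ suc (toℕ s)) + f (ℤ.- + suc (toℕ s)))
    ∑-symmetric zero f = refl
    ∑-symmetric (suc k) f = begin
      sum {suc (suc k ℕ.+ suc k)} (g ∘ toℕ)
        ≈⟨ reflexive (cong (λ l → sum {suc (suc l)} (g ∘ toℕ)) (ℕ.+-suc k k)) ⟩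
      g 0 + sum {2 ℕ.+ (k ℕ.+ k)} (g ∘ suc ∘ toℕ)
        ≈⟨ +-congˡ (∑-last (suc (k ℕ.+ k)) (g ∘ suc)) ⟩
      g 0 + (sum {suc (k ℕ.+ k)} (g ∘ suc ∘ toℕ) + g (2 ℕ.+ (k ℕ.+ k)))
        ≈⟨ +-congˡ (+-cong (∑-cong {suc (k ℕ.+ k)} (λ i → reflexive (cong f (e₁ (+ toℕ i) (+ k))))) (reflexive (cong f (e₂ (+ k))))) ⟩
      g 0 + (sum {suc (k ℕ.+ k)} (λ i → f (+ toℕ i ℤ.- + k)) + f (+ suc k))
        ≈⟨ +-cong (reflexive (cong f (ℤ.+-identityˡ (ℤ.- + suc k)))) (+-congʳ (∑-symmetric k f)) ⟩
      f (ℤ.- + suc k) + (f (+ 0) + sum {k} (h ∘ toℕ) + f (+ suc k))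
        ≈⟨ solve 4 (λ a b c d → a :+ (b :+ c :+ d) := b :+ (c :+ (d :+ a))) refl (f (ℤ.- + suc k)) (f (+ 0)) (sum {k} (h ∘ toℕ)) (f (+ suc k)) ⟩
      f (+ 0) + (sum {k} (h ∘ toℕ) + h k)
        ≈⟨ +-congˡ (∑-last k h) ⟨
      f (+ 0) + sum {suc k} (h ∘ toℕ) ∎
      where
      g : ℕ → Carrier
      g i = f (+ i ℤ.- + suc k)
      h : ℕ → Carrier
      h s = f (+ suc s) + f (ℤ.- + suc s)
      open Solver
      module Z = ℤ.+-*-Solver
      e₁ : ∀ i k → + 1 ℤ.+ i ℤ.- (+ 1 ℤ.+ k) ≡ i ℤ.- k
      e₁ = Z.solve 2 (λ i k → Z.con (+ 1) Z.:+ i Z.:- (Z.con (+ 1) Z.:+ k) Z.:= i Z.:- k) ≡.refl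
      e₂ : ∀ k → + 2 ℤ.+ (k ℤ.+ k) ℤ.- (+ 1 ℤ.+ k) ≡ + 1 ℤ.+ k
      e₂ = Z.solve 1 (λ k → Z.con (+ 2) Z.:+ (k Z.:+ k) Z.:- (Z.con (+ 1) Z.:+ k) Z.:= Z.con (+ 1) Z.:+ k) ≡.refl

    -- Move the window of summation to the integers from `- m` to `m`; as `n` is odd, only 0 stays
    -- unpaired.
    ∑ₙ-symmetric : ∀ f → Periodic f →
      ∑ₙ f ≈ f (+ 0) + sum {m} (λ s → f (+ suc (toℕ s)) + f (ℤ.- + suc (toℕ s)))
    ∑ₙ-symmetric f per = trans (sym (∑ₙ-shift f per (ℤ.- + m))) (∑-symmetric m f)

    -- Fourier coefficients of the cycle distance

    wave : ℤ → ℤ → ℤ → Carrier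
    wave j x q = t (x ℤ.+ j ℤ.* q)

    wave-periodic : ∀ j x → Periodic (wave j x)
    wave-periodic j x h = t-≋ (≋-+ (≋-refl {x}) (≋-* j h))

    -- For a frequency below `n`, the eigenvalue of the all-ones matrix of size `n`.
    ρ : ℕ → Carrier
    ρ zero    = ν n
    ρ (suc _) = 0#

    -- By the product formula, multiplying the sum by `t j` adds its two translates by one step,
    -- which both equal the sum. So `ν 2 - t j` annihilates it and can be cancelled.
    ∑-wave≈0 : ∀ j x → ¬ (j ≋ + 0) → ∑ₙ (wave j x) ≈ 0#
    ∑-wave≈0 j x j≢0 = nz-cancel (2-t≉0 j j≢0) (begin
      (ν 2 - t j) * s             ≈⟨ solve 2 (λ y s → (con (+ 2) :- y) :* s := s :+ s :- y :* s) refl (t j) s ⟩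
      s + s - t j * s             ≈⟨ +-congˡ (-‿cong tⱼs) ⟩
      s + s - (s + s)             ≈⟨ -‿inverseʳ (s + s) ⟩
      0#                          ∎)
      where
      f = wave j x
      s = ∑ₙ f
      open Solver
      module Z = ℤ.+-*-Solver
      e₁ : ∀ j x q → x ℤ.+ j ℤ.* q ℤ.+ j ≡ x ℤ.+ j ℤ.* (q ℤ.+ + 1)
      e₁ = Z.solve 3 (λ j x q → x Z.:+ j Z.:* q Z.:+ j Z.:= x Z.:+ j Z.:* (q Z.:+ Z.con (+ 1))) ≡.refl
      e₂ : ∀ j x q → x ℤ.+ j ℤ.* q ℤ.- j ≡ x ℤ.+ j ℤ.* (q ℤ.- + 1)
      e₂ = Z.solve 3 (λ j x q → x Z.:+ j Z.:* q Z.:- j Z.:= x Z.:+ j Z.:* (q Z.:- Z.con (+ 1))) ≡.refl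
      tⱼs : t j * s ≈ s + s
      tⱼs = begin
        t j * s
          ≈⟨ *-distribˡ-sum {n} (t j) (f ∘ ι) ⟩
        sum {n} (λ i → t j * f (ι i))
          ≈⟨ ∑-cong {n} (λ i → trans (*-comm (t j) _) (trans (t-* (x ℤ.+ j ℤ.* ι i) j)
               (+-cong (t-≡ (e₁ j x (ι i))) (t-≡ (e₂ j x (ι i)))))) ⟩
        sum {n} (λ i → f (ι i ℤ.+ + 1) + f (ι i ℤ.- + 1))
          ≈⟨ ∑-distrib-+ {n} (λ i → f (ι i ℤ.+ + 1)) (λ i → f (ι i ℤ.- + 1)) ⟩
        ∑ₙ (λ z → f (z ℤ.+ + 1)) + ∑ₙ (λ z → f (z ℤ.- + 1))
          ≈⟨ +-cong (∑ₙ-shift f (wave-periodic j x) (+ 1)) (∑ₙ-shift f (wave-periodic j x) (ℤ.- + 1)) ⟩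
        s + s ∎

    -- The distance eigenvalue of the cycle at frequency `j`: distance `s` occurs at the
    -- displacements `s` and `- s`, and the two waves add up to one `t`.
    Λ : ℤ → Carrier
    Λ j = sum {m} (λ s → ν (suc (toℕ s)) * t (j ℤ.* + suc (toℕ s)))

    ∑-wave-δ : ∀ j x → ∑ₙ (λ q → wave j x q * ν (δ q)) ≈ Λ j * t x
    ∑-wave-δ j x = begin
      ∑ₙ f
        ≈⟨ ∑ₙ-symmetric f (λ h → *-cong (wave-periodic j x h) (reflexive (cong ν (δ-cong h)))) ⟩
      f (+ 0) + sum {m} (λ s → f (+ suc (toℕ s)) + f (ℤ.- + suc (toℕ s)))
        ≈⟨ +-cong f0 (∑-cong {m} term) ⟩
      0# + sum {m} (λ s → ν (suc (toℕ s)) * t (j ℤ.* + suc (toℕ s)) * t x)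
        ≈⟨ +-identityˡ _ ⟩
      sum {m} (λ s → ν (suc (toℕ s)) * t (j ℤ.* + suc (toℕ s)) * t x)
        ≈⟨ *-distribʳ-sum {m} (t x) (λ s → ν (suc (toℕ s)) * t (j ℤ.* + suc (toℕ s))) ⟨
      Λ j * t x ∎
      where
      f : ℤ → Carrier
      f q = wave j x q * ν (δ q)
      f0 : f (+ 0) ≈ 0#
      f0 = trans (*-congˡ (trans (reflexive (cong ν (δ-small (+ 0) ℕ.z≤n))) 0-homo)) (zeroʳ _)
      open Solver
      module Z = ℤ.+-*-Solver
      term : ∀ (s : Fin m) → f (+ suc (toℕ s)) + f (ℤ.- + suc (toℕ s)) ≈ ν (suc (toℕ s)) * t (j ℤ.* + suc (toℕ s)) * t x
      term s = begin
        t (x ℤ.+ j ℤ.* k) * ν (δ k) + t (x ℤ.+ j ℤ.* (ℤ.- k)) * ν (δ (ℤ.- k))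
          ≈⟨ +-cong (*-congˡ (reflexive (cong ν (δ-small k (Fin.toℕ<n s)))))
               (*-cong (t-≡ (cong (λ w → x ℤ.+ w) (≡.sym (ℤ.neg-distribʳ-* j k)))) (reflexive (cong ν (δ-small (ℤ.- k) (Fin.toℕ<n s))))) ⟩
        t (x ℤ.+ j ℤ.* k) * v + t (x ℤ.- j ℤ.* k) * v
          ≈⟨ distribʳ v _ _ ⟨
        (t (x ℤ.+ j ℤ.* k) + t (x ℤ.- j ℤ.* k)) * v
          ≈⟨ *-congʳ (t-* x (j ℤ.* k)) ⟨
        t x * t (j ℤ.* k) * v
          ≈⟨ solve 3 (λ a b c → a :* b :* c := c :* b :* a) refl (t x) (t (j ℤ.* k)) v ⟩
        v * t (j ℤ.* k) * t x ∎
        where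
        k = + suc (toℕ s)
        v = ν (suc (toℕ s))

    -- Summation by parts: multiplication by `t j - ν 2` is the second difference of s ↦ t (j s), so
    -- against the linear weight `s` only boundary terms survive.
    Λ-telescope : ∀ j k → (t j - ν 2) * sum {k} (λ s → ν (suc (toℕ s)) * t (j ℤ.* + suc (toℕ s)))
      ≈ ν k * t (j ℤ.* + suc k) - ν (suc k) * t (j ℤ.* + k) + ν 2
    Λ-telescope j zero = begin
      (t j - ν 2) * 0#
        ≈⟨ trans (zeroʳ _) (sym 0-homo) ⟩
      ν 0
        ≈⟨ solve 1 (λ a → con (+ 0) := con (+ 0) :* a :- con (+ 1) :* con (+ 2) :+ con (+ 2)) refl (t (j ℤ.* + 1)) ⟩
      ν 0 * t (j ℤ.* + 1) - ν 1 * ν 2 + ν 2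
        ≈⟨ +-congʳ (+-congˡ (-‿cong (*-congˡ (t-≡ (ℤ.*-zeroʳ j))))) ⟨
      ν 0 * t (j ℤ.* + 1) - ν 1 * t (j ℤ.* + 0) + ν 2 ∎
      where open Solver
    Λ-telescope j (suc k) = begin
      (t j - ν 2) * sum {suc k} (h ∘ toℕ)
        ≈⟨ *-congˡ (∑-last k h) ⟩
      (t j - ν 2) * (sum {k} (h ∘ toℕ) + ν (suc k) * b)
        ≈⟨ solve 4 (λ y s v b → (y :- con (+ 2)) :* (s :+ v :* b) := (y :- con (+ 2)) :* s :+ v :* (b :* y :- con (+ 2) :* b)) refl
             (t j) (sum {k} (h ∘ toℕ)) (ν (suc k)) b ⟩
      (t j - ν 2) * sum {k} (h ∘ toℕ) + ν (suc k) * (b * t j - ν 2 * b)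
        ≈⟨ +-cong (Λ-telescope j k) (*-congˡ (+-congʳ (trans (t-* (j ℤ.* + suc k) j) (+-cong (t-≡ (e₁ j (+ k))) (t-≡ (e₂ j (+ k))))))) ⟩
      (ν k * b - ν (suc k) * a + ν 2) + ν (suc k) * ((c′ + a) - ν 2 * b)
        ≈⟨ solve 5 (λ k v a b c → (k :* b :- v :* a :+ con (+ 2)) :+ v :* ((c :+ a) :- con (+ 2) :* b)
             := v :* c :- (v :+ (v :- k)) :* b :+ con (+ 2)) refl (ν k) (ν (suc k)) a b c′ ⟩
      ν (suc k) * c′ - (ν (suc k) + (ν (suc k) - ν k)) * b + ν 2
        ≈⟨ +-congʳ (+-congˡ (-‿cong (*-congʳ v≈))) ⟩
      ν (suc k) * c′ - ν (2 ℕ.+ k) * b + ν 2 ∎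
      where
      h : ℕ → Carrier
      h s = ν (suc s) * t (j ℤ.* + suc s)
      a = t (j ℤ.* + k)
      b = t (j ℤ.* + suc k)
      c′ = t (j ℤ.* + (2 ℕ.+ k))
      open Solver
      v≈ : ν (suc k) + (ν (suc k) - ν k) ≈ ν (2 ℕ.+ k)
      v≈ = begin
        ν (suc k) + (ν (suc k) - ν k)    ≈⟨ +-congˡ (+-congʳ (ν-suc k)) ⟩
        ν (suc k) + (ν 1 + ν k - ν k)    ≈⟨ solve 3 (λ v e k → v :+ (e :+ k :- k) := e :+ v) refl (ν (suc k)) (ν 1) (ν k) ⟩
        ν 1 + ν (suc k)                  ≈⟨ ν-suc (suc k) ⟨
        ν (2 ℕ.+ k)                      ∎
      module Z = ℤ.+-*-Solver
      e₁ : ∀ j k → j ℤ.* (+ 1 ℤ.+ k) ℤ.+ j ≡ j ℤ.* (+ 2 ℤ.+ k)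
      e₁ = Z.solve 2 (λ j k → j Z.:* (Z.con (+ 1) Z.:+ k) Z.:+ j Z.:= j Z.:* (Z.con (+ 2) Z.:+ k)) ≡.refl
      e₂ : ∀ j k → j ℤ.* (+ 1 ℤ.+ k) ℤ.- j ≡ j ℤ.* k
      e₂ = Z.solve 2 (λ j k → j Z.:* (Z.con (+ 1) Z.:+ k) Z.:- j Z.:= j Z.:* k) ≡.refl

    jm+jm≋-j : ∀ j → j ℤ.* + m ℤ.+ j ℤ.* + m ≋ ℤ.- j
    jm+jm≋-j j = mod j (e j (+ m))
      where
      open ℤ.+-*-Solver
      e : ∀ j m → j ℤ.* m ℤ.+ j ℤ.* m ≡ ℤ.- j ℤ.+ j ℤ.* (+ 1 ℤ.+ (m ℤ.+ m))
      e = solve 2 (λ j m → j :* m :+ j :* m := :- j :+ j :* (con (+ 1) :+ (m :+ m))) ≡.refl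

    jm≢0 : ∀ {j} → ¬ (j ≋ + 0) → ¬ (j ℤ.* + m ≋ + 0)
    jm≢0 {j} j≢0 h = j≢0 (subst (_≋ + 0) (ℤ.neg-involutive j)
      (≋-neg {b = + 0} (≋-trans (≋-sym (jm+jm≋-j j)) (≋-+ h h))))

    -- Λ j = -1 / (2 + t (j m)).
    Λ-reciprocal : ∀ j → ¬ (j ≋ + 0) → (ν 2 + t (j ℤ.* + m)) * Λ j + 1# ≈ 0#
    -- Put y = t (j m). As 2jm is congruent to -j, t j = y² - 2, hence t j - 2 = (y - 2) (y + 2).
    -- Also t (j (m + 1)) = y, so `Λ-telescope` at `m` reads (y - 2) (y + 2) Λ j = 2 - y, and 2 - y
    -- is cancelled.
    Λ-reciprocal j j≢0 = nz-cancel (2-t≉0 (j ℤ.* + m) (jm≢0 j≢0)) (begin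
      (ν 2 - y) * ((ν 2 + y) * Λ j + 1#)
        ≈⟨ *-congˡ (+-congˡ 1-homo) ⟨
      (ν 2 - y) * ((ν 2 + y) * Λ j + ν 1)
        ≈⟨ solve 2 (λ y l → (con (+ 2) :- y) :* ((con (+ 2) :+ y) :* l :+ con (+ 1))
             := con (+ 2) :- y :- ((y :* y :- con (+ 2)) :- con (+ 2)) :* l) refl y (Λ j) ⟩
      ν 2 - y - ((y * y - ν 2) - ν 2) * Λ j
        ≈⟨ +-congˡ (-‿cong (*-congʳ (+-congʳ y²-2))) ⟩
      ν 2 - y - (t j - ν 2) * Λ j
        ≈⟨ +-congˡ (-‿cong (Λ-telescope j m)) ⟩
      ν 2 - y - (ν m * t (j ℤ.* + suc m) - ν (suc m) * y + ν 2)
        ≈⟨ +-congˡ (-‿cong (+-congʳ (+-cong (*-congˡ y′) (-‿cong (*-congʳ (ν-suc m)))))) ⟩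
      ν 2 - y - (ν m * y - (ν 1 + ν m) * y + ν 2)
        ≈⟨ solve 2 (λ y m → con (+ 2) :- y :- (m :* y :- (con (+ 1) :+ m) :* y :+ con (+ 2)) := con (+ 0)) refl y (ν m) ⟩
      ν 0
        ≈⟨ 0-homo ⟩
      0# ∎)
      where
      y = t (j ℤ.* + m)
      open Solver
      module Z = ℤ.+-*-Solver
      e : ∀ j m → j ℤ.* (+ 1 ℤ.+ m) ≡ ℤ.- (j ℤ.* m) ℤ.+ j ℤ.* (+ 1 ℤ.+ (m ℤ.+ m))
      e = Z.solve 2 (λ j m → j Z.:* (Z.con (+ 1) Z.:+ m) Z.:= Z.:- (j Z.:* m) Z.:+ j Z.:* (Z.con (+ 1) Z.:+ (m Z.:+ m))) ≡.refl
      y′ : t (j ℤ.* + suc m) ≈ y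
      y′ = trans (t-≋ {b = ℤ.- (j ℤ.* + m)} (mod j (e j (+ m)))) (t-neg (j ℤ.* + m))
      y²-2 : y * y - ν 2 ≈ t j
      y²-2 = begin
        y * y - ν 2              ≈⟨ +-congʳ (t-* (j ℤ.* + m) (j ℤ.* + m)) ⟩
        t (j ℤ.* + m ℤ.+ j ℤ.* + m) + t (j ℤ.* + m ℤ.- j ℤ.* + m) - ν 2
          ≈⟨ +-congʳ (+-cong (trans (t-≋ (jm+jm≋-j j)) (t-neg j)) (t-≡ (ℤ.+-inverseʳ (j ℤ.* + m)))) ⟩
        t j + ν 2 - ν 2          ≈⟨ solve 2 (λ x e → x :+ e :- e := x) refl (t j) (ν 2) ⟩
        t j                      ∎

    -- The half-angle formula, with `half` taken modulo `n`. It displays `ν 2 + t a` as a square,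
    -- the shape that `nz-kz²+1` asks for.
    2+t-square : ∀ a → ν 2 + t a ≈ t (half a) * t (half a)
    2+t-square a = sym (begin
      t (half a) * t (half a)                        ≈⟨ t-* (half a) (half a) ⟩
      t (half a ℤ.+ half a) + t (half a ℤ.- half a)  ≈⟨ +-cong
        (t-≋ (≋-trans (≋-reflexive (≡.sym (ℤ.*-distribˡ-+ (+ suc m) a a))) (half-double a)))
        (t-≡ (ℤ.+-inverseʳ (half a))) ⟩
      t a + ν 2                                      ≈⟨ +-comm (t a) (ν 2) ⟩
      ν 2 + t a                                      ∎)

    -- `Λ-reciprocal` makes `Λ j` a factor of -1.
    Λ≉0 : ∀ j → ¬ (j ≋ + 0) → NonZero (Λ j)
    Λ≉0 j j≢0 = nz-*⁻ˡ (nz-cong (begin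
      - 1#                       ≈⟨ +-identityˡ _ ⟨
      0# - 1#                    ≈⟨ +-congʳ (Λ-reciprocal j j≢0) ⟨
      u * Λ j + 1# - 1#          ≈⟨ solve 3 (λ u l e → u :* l :+ e :- e := l :* u) refl u (Λ j) 1# ⟩
      Λ j * u                    ∎) (nz-neg (nz-cong 1-homo (nz-ν 0))))
      where
      u = ν 2 + t (j ℤ.* + m)
      open Solver

    t-apart : ∀ a b → ¬ (a ℤ.+ b ≋ + 0) → ¬ (a ℤ.- b ≋ + 0) → NonZero (t a - t b)
    t-apart a b h₊ h₋ = nz-*⁻ˡ (nz-cong (sym (t-difference² a b)) (nz-* (2-t≉0 _ h₊) (2-t≉0 _ h₋)))

    -- Difference of reciprocals: Λ i - Λ j = Λ i Λ j (yᵢ - yⱼ), where the `y` are cosines at the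
    -- frequencies `i m` and `j m`.
    Λ-apart : ∀ i j → ¬ (i ≋ + 0) → ¬ (j ≋ + 0) → ¬ (i ℤ.+ j ≋ + 0) → ¬ (i ℤ.- j ≋ + 0) → NonZero (Λ i - Λ j)
    Λ-apart i j i≢0 j≢0 i+j i-j = nz-cong (x-y≈0⇒x≈y (begin
      Λ i * Λ j * (yᵢ - yⱼ) - (Λ i - Λ j)
        ≈⟨ solve 5 (λ a b y z e → a :* b :* (y :- z) :- (a :- b)
             := b :* ((con (+ 2) :+ y) :* a :+ e) :- a :* ((con (+ 2) :+ z) :* b :+ e) :+ (e :- con (+ 1)) :* (a :- b)) refl
             (Λ i) (Λ j) yᵢ yⱼ 1# ⟩
      Λ j * ((ν 2 + yᵢ) * Λ i + 1#) - Λ i * ((ν 2 + yⱼ) * Λ j + 1#) + (1# - ν 1) * (Λ i - Λ j)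
        ≈⟨ +-cong (+-cong (trans (*-congˡ (Λ-reciprocal i i≢0)) (zeroʳ _)) (-‿cong (trans (*-congˡ (Λ-reciprocal j j≢0)) (zeroʳ _))))
                  (trans (*-congʳ (x≈y⇒x-y≈0 (sym 1-homo))) (zeroˡ _)) ⟩
      0# - 0# + 0#
        ≈⟨ trans (+-identityʳ _) (-‿inverseʳ 0#) ⟩
      0# ∎)) (nz-* (nz-* (Λ≉0 i i≢0) (Λ≉0 j j≢0))
               (t-apart (i ℤ.* + m) (j ℤ.* + m)
                  (jm≢0 i+j ∘ ≋-trans (≋-reflexive (ℤ.*-distribʳ-+ (+ m) i j)))
                  (jm≢0 i-j ∘ ≋-trans (≋-reflexive (e i j (+ m))))))
      where
      yᵢ = t (i ℤ.* + m)
      yⱼ = t (j ℤ.* + m)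
      open Solver
      module Z = ℤ.+-*-Solver
      e : ∀ i j m → (i ℤ.- j) ℤ.* m ≡ i ℤ.* m ℤ.- j ℤ.* m
      e = Z.solve 3 (λ i j m → (i Z.:- j) Z.:* m Z.:= i Z.:* m Z.:- j Z.:* m) ≡.refl

    ∑-ν : ∀ {k} (a : Fin k → ℕ) → ∃[ r ] sum (ν ∘ a) ≈ ν r
    ∑-ν {zero}  a = 0 , sym 0-homo
    ∑-ν {suc k} a = let (r , h) = ∑-ν (a ∘ Fin.suc) in
      a Fin.zero ℕ.+ r , trans (+-congˡ h) (sym (+-homo (+ a Fin.zero) (+ r)))

    -- The value is m (m + 1), but only that it is a positive integer gets used.
    Λ0-natural : ∃[ r ] Λ (+ 0) ≈ ν (suc r)
    Λ0-natural =
      let (r , h) = ∑-ν {m-1} (λ s → (2 ℕ.+ toℕ s) ℕ.* 2) in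
      suc r , (begin
        Λ (+ 0)                                       ≈⟨ ∑-cong {m} (λ s → trans (*-congˡ (t-≡ (ℤ.*-zeroˡ (+ suc (toℕ s))))) (sym (*-ν (suc (toℕ s)) 2))) ⟩
        ν 2 + sum {m-1} (λ s → ν ((2 ℕ.+ toℕ s) ℕ.* 2)) ≈⟨ +-congˡ h ⟩
        ν 2 + ν r                                     ≈⟨ +-homo (+ 2) (+ r) ⟨
        ν (2 ℕ.+ r)                                   ∎)
      where
      *-ν : ∀ a b → ν (a ℕ.* b) ≈ ν a * ν b
      *-ν a b = trans (reflexive (cong ⟦_⟧ (ℤ.pos-* a b))) (*-homo (+ a) (+ b))

    -- Multiplied by `ν 2 + t (j m)`, a square z², the difference becomes 2 Λ₀ z² + 1 with Λ₀ a
    -- positive integer. This stands in for comparing a positive number with a negative one.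
    2Λ0-Λ≉0 : ∀ j → ¬ (j ≋ + 0) → NonZero (Λ (+ 0) + Λ (+ 0) - Λ j)
    2Λ0-Λ≉0 j j≢0 = nz-*⁻ˡ (nz-cong (begin
      ν (suc r ℕ.+ suc r) * (z * z) + 1#
        ≈⟨ +-congʳ (*-cong (trans (+-homo (+ suc r) (+ suc r)) (sym (+-cong Λ0 Λ0))) (sym (2+t-square (j ℤ.* + m)))) ⟩
      (l + l) * u + 1#
        ≈⟨ +-identityˡ _ ⟨
      0# + ((l + l) * u + 1#)
        ≈⟨ +-congʳ (trans (-‿cong (Λ-reciprocal j j≢0)) -0≈0) ⟨
      - (u * Λ j + 1#) + ((l + l) * u + 1#)
        ≈⟨ solve 4 (λ u k l e → :- (u :* k :+ e) :+ ((l :+ l) :* u :+ e) := (l :+ l :- k) :* u) refl u (Λ j) l 1# ⟩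
      (l + l - Λ j) * u ∎) (nz-kz²+1 (suc r ℕ.+ suc r) z))
      where
      r = proj₁ Λ0-natural
      Λ0 = proj₂ Λ0-natural
      z = t (half (j ℤ.* + m))
      l = Λ (+ 0)
      u = ν 2 + t (j ℤ.* + m)
      open Solver
      -0≈0 : - 0# ≈ 0#
      -0≈0 = trans (sym (+-identityˡ (- 0#))) (-‿inverseʳ 0#)

    -- The spectrum of the distance matrix of the torus

    module Torus {N : ℕ} (π : Fin N ↔ (Fin n × Fin n)) (d : Fin N → Fin N → ℕ)
      (d≡ : ∀ P Q → d P Q ≡ δ (ι (proj₁ (Inverse.to π P)) ℤ.- ι (proj₁ (Inverse.to π Q)))
                        ℕ.+ δ (ι (proj₂ (Inverse.to π P)) ℤ.- ι (proj₂ (Inverse.to π Q))))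
      where

      open Inverse π using (to)

      U W : Fin N → ℤ
      U P = ι (proj₁ (to P))
      W P = ι (proj₂ (to P))

      UW-injective : ∀ {P Q} → U P ≋ U Q → W P ≋ W Q → P ≡ Q
      UW-injective {P} {Q} u w = ≡.trans (≡.sym (Inverse.strictlyInverseʳ π P))
        (≡.trans (cong (Inverse.from π) (≡.cong₂ _,_ (ι-injective u) (ι-injective w))) (Inverse.strictlyInverseʳ π Q))

      IsEigenvalue : Carrier → Set
      IsEigenvalue x = Σ[ v ∈ (Fin N → Carrier) ] (∃[ P ] NonZero (v P)) × (∀ P → sum (λ Q → ν (d P Q) * v Q) ≈ x * v P)

      -- A kernel in coordinate differences: fixing `P` gives an eigenvector peaked at `P`, and
      -- summing over the frequencies gives a multiple of the delta function at `P`.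
      K : ℕ → ℕ → Fin N → Fin N → Carrier
      K j l P Q = t (+ j ℤ.* (U Q ℤ.- U P)) * t (+ l ℤ.* (W Q ℤ.- W P))

      -- Because the distance is a sum over the two coordinates, the matrix is D ⊗ J + J ⊗ D with D
      -- the cycle distances and J all ones; `Λ` and `ρ` are their eigenvalues.
      μ : ℕ → ℕ → Carrier
      μ j l = Λ (+ j) * ρ l + ρ j * Λ (+ l)

      ∑-t : ∀ j p r → j ℕ.< n → ∑ₙ (λ u → t (+ j ℤ.* (u ℤ.- p))) ≈ ρ j * t (+ j ℤ.* (r ℤ.- p))
      ∑-t zero p r _ = ∑-const n (ν 2)
      ∑-t (suc j) p r j<n = begin
        ∑ₙ (λ u → t (+ suc j ℤ.* (u ℤ.- p)))       ≈⟨ ∑-cong {n} (λ u → t-≡ (e (+ suc j) (ι u) p)) ⟩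
        ∑ₙ (wave (+ suc j) (ℤ.- (+ suc j ℤ.* p)))  ≈⟨ ∑-wave≈0 (+ suc j) (ℤ.- (+ suc j ℤ.* p)) (≢0 (ℕ.s≤s ℕ.z≤n) j<n) ⟩
        0#                                         ≈⟨ zeroˡ _ ⟨
        0# * t (+ suc j ℤ.* (r ℤ.- p))             ∎
        where
        open ℤ.+-*-Solver
        e : ∀ j u p → j ℤ.* (u ℤ.- p) ≡ ℤ.- (j ℤ.* p) ℤ.+ j ℤ.* u
        e = solve 3 (λ j u p → j :* (u :- p) := :- (j :* p) :+ j :* u) ≡.refl

      ∑-tδ : ∀ j p r → ∑ₙ (λ u → t (j ℤ.* (u ℤ.- p)) * ν (δ (u ℤ.- r))) ≈ Λ j * t (j ℤ.* (r ℤ.- p))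
      ∑-tδ j p r = begin
        ∑ₙ (λ u → t (j ℤ.* (u ℤ.- p)) * ν (δ (u ℤ.- r)))
          ≈⟨ ∑-cong {n} (λ u → *-congʳ {ν (δ (ι u ℤ.- r))} (t-≡ (e j (ι u) p r))) ⟩
        ∑ₙ (λ u → f (u ℤ.- r))
          ≈⟨ ∑ₙ-shift f (λ h → *-cong (wave-periodic j (j ℤ.* (r ℤ.- p)) h) (reflexive (cong ν (δ-cong h)))) (ℤ.- r) ⟩
        ∑ₙ f
          ≈⟨ ∑-wave-δ j (j ℤ.* (r ℤ.- p)) ⟩
        Λ j * t (j ℤ.* (r ℤ.- p)) ∎
        where
        f : ℤ → Carrier
        f q = wave j (j ℤ.* (r ℤ.- p)) q * ν (δ q)
        open ℤ.+-*-Solver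
        e : ∀ j u p r → j ℤ.* (u ℤ.- p) ≡ j ℤ.* (r ℤ.- p) ℤ.+ j ℤ.* (u ℤ.- r)
        e = solve 4 (λ j u p r → j :* (u :- p) := j :* (r :- p) :+ j :* (u :- r)) ≡.refl

      K-eigen : ∀ j l → j ℕ.< n → l ℕ.< n → ∀ P R → sum (λ Q → K j l P Q * ν (d Q R)) ≈ μ j l * K j l P R
      K-eigen j l j<n l<n P R = begin
        sum (λ Q → K j l P Q * ν (d Q R))
          ≈⟨ ∑-cong (λ Q → trans (*-congˡ (trans (reflexive (cong ν (d≡ Q R))) (+-homo _ _)))
               (solve 4 (λ a b x y → a :* b :* (x :+ y) := a :* x :* b :+ a :* (b :* y)) refl _ _ _ _)) ⟩
        sum ((λ (u , w) → a u * x u * b w + a u * (b w * y w)) ∘ to)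
          ≈⟨ ∑-↔ π (λ (u , w) → a u * x u * b w + a u * (b w * y w)) ⟩
        sum (λ u → sum (λ w → a u * x u * b w + a u * (b w * y w)))
          ≈⟨ ∑-cong {n} (λ u → ∑-distrib-+ {n} (λ w → a u * x u * b w) (λ w → a u * (b w * y w))) ⟩
        sum (λ u → sum (λ w → a u * x u * b w) + sum (λ w → a u * (b w * y w)))
          ≈⟨ ∑-distrib-+ {n} (λ u → sum (λ w → a u * x u * b w)) (λ u → sum (λ w → a u * (b w * y w))) ⟩
        sum (λ u → sum (λ w → a u * x u * b w)) + sum (λ u → sum (λ w → a u * (b w * y w)))
          ≈⟨ +-cong (∑∑-* (λ u → a u * x u) b) (∑∑-* a (λ w → b w * y w)) ⟩
        sum (λ u → a u * x u) * sum b + sum a * sum (λ w → b w * y w)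
          ≈⟨ +-cong (*-cong (∑-tδ (+ j) (U P) (U R)) (∑-t l (W P) (W R) l<n))
                    (*-cong (∑-t j (U P) (U R) j<n) (∑-tδ (+ l) (W P) (W R))) ⟩
        Λ (+ j) * tᵤ * (ρ l * tᵥ) + ρ j * tᵤ * (Λ (+ l) * tᵥ)
          ≈⟨ solve 6 (λ x y a b r s → x :* a :* (s :* b) :+ r :* a :* (y :* b) := (x :* s :+ r :* y) :* (a :* b)) refl
               (Λ (+ j)) (Λ (+ l)) tᵤ tᵥ (ρ j) (ρ l) ⟩
        μ j l * K j l P R ∎
        where
        open Solver
        a b x y : Fin n → Carrier
        a u = t (+ j ℤ.* (ι u ℤ.- U P))
        b w = t (+ l ℤ.* (ι w ℤ.- W P))
        x u = ν (δ (ι u ℤ.- U R))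
        y w = ν (δ (ι w ℤ.- W R))
        tᵤ = t (+ j ℤ.* (U R ℤ.- U P))
        tᵥ = t (+ l ℤ.* (W R ℤ.- W P))

      d-sym : ∀ P Q → d P Q ≡ d Q P
      d-sym P Q = ≡.trans (d≡ P Q) (≡.trans (≡.cong₂ ℕ._+_ (flip (U P) (U Q)) (flip (W P) (W Q))) (≡.sym (d≡ Q P)))
        where
        flip : ∀ a b → δ (a ℤ.- b) ≡ δ (b ℤ.- a)
        flip a b = ≡.trans (cong δ (e a b)) (δ-neg (b ℤ.- a))
          where
          open ℤ.+-*-Solver
          e : ∀ a b → a ℤ.- b ≡ ℤ.- (b ℤ.- a)
          e = solve 2 (λ a b → a :- b := :- (b :- a)) ≡.refl

      μ-isEigenvalue : Fin N → ∀ j l → j ℕ.< n → l ℕ.< n → IsEigenvalue (μ j l)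
      μ-isEigenvalue O j l j<n l<n = K j l O , (O , nz-cong (sym K≈4) (nz-* (nz-ν 1) (nz-ν 1))) , λ P → begin
        sum (λ Q → ν (d P Q) * K j l O Q)  ≈⟨ ∑-cong (λ Q → trans (*-comm _ _) (*-congˡ (reflexive (cong ν (d-sym P Q))))) ⟩
        sum (λ Q → K j l O Q * ν (d Q P))  ≈⟨ K-eigen j l j<n l<n O P ⟩
        μ j l * K j l O P                  ∎
        where
        at0 : ∀ j u → t (+ j ℤ.* (u ℤ.- u)) ≈ ν 2
        at0 j u = t-≡ (≡.trans (cong (λ w → + j ℤ.* w) (ℤ.+-inverseʳ u)) (ℤ.*-zeroʳ (+ j)))
        K≈4 : K j l O O ≈ ν 2 * ν 2
        K≈4 = *-cong (at0 j (U O)) (at0 l (W O))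

      ∑-frequencies≈0 : ∀ x → ¬ (x ≋ + 0) → sum {n} (λ j → t (ι j ℤ.* x)) ≈ 0#
      ∑-frequencies≈0 x x≢0 = trans (∑-cong {n} λ j → t-≡ (≡.trans (ℤ.*-comm (ι j) x) (≡.sym (ℤ.+-identityˡ (x ℤ.* ι j)))))
        (∑-wave≈0 x (+ 0) x≢0)

      ∑-frequencies-0 : sum {n} (λ j → t (ι j ℤ.* + 0)) ≈ ν n * ν 2
      ∑-frequencies-0 = trans (∑-cong {n} λ j → t-≡ (ℤ.*-zeroʳ (ι j))) (∑-const n (ν 2))

      -- Pairs of frequencies are indexed by `Fin N` too, through the same bijection `π` as the
      -- vertices.
      first second : Fin N → ℕ
      first α = toℕ (proj₁ (to α))
      second α = toℕ (proj₂ (to α))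

      ∑K : ∀ P Q → sum (λ α → K (first α) (second α) P Q)
        ≈ sum {n} (λ j → t (ι j ℤ.* (U Q ℤ.- U P))) * sum {n} (λ l → t (ι l ℤ.* (W Q ℤ.- W P)))
      ∑K P Q = trans (∑-↔ π (λ (j , l) → K (toℕ j) (toℕ l) P Q))
                     (∑∑-* {n} {n} (λ j → t (ι j ℤ.* (U Q ℤ.- U P))) (λ l → t (ι l ℤ.* (W Q ℤ.- W P))))

      ∑K-diagonal : ∀ P → sum (λ α → K (first α) (second α) P P) ≈ ν n * ν 2 * (ν n * ν 2)
      ∑K-diagonal P = trans (∑K P P) (*-cong (diag (U P)) (diag (W P)))
        where
        diag : ∀ u → sum {n} (λ j → t (ι j ℤ.* (u ℤ.- u))) ≈ ν n * ν 2
        diag u = trans (∑-cong {n} λ j → t-≡ (cong (λ w → ι j ℤ.* w) (ℤ.+-inverseʳ u))) ∑-frequencies-0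

      ∑K-off-diagonal : ∀ P Q → Q ≢ P → sum (λ α → K (first α) (second α) P Q) ≈ 0#
      ∑K-off-diagonal P Q Q≢P = trans (∑K P Q) (go (proj₁ (to Q) Fin.≟ proj₁ (to P)))
        where
        vanish : ∀ {i j : Fin n} → i ≢ j → sum {n} (λ k → t (ι k ℤ.* (ι i ℤ.- ι j))) ≈ 0#
        vanish {i} {j} i≢j = ∑-frequencies≈0 (ι i ℤ.- ι j) (λ h → i≢j (ι-injective
          (≋-trans (≋-reflexive (e (ι i) (ι j))) (≋-trans (≋-+ h ≋-refl) (≋-reflexive (ℤ.+-identityˡ (ι j)))))))
          where
          open ℤ.+-*-Solver
          e : ∀ a b → a ≡ a ℤ.- b ℤ.+ b
          e = solve 2 (λ a b → a := a :- b :+ b) ≡.refl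
        go : Dec (proj₁ (to Q) ≡ proj₁ (to P)) →
          sum {n} (λ j → t (ι j ℤ.* (U Q ℤ.- U P))) * sum {n} (λ l → t (ι l ℤ.* (W Q ℤ.- W P))) ≈ 0#
        go (no u≢) = trans (*-congʳ (vanish u≢)) (zeroˡ _)
        go (yes u≡) = trans (*-congˡ (vanish (λ w≡ → Q≢P
          (UW-injective (≋-reflexive (cong ι u≡)) (≋-reflexive (cong ι w≡)))))) (zeroʳ _)

      -- The coefficients `V α` of the eigenvector sum to (2n)² v P, so one of them is apart from
      -- zero. Moving the symmetric distance matrix onto the kernel gives x V α = μ V α, from which
      -- `V α` is cancelled.
      eigenvalue⇒μ : ∀ x → IsEigenvalue x → ∃[ j ] ∃[ l ] j ℕ.< n × l ℕ.< n × x ≈ μ j l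
      eigenvalue⇒μ x (v , (P , vP≉0) , eig) =
        let (α , nz) = nz-sum (λ α → V α) (nz-cong (sym ∑V) (nz-* (nz-* κ κ) vP≉0)) in
        first α , second α , Fin.toℕ<n (proj₁ (to α)) , Fin.toℕ<n (proj₂ (to α)) ,
        x-y≈0⇒x≈y (nz-cancel nz (begin
          V α * (x - μ′ α)           ≈⟨ solve 3 (λ v x y → v :* (x :- y) := x :* v :- y :* v) refl (V α) x (μ′ α) ⟩
          x * V α - μ′ α * V α       ≈⟨ x≈y⇒x-y≈0 (xV α) ⟩
          0#                         ∎))
        where
        open Solver
        κ : NonZero (ν n * ν 2)
        κ = nz-* (nz-ν (m ℕ.+ m)) (nz-ν 1)
        k : Fin N → Fin N → Carrier
        k α Q = K (first α) (second α) P Q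
        μ′ V : Fin N → Carrier
        μ′ α = μ (first α) (second α)
        V α = sum (λ Q → k α Q * v Q)
        xV : ∀ α → x * V α ≈ μ′ α * V α
        xV α = begin
          x * V α
            ≈⟨ *-distribˡ-sum x (λ Q → k α Q * v Q) ⟩
          sum (λ Q → x * (k α Q * v Q))
            ≈⟨ ∑-cong (λ Q → trans (solve 3 (λ x k v → x :* (k :* v) := k :* (x :* v)) refl x (k α Q) (v Q))
                 (trans (*-congˡ (sym (eig Q))) (*-distribˡ-sum (k α Q) (λ R → ν (d Q R) * v R)))) ⟩
          sum (λ Q → sum (λ R → k α Q * (ν (d Q R) * v R)))
            ≈⟨ ∑-comm (λ Q R → k α Q * (ν (d Q R) * v R)) ⟩
          sum (λ R → sum (λ Q → k α Q * (ν (d Q R) * v R)))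
            ≈⟨ ∑-cong (λ R → trans (∑-cong (λ Q → sym (*-assoc (k α Q) (ν (d Q R)) (v R))))
                 (sym (*-distribʳ-sum (v R) (λ Q → k α Q * ν (d Q R))))) ⟩
          sum (λ R → sum (λ Q → k α Q * ν (d Q R)) * v R)
            ≈⟨ ∑-cong (λ R → trans (*-congʳ (K-eigen (first α) (second α) (Fin.toℕ<n (proj₁ (to α))) (Fin.toℕ<n (proj₂ (to α))) P R))
                 (*-assoc (μ′ α) (k α R) (v R))) ⟩
          sum (λ R → μ′ α * (k α R * v R))
            ≈⟨ *-distribˡ-sum (μ′ α) (λ R → k α R * v R) ⟨
          μ′ α * V α ∎
        ∑V : sum V ≈ ν n * ν 2 * (ν n * ν 2) * v P
        ∑V = begin
          sum (λ α → sum (λ Q → k α Q * v Q))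
            ≈⟨ ∑-comm (λ α Q → k α Q * v Q) ⟩
          sum (λ Q → sum (λ α → k α Q * v Q))
            ≈⟨ ∑-cong (λ Q → *-distribʳ-sum (v Q) (λ α → k α Q)) ⟨
          sum (λ Q → sum (λ α → k α Q) * v Q)
            ≈⟨ ∑-single (λ Q → sum (λ α → k α Q) * v Q) P
                 (λ Q Q≢P → trans (*-congʳ (∑K-off-diagonal P Q Q≢P)) (zeroˡ (v Q))) ⟩
          sum (λ α → k α P) * v P
            ≈⟨ *-congʳ (∑K-diagonal P) ⟩
          ν n * ν 2 * (ν n * ν 2) * v P ∎

      -- One entry for the frequency (0 , 0), one for all frequencies off the axes, and `m` for the
      -- classes of j and -j on the axes.
      spectrum : Fin (2 ℕ.+ m) → Carrier
      spectrum Fin.zero               = μ 0 0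
      spectrum (Fin.suc Fin.zero)     = 0#
      spectrum (Fin.suc (Fin.suc i))  = Λ (+ suc (toℕ i)) * ν n

      -- `Λ` is even and periodic, so a frequency above `m` may be replaced by its complement to
      -- `n`.
      Λ-fold : ∀ j → j ≢ 0 → j ℕ.< n → ∃[ i ] Λ (+ j) ≈ Λ (+ suc (toℕ {m} i))
      Λ-fold zero j≢0 _ = contradiction ≡.refl j≢0
      Λ-fold (suc j) _ j<n with j ℕ.<? m
      ... | yes j<m = fromℕ< j<m , reflexive (cong (λ k → Λ (+ suc k)) (≡.sym (Fin.toℕ-fromℕ< j<m)))
      ... | no j≮m  = fromℕ< i<m , trans (∑-cong {m} λ s → *-congˡ {ν (suc (toℕ s))} (begin
              t (+ suc j ℤ.* + suc (toℕ s))            ≈⟨ t-neg (+ suc j ℤ.* + suc (toℕ s)) ⟨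
              t (ℤ.- (+ suc j ℤ.* + suc (toℕ s)))      ≈⟨ t-≋ {b = (+ n ℤ.- + suc j) ℤ.* + suc (toℕ s)} (mod (ℤ.- + suc (toℕ s)) (e (+ suc j) (+ suc (toℕ s)) (+ n))) ⟩
              t ((+ n ℤ.- + suc j) ℤ.* + suc (toℕ s))  ≈⟨ t-≡ (cong (ℤ._* + suc (toℕ s)) i≡) ⟩
              t (+ suc i ℤ.* + suc (toℕ s))            ∎))
            (reflexive (cong (λ k → Λ (+ suc k)) (≡.sym (Fin.toℕ-fromℕ< i<m))))
        where
        i = m ℕ.+ m ℕ.∸ suc j
        i≡ : + n ℤ.- + suc j ≡ + suc i
        i≡ = ≡.trans (ℤ.m-n≡m⊖n n (suc j)) (≡.trans (ℤ.⊖-≥ (ℕ.<⇒≤ j<n))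
               (cong +_ (ℕ.+-∸-assoc 1 (ℕ.s≤s⁻¹ j<n))))
        i<m : i ℕ.< m
        i<m = ℕ.s≤s (ℕ.≤-trans (ℕ.∸-monoʳ-≤ (m ℕ.+ m) (ℕ.s≤s (ℕ.≮⇒≥ j≮m)))
                (ℕ.≤-reflexive (≡.trans (cong (ℕ._∸ suc m) (≡.sym (ℕ.+-suc m-1 m))) (ℕ.m+n∸n≡m m-1 (suc m)))))
        open ℤ.+-*-Solver
        e : ∀ j s n → ℤ.- (j ℤ.* s) ≡ (n ℤ.- j) ℤ.* s ℤ.+ (ℤ.- s) ℤ.* n
        e = solve 3 (λ j s n → :- (j :* s) := (n :- j) :* s :+ (:- s) :* n) ≡.refl

      μ⇒spectrum : ∀ j l → j ℕ.< n → l ℕ.< n → ∃[ i ] μ j l ≈ spectrum i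
      μ⇒spectrum zero zero _ _ = Fin.zero , refl
      μ⇒spectrum (suc j) (suc l) _ _ = Fin.suc Fin.zero ,
        trans (+-cong (zeroʳ _) (zeroˡ _)) (+-identityˡ 0#)
      μ⇒spectrum (suc j) zero j<n _ = let (i , h) = Λ-fold (suc j) (λ ()) j<n in
        Fin.suc (Fin.suc i) , trans (+-cong (*-congʳ h) (zeroˡ _)) (+-identityʳ _)
      μ⇒spectrum zero (suc l) _ l<n = let (i , h) = Λ-fold (suc l) (λ ()) l<n in
        Fin.suc (Fin.suc i) , trans (+-cong (zeroʳ _) (trans (*-comm _ _) (*-congʳ h))) (+-identityˡ _)

      eigenvalue⇒spectrum : ∀ x → IsEigenvalue x → ∃[ i ] x ≈ spectrum i
      eigenvalue⇒spectrum x h =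
        let (j , l , j<n , l<n , e) = eigenvalue⇒μ x h
            (i , e′) = μ⇒spectrum j l j<n l<n
        in i , trans e e′

      IsEigenvalue-cong : ∀ {x y} → x ≈ y → IsEigenvalue x → IsEigenvalue y
      IsEigenvalue-cong e (v , nz , h) = v , nz , λ P → trans (h P) (*-congʳ e)

      spectrum-isEigenvalue : Fin N → ∀ i → IsEigenvalue (spectrum i)
      spectrum-isEigenvalue O Fin.zero = μ-isEigenvalue O 0 0 (ℕ.s≤s ℕ.z≤n) (ℕ.s≤s ℕ.z≤n)
      spectrum-isEigenvalue O (Fin.suc Fin.zero) = IsEigenvalue-cong
        (proj₂ (μ⇒spectrum 1 1 1<n 1<n)) (μ-isEigenvalue O 1 1 1<n 1<n)
        where
        1<n : 1 ℕ.< n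
        1<n = ℕ.s≤s (ℕ.s≤s ℕ.z≤n)
      spectrum-isEigenvalue O (Fin.suc (Fin.suc i)) = IsEigenvalue-cong
        (trans (+-congˡ (zeroˡ _)) (+-identityʳ _))
        (μ-isEigenvalue O (suc (toℕ i)) 0 (ℕ.s≤s (ℕ.≤-trans (Fin.toℕ<n i) (ℕ.m≤m+n m m))) (ℕ.s≤s ℕ.z≤n))

      nz-swap : ∀ {x y} → NonZero (x - y) → NonZero (y - x)
      nz-swap {x} {y} h = nz-cong (solve 2 (λ x y → :- (x :- y) := y :- x) refl x y) (nz-neg h)
        where open Solver

      index≢0 : ∀ (i : Fin m) → ¬ (+ suc (toℕ i) ≋ + 0)
      index≢0 i = ≢0 (ℕ.s≤s ℕ.z≤n) (ℕ.s≤s (ℕ.≤-trans (Fin.toℕ<n i) (ℕ.m≤m+n m m)))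

      x-0≉0 : ∀ {x} → NonZero x → NonZero (x - 0#)
      x-0≉0 {x} = nz-cong (begin
        x            ≈⟨ solve 2 (λ x z → x := x :+ (z :- z)) refl x 0# ⟩
        x + (0# - 0#) ≈⟨ +-congˡ (+-identityˡ (- 0#)) ⟩
        x - 0#       ∎)
        where open Solver

      n≉0 : NonZero (ν n)
      n≉0 = nz-ν (m ℕ.+ m)

      spectrum≉0 : ∀ i → NonZero (spectrum (Fin.suc (Fin.suc i)))
      spectrum≉0 i = nz-* (Λ≉0 (+ suc (toℕ i)) (index≢0 i)) n≉0

      μ₀₀≉0 : NonZero (μ 0 0)
      μ₀₀≉0 = nz-cong (begin
        ν (suc r) * ν 2 * ν n             ≈⟨ *-congʳ (*-congʳ (proj₂ Λ0-natural)) ⟨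
        Λ (+ 0) * ν 2 * ν n               ≈⟨ solve 2 (λ l k → l :* con (+ 2) :* k := l :* k :+ k :* l) refl (Λ (+ 0)) (ν n) ⟩
        μ 0 0                             ∎) (nz-* (nz-* (nz-ν r) (nz-ν 1)) n≉0)
        where
        r = proj₁ Λ0-natural
        open Solver

      μ₀₀-apart : ∀ i → NonZero (μ 0 0 - spectrum (Fin.suc (Fin.suc i)))
      μ₀₀-apart i = nz-cong
        (solve 3 (λ l k x → (l :+ l :- x) :* k := (l :* k :+ k :* l) :- x :* k) refl (Λ (+ 0)) (ν n) (Λ (+ suc (toℕ i))))
        (nz-* (2Λ0-Λ≉0 (+ suc (toℕ i)) (index≢0 i)) n≉0)
        where open Solver

      spectrum-apart : ∀ i j → i ≢ j → NonZero (spectrum i - spectrum j)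
      spectrum-apart Fin.zero Fin.zero i≢j = contradiction ≡.refl i≢j
      spectrum-apart Fin.zero (Fin.suc Fin.zero) _ = x-0≉0 μ₀₀≉0
      spectrum-apart Fin.zero (Fin.suc (Fin.suc j)) _ = μ₀₀-apart j
      spectrum-apart (Fin.suc Fin.zero) Fin.zero _ = nz-swap (x-0≉0 μ₀₀≉0)
      spectrum-apart (Fin.suc Fin.zero) (Fin.suc Fin.zero) i≢j = contradiction ≡.refl i≢j
      spectrum-apart (Fin.suc Fin.zero) (Fin.suc (Fin.suc j)) _ = nz-swap (x-0≉0 (spectrum≉0 j))
      spectrum-apart (Fin.suc (Fin.suc i)) Fin.zero _ = nz-swap (μ₀₀-apart i)
      spectrum-apart (Fin.suc (Fin.suc i)) (Fin.suc Fin.zero) _ = x-0≉0 (spectrum≉0 i)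
      spectrum-apart (Fin.suc (Fin.suc i)) (Fin.suc (Fin.suc j)) i≢j = nz-cong
        (solve 3 (λ x y k → (x :- y) :* k := x :* k :- y :* k) refl (Λ a) (Λ b) (ν n))
        -- Both indices lie between 1 and `m`: their sum is positive and below `n`, and congruent
        -- ones are equal.
        (nz-* (Λ-apart a b (index≢0 i) (index≢0 j)
          (≢0 (ℕ.s≤s ℕ.z≤n) (ℕ.s≤s (ℕ.+-mono-≤ (Fin.toℕ<n i) (Fin.toℕ<n j))))
          (λ h → i≢j (cong (Fin.suc ∘ Fin.suc) (Fin.toℕ-injective (ℕ.suc-injective (ℤ.+-injective (difference h))))))) n≉0)
        where
        a = + suc (toℕ i)
        b = + suc (toℕ j)
        open Solver
        difference : a ℤ.- b ≋ + 0 → a ≡ b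
        difference h = ≋-unique (Fin.toℕ<n i) (Fin.toℕ<n j)
          (≋-trans (≋-reflexive (e a b)) (≋-trans (≋-+ h ≋-refl) (≋-reflexive (ℤ.+-identityˡ b))))
          where
          open ℤ.+-*-Solver using () renaming (solve to solveℤ; _:+_ to _⊕_; _:-_ to _⊝_; _:=_ to _⊜_)
          e : ∀ a b → a ≡ a ℤ.- b ℤ.+ b
          e = solveℤ 2 (λ a b → a ⊜ (a ⊝ b) ⊕ b) ≡.refl

  torus-spectrum : (m-1 : ℕ) (c : Carrier) (p : ℕ → Carrier) →
    p 0 ≈ 1# → p 1 ≈ c + 1# → (∀ k → p (2 ℕ.+ k) ≈ c * p (1 ℕ.+ k) - p k) →
    p (suc m-1) ≈ 0# → (∀ k → k ℕ.< suc m-1 → NonZero (p k)) → NonZero (p m-1 + ν 2) →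
    let open Cyclic (suc m-1) in
    {N : ℕ} (π : Fin N ↔ (Fin n × Fin n)) (d : Fin N → Fin N → ℕ) →
    (∀ P Q → 
      d P Q ≡ δ (ι (proj₁ (Inverse.to π P)) ℤ.- ι (proj₁ (Inverse.to π Q)))
          ℕ.+ δ (ι (proj₂ (Inverse.to π P)) ℤ.- ι (proj₂ (Inverse.to π Q)))) →
    Fin N →
    let IsEigenvalue : Carrier → Set
        IsEigenvalue x = Σ[ v ∈ (Fin N → Carrier) ] (∃[ P ] NonZero (v P)) ×
          (∀ P → sum (λ Q → ν (d P Q) * v Q) ≈ x * v P)
    in Σ[ μ ∈ (Fin (3 ℕ.+ m-1) → Carrier) ]
      (∀ i j → i ≢ j → NonZero (μ i - μ j)) × (∀ i → IsEigenvalue (μ i)) × (∀ x → IsEigenvalue x → ∃[ i ] x ≈ μ i)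
  torus-spectrum m-1 c p p₀ p₁ pₖ pₘ≈0 p≉0 p+2≉0 π d d≡ O =
    spectrum , spectrum-apart , spectrum-isEigenvalue O , eigenvalue⇒spectrum
    where
    open Rotation m-1 c p p₀ p₁ pₖ pₘ≈0 p≉0 p+2≉0
    open Torus π d d≡

-- The Cauchy reals as a commutative ring

open import Defs
open ≡ using (refl; sym; trans; subst₂)

≈-pointwise : ∀ {x y} → (∀ n → seq x n ≡ seq y n) → x ≈ y
≈-pointwise {x} {y} h = mk≈ λ ε 0<ε → 0 , λ n _ →
  subst (ℚ._< ε)
    (sym (cong ∣_∣ (trans (cong (ℚ._- seq y n) (h n)) (ℚ.+-inverseʳ (seq y n))))) 0<ε

≈-refl : ∀ {x} → x ≈ x
≈-refl = ≈-pointwise λ _ → refl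

∣p-q∣≡∣q-p∣ : ∀ p q → ∣ p ℚ.- q ∣ ≡ ∣ q ℚ.- p ∣
∣p-q∣≡∣q-p∣ p q = trans (cong ∣_∣ (flip p q)) (ℚ.∣-p∣≡∣p∣ (q ℚ.- p))
  where
  open ℚ.+-*-Solver
  flip : ∀ p q → p ℚ.- q ≡ ℚ.- (q ℚ.- p)
  flip = solve 2 (λ p q → p :- q := :- (q :- p)) refl

≈-sym : ∀ {x y} → x ≈ y → y ≈ x
≈-sym {x} {y} (mk≈ h) = mk≈ λ ε 0<ε → let (N , k) = h ε 0<ε in
  N , λ n N≤n → subst (ℚ._< ε) (∣p-q∣≡∣q-p∣ (seq x n) (seq y n)) (k n N≤n)

∣p+q∣<ε : ∀ p q {ε} → ∣ p ∣ ℚ.< ε ℚ.* ½ → ∣ q ∣ ℚ.< ε ℚ.* ½ → ∣ p ℚ.+ q ∣ ℚ.< ε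
∣p+q∣<ε p q {ε} hp hq = begin-strict
  ∣ p ℚ.+ q ∣          ≤⟨ ℚ.∣p+q∣≤∣p∣+∣q∣ p q ⟩
  ∣ p ∣ ℚ.+ ∣ q ∣      <⟨ ℚ.+-mono-< hp hq ⟩
  ε ℚ.* ½ ℚ.+ ε ℚ.* ½  ≡⟨ half+half ε ⟩
  ε                    ∎
  where open ℚ.≤-Reasoning

≈-trans : ∀ {x y z} → x ≈ y → y ≈ z → x ≈ z
≈-trans {x} {y} {z} (mk≈ h) (mk≈ k) = mk≈ λ ε 0<ε →
  let (N , h′) = h (ε ℚ.* ½) (half-pos 0<ε)
      (M , k′) = k (ε ℚ.* ½) (half-pos 0<ε)
  in N ℕ.⊔ M , λ n le → subst (λ q → ∣ q ∣ ℚ.< ε) (split (seq x n) (seq y n) (seq z n))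
       (∣p+q∣<ε (seq x n ℚ.- seq y n) (seq y n ℚ.- seq z n)
          (h′ n (ℕ.m⊔n≤o⇒m≤o N M le)) (k′ n (ℕ.m⊔n≤o⇒n≤o N M le)))
  where
  open ℚ.+-*-Solver
  split : ∀ a b c → (a ℚ.- b) ℚ.+ (b ℚ.- c) ≡ a ℚ.- c
  split = solve 3 (λ a b c → (a :- b) :+ (b :- c) := a :- c) refl

+ℝ-cong : ∀ {x y u v} → x ≈ y → u ≈ v → x +ℝ u ≈ y +ℝ v
+ℝ-cong {x} {y} {u} {v} (mk≈ h) (mk≈ k) = mk≈ λ ε 0<ε →
  let (N , h′) = h (ε ℚ.* ½) (half-pos 0<ε)
      (M , k′) = k (ε ℚ.* ½) (half-pos 0<ε)
  in N ℕ.⊔ M , λ n le →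
       subst (λ q → ∣ q ∣ ℚ.< ε) (split (seq x n) (seq y n) (seq u n) (seq v n))
       (∣p+q∣<ε (seq x n ℚ.- seq y n) (seq u n ℚ.- seq v n)
          (h′ n (ℕ.m⊔n≤o⇒m≤o N M le)) (k′ n (ℕ.m⊔n≤o⇒n≤o N M le)))
  where
  open ℚ.+-*-Solver
  split : ∀ a b c d → (a ℚ.- b) ℚ.+ (c ℚ.- d) ≡ (a ℚ.+ c) ℚ.- (b ℚ.+ d)
  split = solve 4 (λ a b c d → (a :- b) :+ (c :- d) := (a :+ c) :- (b :+ d)) refl

*ℝ-cong : ∀ {x y u v} → x ≈ y → u ≈ v → x *ℝ u ≈ y *ℝ v
*ℝ-cong {x} {y} {u} {v} (mk≈ h) (mk≈ k) = mk≈ λ ε 0<ε →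
  let (A , 0<A , N₁ , hA) = bounded (cauchy x)
      (B , 0<B , N₂ , hB) = bounded (cauchy v)
      (δ , 0<δ , Aδ) = shrink A ε 0<A 0<ε
      (η , 0<η , Bη) = shrink B ε 0<B 0<ε
      (N₃ , h′) = h η 0<η
      (N₄ , k′) = k δ 0<δ
  in (N₁ ℕ.⊔ N₂) ℕ.⊔ (N₃ ℕ.⊔ N₄) , λ n le →
     let l₁ = ℕ.m⊔n≤o⇒m≤o (N₁ ℕ.⊔ N₂) (N₃ ℕ.⊔ N₄) le
         l₂ = ℕ.m⊔n≤o⇒n≤o (N₁ ℕ.⊔ N₂) (N₃ ℕ.⊔ N₄) le
     in product-bound (seq x n) (seq u n) (seq y n) (seq v n) {ε = ε} 0<A 0<B
          (hA n (ℕ.m⊔n≤o⇒m≤o N₁ N₂ l₁)) (hB n (ℕ.m⊔n≤o⇒n≤o N₁ N₂ l₁))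
          (k′ n (ℕ.m⊔n≤o⇒n≤o N₃ N₄ l₂)) (h′ n (ℕ.m⊔n≤o⇒m≤o N₃ N₄ l₂)) Aδ Bη

1ℝ : ℝ
1ℝ = fromℚ 1ℚ

infix 8 -ℝ_

-- As a multiple by -1 it inherits the Cauchy property and congruence from `_*ℝ_`; `seq-neg`
-- restores the termwise description.
-ℝ_ : ℝ → ℝ
-ℝ x = fromℚ (ℚ.- 1ℚ) *ℝ x

seq-neg : ∀ x n → seq (-ℝ x) n ≡ ℚ.- seq x n
seq-neg x n = trans (sym (ℚ.neg-distribˡ-* 1ℚ (seq x n))) (cong ℚ.-_ (ℚ.*-identityˡ (seq x n)))

ℝ-commutativeRing : CommutativeRing 0ℓ 0ℓ
ℝ-commutativeRing = record
  { Carrier = ℝ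
  ; _≈_ = _≈_
  ; _+_ = _+ℝ_
  ; _*_ = _*ℝ_
  ; -_ = -ℝ_
  ; 0# = 0ℝ
  ; 1# = 1ℝ
  ; isCommutativeRing = record
    { isRing = record
      { +-isAbelianGroup = record
        { isGroup = record
          { isMonoid = record
            { isSemigroup = record
              { isMagma = record
                { isEquivalence = record { refl = ≈-refl ; sym = ≈-sym ; trans = ≈-trans }
                ; ∙-cong = +ℝ-cong
                }
              ; assoc = λ x y z → ≈-pointwise λ n → ℚ.+-assoc (seq x n) (seq y n) (seq z n)
              }
            ; identity = (λ x → ≈-pointwise λ n → ℚ.+-identityˡ (seq x n))
                       , (λ x → ≈-pointwise λ n → ℚ.+-identityʳ (seq x n))
            }
          ; inverse = (λ x → ≈-pointwise λ n →
                        trans (cong (ℚ._+ seq x n) (seq-neg x n)) (ℚ.+-inverseˡ (seq x n)))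
                    , (λ x → ≈-pointwise λ n →
                        trans (cong (seq x n ℚ.+_) (seq-neg x n)) (ℚ.+-inverseʳ (seq x n)))
          ; ⁻¹-cong = λ {x} {y} → *ℝ-cong {fromℚ (ℚ.- 1ℚ)} {fromℚ (ℚ.- 1ℚ)} {x} {y} ≈-refl
          }
        ; comm = λ x y → ≈-pointwise λ n → ℚ.+-comm (seq x n) (seq y n)
        }
      ; *-cong = *ℝ-cong
      ; *-assoc = λ x y z → ≈-pointwise λ n → ℚ.*-assoc (seq x n) (seq y n) (seq z n)
      ; *-identity = (λ x → ≈-pointwise λ n → ℚ.*-identityˡ (seq x n))
                   , (λ x → ≈-pointwise λ n → ℚ.*-identityʳ (seq x n))
      ; distrib = (λ x y z → ≈-pointwise λ n → ℚ.*-distribˡ-+ (seq x n) (seq y n) (seq z n))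
                , (λ x y z → ≈-pointwise λ n → ℚ.*-distribʳ-+ (seq x n) (seq y n) (seq z n))
      }
    ; *-comm = λ x y → ≈-pointwise λ n → ℚ.*-comm (seq x n) (seq y n)
    }
  }

-- Integers

ℤ/1-+ : ∀ a b → (a ℤ.+ b) ℚ./ 1 ≡ a ℚ./ 1 ℚ.+ b ℚ./ 1
ℤ/1-+ a b = ℚ.toℚᵘ-injective (begin
  ℚ.toℚᵘ ((a ℤ.+ b) ℚ./ 1)                   ≈⟨ ℚ.toℚᵘ-fromℚᵘ (mkℚᵘ (a ℤ.+ b) 0) ⟩
  mkℚᵘ (a ℤ.+ b) 0                           ≈⟨ *≡* (lem a b) ⟩
  mkℚᵘ a 0 ℚᵘ.+ mkℚᵘ b 0                     ≈⟨ ℚᵘ.+-cong (ℚ.toℚᵘ-fromℚᵘ (mkℚᵘ a 0)) (ℚ.toℚᵘ-fromℚᵘ (mkℚᵘ b 0)) ⟨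
  ℚ.toℚᵘ (a ℚ./ 1) ℚᵘ.+ ℚ.toℚᵘ (b ℚ./ 1)     ≈⟨ ℚ.toℚᵘ-homo-+ (a ℚ./ 1) (b ℚ./ 1) ⟨
  ℚ.toℚᵘ (a ℚ./ 1 ℚ.+ b ℚ./ 1)               ∎)
  where
  open import Relation.Binary.Reasoning.Setoid ℚᵘ.≃-setoid
  open ℤ.+-*-Solver
  lem : ∀ a b → (a ℤ.+ b) ℤ.* (+ 1 ℤ.* + 1) ≡ (a ℤ.* + 1 ℤ.+ b ℤ.* + 1) ℤ.* + 1
  lem = solve 2 (λ a b → (a :+ b) :* (con (+ 1) :* con (+ 1)) := (a :* con (+ 1) :+ b :* con (+ 1)) :* con (+ 1)) refl

ℤ/1-* : ∀ a b → (a ℤ.* b) ℚ./ 1 ≡ (a ℚ./ 1) ℚ.* (b ℚ./ 1)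
ℤ/1-* a b = ℚ.toℚᵘ-injective (begin
  ℚ.toℚᵘ ((a ℤ.* b) ℚ./ 1)                   ≈⟨ ℚ.toℚᵘ-fromℚᵘ (mkℚᵘ (a ℤ.* b) 0) ⟩
  mkℚᵘ a 0 ℚᵘ.* mkℚᵘ b 0                     ≈⟨ ℚᵘ.*-cong (ℚ.toℚᵘ-fromℚᵘ (mkℚᵘ a 0)) (ℚ.toℚᵘ-fromℚᵘ (mkℚᵘ b 0)) ⟨
  ℚ.toℚᵘ (a ℚ./ 1) ℚᵘ.* ℚ.toℚᵘ (b ℚ./ 1)     ≈⟨ ℚ.toℚᵘ-homo-* (a ℚ./ 1) (b ℚ./ 1) ⟨
  ℚ.toℚᵘ ((a ℚ./ 1) ℚ.* (b ℚ./ 1))           ∎)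
  where open import Relation.Binary.Reasoning.Setoid ℚᵘ.≃-setoid

ℤ/1-neg : ∀ a → (ℤ.- a) ℚ./ 1 ≡ ℚ.- (a ℚ./ 1)
ℤ/1-neg (+ zero)  = refl
ℤ/1-neg (+ suc _) = refl
ℤ/1-neg -[1+ n ]  = neg-neg (+ suc n ℚ./ 1)
  where
  open ℚ.+-*-Solver
  neg-neg : ∀ p → p ≡ ℚ.- (ℚ.- p)
  neg-neg = solve 1 (λ p → p := :- (:- p)) refl

0≤ℕ/1 : ∀ k → 0ℚ ℚ.≤ + k ℚ./ 1
0≤ℕ/1 k = ℚ.nonNegative⁻¹ (+ k ℚ./ 1) {{ℚ.normalize-nonNeg k 1}}

fromℤ : ℤ → ℝ
fromℤ z = fromℚ (z ℚ./ 1)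

fromℤ-homomorphism : CommutativeRing.rawRing ℤ.+-*-commutativeRing
  ACR.-Raw-AlmostCommutative⟶ ACR.fromCommutativeRing ℝ-commutativeRing
fromℤ-homomorphism = record
  { ⟦_⟧    = fromℤ
  ; +-homo = λ a b → ≈-pointwise λ _ → ℤ/1-+ a b
  ; *-homo = λ a b → ≈-pointwise λ _ → ℤ/1-* a b
  ; -‿homo = λ a → ≈-pointwise λ n → trans (ℤ/1-neg a) (sym (seq-neg (fromℤ a) n))
  ; 0-homo = ≈-refl
  ; 1-homo = ≈-refl
  }

-- Apartness

<⇒≱ : ∀ {p q} → p ℚ.< q → ¬ (q ℚ.≤ p)
<⇒≱ p<q q≤p = ℚ.<-irrefl refl (ℚ.<-≤-trans p<q q≤p)

p-0≡p : ∀ p → p ℚ.- 0ℚ ≡ p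
p-0≡p p = ℚ.+-identityʳ p

-- Apartness from `0ℝ` with the subtraction of 0 removed, so that bounds apply to the terms of the
-- sequence.
BoundedAway : ℝ → Set
BoundedAway x = ∃[ ε ] 0ℚ ℚ.< ε × ∃[ N ] ∀ n → N ℕ.≤ n → ε ℚ.≤ ∣ seq x n ∣

boundedAway⇒# : ∀ {x y} → BoundedAway (x +ℝ (-ℝ y)) → x # y
boundedAway⇒# {x} {y} (ε , 0<ε , N , h) = mk# (ε , 0<ε , N , λ n le →
  subst (λ q → ε ℚ.≤ ∣ seq x n ℚ.+ q ∣) (seq-neg y n) (h n le))

#0⇒boundedAway : ∀ {x} → x # 0ℝ → BoundedAway x
#0⇒boundedAway {x} (mk# (ε , 0<ε , N , h)) = ε , 0<ε , N , λ n le →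
  subst (λ q → ε ℚ.≤ ∣ q ∣) (p-0≡p (seq x n)) (h n le)

boundedAway⇒#0 : ∀ {x} → BoundedAway x → x # 0ℝ
boundedAway⇒#0 {x} (ε , 0<ε , N , h) = mk# (ε , 0<ε , N , λ n le →
  subst (λ q → ε ℚ.≤ ∣ q ∣) (sym (p-0≡p (seq x n))) (h n le))

private
  cover : ∀ p q {ε} → ε ℚ.≤ ∣ p ∣ → ∣ p ℚ.- q ∣ ℚ.< ε ℚ.* ½ → ε ℚ.* ½ ℚ.≤ ∣ q ∣
  cover p q {ε} hp hd with ε ℚ.* ½ ℚ.≤? ∣ q ∣
  ... | yes le = le
  ... | no nle = contradiction hp (<⇒≱ (subst (λ r → ∣ r ∣ ℚ.< ε) (split p q)
                   (∣p+q∣<ε (p ℚ.- q) q hd (ℚ.≰⇒> nle))))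
    where
    open ℚ.+-*-Solver
    split : ∀ a b → (a ℚ.- b) ℚ.+ b ≡ a
    split = solve 2 (λ a b → (a :- b) :+ b := a) refl

boundedAway-cong : ∀ {x y} → x ≈ y → BoundedAway x → BoundedAway y
boundedAway-cong {x} {y} (mk≈ e) (ε , 0<ε , N , h) =
  let (M , k) = e (ε ℚ.* ½) (half-pos 0<ε) in
  ε ℚ.* ½ , half-pos 0<ε , N ℕ.⊔ M , λ n le →
    cover (seq x n) (seq y n) (h n (ℕ.m⊔n≤o⇒m≤o N M le)) (k n (ℕ.m⊔n≤o⇒n≤o N M le))

pos*pos : ∀ {p q} → 0ℚ ℚ.< p → 0ℚ ℚ.< q → 0ℚ ℚ.< p ℚ.* q
pos*pos {p} {q} 0<p 0<q = ℚ.positive⁻¹ (p ℚ.* q)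
  {{ℚ.pos*pos⇒pos p {{ℚ.positive 0<p}} q {{ℚ.positive 0<q}}}}

*-mono-≤₀ : ∀ {p q r s} → 0ℚ ℚ.≤ p → 0ℚ ℚ.≤ s → p ℚ.≤ q → r ℚ.≤ s → p ℚ.* r ℚ.≤ q ℚ.* s
*-mono-≤₀ {p} {q} {r} {s} 0≤p 0≤s p≤q r≤s = ℚ.≤-trans
  (ℚ.*-monoˡ-≤-nonNeg p {{ℚ.nonNegative 0≤p}} r≤s)
  (ℚ.*-monoʳ-≤-nonNeg s {{ℚ.nonNegative 0≤s}} p≤q)

boundedAway-* : ∀ {x y} → BoundedAway x → BoundedAway y → BoundedAway (x *ℝ y)
boundedAway-* {x} {y} (ε , 0<ε , N , h) (η , 0<η , M , k) =
  ε ℚ.* η , pos*pos 0<ε 0<η , N ℕ.⊔ M , λ n le →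
    subst (ε ℚ.* η ℚ.≤_) (sym (ℚ.∣p*q∣≡∣p∣*∣q∣ (seq x n) (seq y n)))
      (*-mono-≤₀ (ℚ.<⇒≤ 0<ε) (ℚ.0≤∣p∣ (seq y n))
        (h n (ℕ.m⊔n≤o⇒m≤o N M le)) (k n (ℕ.m⊔n≤o⇒n≤o N M le)))

-- With `B` an eventual bound for `y`, a term of `x` below ε/(2B) would bring the product down to
-- ε/2.
boundedAway-*ˡ : ∀ {x y} → BoundedAway (x *ℝ y) → BoundedAway x
boundedAway-*ˡ {x} {y} (ε , 0<ε , N , h) =
  let (B , 0<B , M , k) = bounded (cauchy y)
      (δ , 0<δ , Bδ) = shrink B ε 0<B 0<ε
  in δ , 0<δ , N ℕ.⊔ M , λ n le → ℚ.≮⇒≥ λ x<δ → <⇒≱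
       (begin-strict
         ∣ seq x n ℚ.* seq y n ∣      ≡⟨ ℚ.∣p*q∣≡∣p∣*∣q∣ (seq x n) (seq y n) ⟩
         ∣ seq x n ∣ ℚ.* ∣ seq y n ∣  ≤⟨ *-mono-≤₀ (ℚ.0≤∣p∣ (seq x n)) (ℚ.<⇒≤ 0<B) (ℚ.<⇒≤ x<δ)
                                          (k n (ℕ.m⊔n≤o⇒n≤o N M le)) ⟩
         δ ℚ.* B                      ≡⟨ ℚ.*-comm δ B ⟩
         B ℚ.* δ                      ≡⟨ Bδ ⟩
         ε ℚ.* ½                      <⟨ ℚ.*-monoʳ-<-pos ε {{ℚ.positive 0<ε}} (ℚ.*<* (ℤ.+<+ (ℕ.s≤s (ℕ.s≤s ℕ.z≤n)))) ⟩
         ε ℚ.* 1ℚ                     ≡⟨ ℚ.*-identityʳ ε ⟩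
         ε                            ∎)
       (h n (ℕ.m⊔n≤o⇒m≤o N M le))
  where open ℚ.≤-Reasoning

-- At a single late index one of the two terms is at least ε/2 in size, and
-- the Cauchy property keeps it there.
boundedAway-+ : ∀ {x y} → BoundedAway (x +ℝ y) → BoundedAway x ⊎ BoundedAway y
boundedAway-+ {x} {y} (ε , 0<ε , N , h) = go (cauchy x γ 0<γ) (cauchy y γ 0<γ)
  where
  -- One halving divides `ε` between the two terms, the other absorbs their drift after the chosen
  -- index.
  γ = ε ℚ.* ½ ℚ.* ½
  0<γ = half-pos (half-pos 0<ε)
  go : ∃[ K ] (∀ m n → K ℕ.≤ m → K ℕ.≤ n → ∣ seq x m ℚ.- seq x n ∣ ℚ.< γ) →
       ∃[ K ] (∀ m n → K ℕ.≤ m → K ℕ.≤ n → ∣ seq y m ℚ.- seq y n ∣ ℚ.< γ) →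
       BoundedAway x ⊎ BoundedAway y
  go (K , hx) (L , hy) with ε ℚ.* ½ ℚ.≤? ∣ seq x (N ℕ.⊔ (K ℕ.⊔ L)) ∣
  ... | yes le = inj₁ (γ , 0<γ , N ℕ.⊔ (K ℕ.⊔ L) , λ n m≤n →
          cover (seq x M) (seq x n) le (hx M n K≤M (ℕ.≤-trans K≤M m≤n)))
    where
    M = N ℕ.⊔ (K ℕ.⊔ L)
    K≤M = ℕ.≤-trans (ℕ.m≤m⊔n K L) (ℕ.m≤n⊔m N (K ℕ.⊔ L))
  ... | no nle = inj₂ (γ , 0<γ , M , λ n m≤n →
          cover (seq y M) (seq y n) ly (hy M n L≤M (ℕ.≤-trans L≤M m≤n)))
    where
    M = N ℕ.⊔ (K ℕ.⊔ L)
    L≤M = ℕ.≤-trans (ℕ.m≤n⊔m K L) (ℕ.m≤n⊔m N (K ℕ.⊔ L))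
    ly : ε ℚ.* ½ ℚ.≤ ∣ seq y M ∣
    ly = ℚ.≮⇒≥ λ y< → <⇒≱ (∣p+q∣<ε (seq x M) (seq y M) (ℚ.≰⇒> nle) y<)
           (h M (ℕ.m≤m⊔n N (K ℕ.⊔ L)))

≈0-cancel : ∀ {x y} → BoundedAway x → x *ℝ y ≈ 0ℝ → y ≈ 0ℝ
≈0-cancel {x} {y} (ε , 0<ε , N , h) (mk≈ e) = mk≈ λ η 0<η →
  let (M , k) = e (ε ℚ.* η) (pos*pos 0<ε 0<η) in
  N ℕ.⊔ M , λ n le → subst (λ q → ∣ q ∣ ℚ.< η) (sym (p-0≡p (seq y n)))
    (ℚ.*-cancelˡ-<-nonNeg ε {{ℚ.nonNegative (ℚ.<⇒≤ 0<ε)}} (begin-strict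
      ε ℚ.* ∣ seq y n ∣            ≤⟨ *-mono-≤₀ (ℚ.<⇒≤ 0<ε) (ℚ.0≤∣p∣ (seq y n))
                                       (h n (ℕ.m⊔n≤o⇒m≤o N M le)) ℚ.≤-refl ⟩
      ∣ seq x n ∣ ℚ.* ∣ seq y n ∣  ≡⟨ ℚ.∣p*q∣≡∣p∣*∣q∣ (seq x n) (seq y n) ⟨
      ∣ seq x n ℚ.* seq y n ∣      ≡⟨ cong ∣_∣ (p-0≡p (seq x n ℚ.* seq y n)) ⟨
      ∣ seq x n ℚ.* seq y n ℚ.- 0ℚ ∣ <⟨ k n (ℕ.m⊔n≤o⇒n≤o N M le) ⟩
      ε ℚ.* η                      ∎))
  where open ℚ.≤-Reasoning

0≤p*p : ∀ p → 0ℚ ℚ.≤ p ℚ.* p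
0≤p*p p with ℚ.∣p∣≡p∨∣p∣≡-p p
... | inj₁ e = subst (λ q → 0ℚ ℚ.≤ q ℚ.* q) e (ℚ.≤-trans (ℚ.0≤∣p∣ _) (ℚ.≤-reflexive (ℚ.∣p*q∣≡∣p∣*∣q∣ p p)))
... | inj₂ e = subst (0ℚ ℚ.≤_) (trans (ℚ.∣p*q∣≡∣p∣*∣q∣ p p) (trans (cong (λ q → q ℚ.* q) e) (sq p))) (ℚ.0≤∣p∣ (p ℚ.* p))
  where
  open ℚ.+-*-Solver
  sq : ∀ p → (ℚ.- p) ℚ.* (ℚ.- p) ≡ p ℚ.* p
  sq = solve 1 (λ p → (:- p) :* (:- p) := p :* p) refl

boundedAway-kz²+1 : ∀ k z → BoundedAway (fromℕ k *ℝ (z *ℝ z) +ℝ 1ℝ)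
boundedAway-kz²+1 k z = 1ℚ , ℚ.positive⁻¹ 1ℚ , 0 , λ n _ →
  let w = (+ k ℚ./ 1) ℚ.* (seq z n ℚ.* seq z n)
      0≤w = subst (ℚ._≤ w) (ℚ.*-zeroˡ 0ℚ) (*-mono-≤₀ ℚ.≤-refl (0≤p*p (seq z n)) (0≤ℕ/1 k) (0≤p*p (seq z n)))
      1≤w+1 = subst (ℚ._≤ w ℚ.+ 1ℚ) (ℚ.+-identityˡ 1ℚ) (ℚ.+-monoˡ-≤ 1ℚ 0≤w)
  in subst (1ℚ ℚ.≤_) (sym (ℚ.0≤p⇒∣p∣≡p (ℚ.≤-trans (ℚ.nonNegative⁻¹ 1ℚ) 1≤w+1))) 1≤w+1

2ℚ : ℚ
2ℚ = + 2 ℚ./ 1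

-- As (k + 2)/2 is at most k + 1, halving a width preserves the bound width × (k + 1) ≤ initial
-- width, from which the Archimedean property makes widths small.
halving-bound : ∀ w k → 0ℚ ℚ.≤ w → w ℚ.* ½ ℚ.* (+ (2 ℕ.+ k) ℚ./ 1) ℚ.≤ w ℚ.* (+ suc k ℚ./ 1)
halving-bound w k 0≤w = begin
  w ℚ.* ½ ℚ.* (+ (2 ℕ.+ k) ℚ./ 1)        ≡⟨ ℚ.*-assoc w ½ (+ (2 ℕ.+ k) ℚ./ 1) ⟩
  w ℚ.* (½ ℚ.* (+ (2 ℕ.+ k) ℚ./ 1))      ≤⟨ ℚ.*-monoˡ-≤-nonNeg w {{ℚ.nonNegative 0≤w}} ineq ⟩
  w ℚ.* (+ suc k ℚ./ 1)                  ∎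
  where
  open ℚ.≤-Reasoning
  open ℚ.+-*-Solver
  K = + k ℚ./ 1
  ineq : ½ ℚ.* (+ (2 ℕ.+ k) ℚ./ 1) ℚ.≤ + suc k ℚ./ 1
  ineq = begin
    ½ ℚ.* (+ (2 ℕ.+ k) ℚ./ 1)       ≡⟨ cong (½ ℚ.*_) (ℤ/1-+ (+ 2) (+ k)) ⟩
    ½ ℚ.* (2ℚ ℚ.+ K)                ≡⟨ solve 1 (λ k → con ½ :* (con 2ℚ :+ k) := con 1ℚ :+ k :* con ½) refl K ⟩
    1ℚ ℚ.+ K ℚ.* ½                  ≤⟨ ℚ.+-monoʳ-≤ 1ℚ (ℚ.*-monoˡ-≤-nonNeg K {{ℚ.nonNegative (0≤ℕ/1 k)}} (from-yes (½ ℚ.≤? 1ℚ))) ⟩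
    1ℚ ℚ.+ K ℚ.* 1ℚ                 ≡⟨ cong (1ℚ ℚ.+_) (ℚ.*-identityʳ K) ⟩
    1ℚ ℚ.+ K                        ≡⟨ ℤ/1-+ (+ 1) (+ k) ⟨
    + suc k ℚ./ 1                   ∎

archimedean : ∀ B ε → 0ℚ ℚ.< ε → ∃[ N ] B ℚ.< ε ℚ.* (+ suc N ℚ./ 1)
archimedean B ε 0<ε = let (N , h) = below (B ℚ.* ℚ.1/ ε) in N , (begin-strict
    B                            ≡⟨ ℚ.*-identityʳ B ⟨
    B ℚ.* 1ℚ                     ≡⟨ cong (B ℚ.*_) (ℚ.*-inverseˡ ε) ⟨
    B ℚ.* (ℚ.1/ ε ℚ.* ε)         ≡⟨ ℚ.*-assoc B (ℚ.1/ ε) ε ⟨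
    B ℚ.* ℚ.1/ ε ℚ.* ε           ≡⟨ ℚ.*-comm (B ℚ.* ℚ.1/ ε) ε ⟩
    ε ℚ.* (B ℚ.* ℚ.1/ ε)         <⟨ ℚ.*-monoʳ-<-pos ε h ⟩
    ε ℚ.* (+ suc N ℚ./ 1)        ∎)
  where
  instance
    posε = ℚ.positive 0<ε
    nzε = ℚ.pos⇒nonZero ε
  open ℚ.≤-Reasoning
  below : ∀ q → ∃[ N ] q ℚ.< + suc N ℚ./ 1
  below q@(ℚ.mkℚ a d-1 _) = ℤ.∣ a ∣ , ℚ.toℚᵘ-cancel-< ℚᵘ<
    where
    ℚᵘ< : ℚ.toℚᵘ q ℚᵘ.< ℚ.toℚᵘ (+ suc ℤ.∣ a ∣ ℚ./ 1)
    ℚᵘ< = ℚᵘ.<-respʳ-≃ (ℚᵘ.≃-sym (ℚ.toℚᵘ-fromℚᵘ (mkℚᵘ (+ suc ℤ.∣ a ∣) 0)))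
      (ℚᵘ.*<* (ℤ.≤-<-trans (ℤ.≤-reflexive (ℤ.*-identityʳ a))
        (ℤ.≤-<-trans (a≤∣a∣ a) (ℤ.<-≤-trans (ℤ.+<+ (ℕ.n<1+n ℤ.∣ a ∣))
          (ℤ.≤-trans (ℤ.+≤+ (ℕ.m≤m*n (suc ℤ.∣ a ∣) (suc d-1))) (ℤ.≤-reflexive (ℤ.pos-* (suc ℤ.∣ a ∣) (suc d-1))))))))
      where
      a≤∣a∣ : ∀ a → a ℤ.≤ + ℤ.∣ a ∣
      a≤∣a∣ (+ k) = ℤ.≤-refl
      a≤∣a∣ -[1+ k ] = ℤ.-≤+

-- The Dirichlet kernel and its largest root

pℚ : ℕ → ℚ → ℚ
pℚ zero          x = 1ℚ
pℚ (suc zero)    x = x ℚ.+ 1ℚ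
pℚ (suc (suc k)) x = x ℚ.* pℚ (suc k) x ℚ.- pℚ k x

pℝ : ℕ → ℝ → ℝ
pℝ zero          x = 1ℝ
pℝ (suc zero)    x = x +ℝ 1ℝ
pℝ (suc (suc k)) x = x *ℝ pℝ (suc k) x +ℝ (-ℝ pℝ k x)

seq-p : ∀ k x n → seq (pℝ k x) n ≡ pℚ k (seq x n)
seq-p zero          x n = refl
seq-p (suc zero)    x n = refl
seq-p (suc (suc k)) x n = cong₂ ℚ._+_ (cong (seq x n ℚ.*_) (seq-p (suc k) x n))
  (trans (seq-neg (pℝ k x) n) (cong ℚ.-_ (seq-p k x n)))

pℝ-cong : ∀ k {x y} → x ≈ y → pℝ k x ≈ pℝ k y
pℝ-cong zero          h = ≈-refl
pℝ-cong (suc zero)    h = CommutativeRing.+-congʳ ℝ-commutativeRing h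
pℝ-cong (suc (suc k)) h = +ℝ-cong (*ℝ-cong h (pℝ-cong (suc k) h))
  (CommutativeRing.-‿cong ℝ-commutativeRing (pℝ-cong k h))

p≤q⇒0≤q-p : ∀ {p q} → p ℚ.≤ q → 0ℚ ℚ.≤ q ℚ.- p
p≤q⇒0≤q-p {p} {q} h = subst (ℚ._≤ q ℚ.- p) (ℚ.+-inverseʳ p) (ℚ.+-monoˡ-≤ (ℚ.- p) h)

q-p≤∣p-q∣ : ∀ p q → q ℚ.- p ℚ.≤ ∣ p ℚ.- q ∣
q-p≤∣p-q∣ p q = subst (q ℚ.- p ℚ.≤_) (∣p-q∣≡∣q-p∣ q p) (p≤∣p∣ (q ℚ.- p))
  where
  p≤∣p∣ : ∀ p → p ℚ.≤ ∣ p ∣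
  p≤∣p∣ p with ℚ.≤-total 0ℚ p
  ... | inj₁ 0≤p = ℚ.≤-reflexive (sym (ℚ.0≤p⇒∣p∣≡p 0≤p))
  ... | inj₂ p≤0 = ℚ.≤-trans p≤0 (ℚ.0≤∣p∣ p)

∣x-y∣≤b-a : ∀ {a b x y} → a ℚ.≤ x → x ℚ.≤ b → a ℚ.≤ y → y ℚ.≤ b → ∣ x ℚ.- y ∣ ℚ.≤ b ℚ.- a
∣x-y∣≤b-a {a} {b} {x} {y} a≤x x≤b a≤y y≤b with ℚ.∣p∣≡p∨∣p∣≡-p (x ℚ.- y)
... | inj₁ e = ℚ.≤-trans (ℚ.≤-reflexive e) (ℚ.+-mono-≤ x≤b (ℚ.neg-antimono-≤ a≤y))
... | inj₂ e = ℚ.≤-trans (ℚ.≤-reflexive (trans e (flip x y))) (ℚ.+-mono-≤ y≤b (ℚ.neg-antimono-≤ a≤x))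
  where
  open ℚ.+-*-Solver
  flip : ∀ x y → ℚ.- (x ℚ.- y) ≡ y ℚ.- x
  flip = solve 2 (λ x y → :- (x :- y) := y :- x) refl

-- The largest root of p m, found by bisecting [-2, 2] on the decidable
-- predicate "p 0, …, p m are all positive".
module LargestRoot (m-1 : ℕ) where

  m : ℕ
  m = suc m-1

  -- The sign of `p m` alone would not single out the largest root, since `p m` can also be positive
  -- between smaller ones. Positivity of the whole chain does, as in Sturm's theorem, and it also
  -- yields the lower bounds for the earlier `p k`.
  AllPositive : ℚ → Set
  AllPositive q = ∀ {j} → j ℕ.< suc m → 0ℚ ℚ.< pℚ j q

  allPositive? : ∀ q → Dec (AllPositive q)
  allPositive? q = ℕ.allUpTo? (λ j → 0ℚ ℚ.<? pℚ j q) (suc m)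

  -2-bad : ¬ AllPositive (ℚ.- 2ℚ)
  -2-bad h = <⇒≱ (h {1} (ℕ.s≤s (ℕ.s≤s ℕ.z≤n))) (from-yes (pℚ 1 (ℚ.- 2ℚ) ℚ.≤? 0ℚ))

  -- At 2 the kernel takes the values 2k + 1, so the induction carries the constant increment 2.
  2-good : AllPositive 2ℚ
  2-good {j} _ = proj₁ (go j)
    where
    open ℚ.+-*-Solver
    go : ∀ k → 0ℚ ℚ.< pℚ k 2ℚ × pℚ (suc k) 2ℚ ≡ pℚ k 2ℚ ℚ.+ 2ℚ
    go zero    = from-yes (0ℚ ℚ.<? 1ℚ) , refl
    go (suc k) = let (h , e) = go k in
      subst (0ℚ ℚ.<_) (sym e) (ℚ.+-mono-< {0ℚ} {_} {0ℚ} h (from-yes (0ℚ ℚ.<? 2ℚ))) ,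
      trans (cong (λ q → 2ℚ ℚ.* q ℚ.- pℚ k 2ℚ) e)
        (trans (solve 1 (λ x → con 2ℚ :* (x :+ con 2ℚ) :- x := x :+ con 2ℚ :+ con 2ℚ) refl (pℚ k 2ℚ))
          (cong (ℚ._+ 2ℚ) (sym e)))

  record Bracket : Set where
    field
      lo hi : ℚ
      lo-bad  : ¬ AllPositive lo
      hi-good : AllPositive hi
      lo≤hi : lo ℚ.≤ hi

    mid : ℚ
    mid = (lo ℚ.+ hi) ℚ.* ½

    lo≤mid : lo ℚ.≤ mid
    lo≤mid = subst (ℚ._≤ mid) (trans (ℚ.*-distribʳ-+ ½ lo lo) (half+half lo))
      (ℚ.*-monoʳ-≤-nonNeg ½ (ℚ.+-monoʳ-≤ lo lo≤hi))

    mid≤hi : mid ℚ.≤ hi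
    mid≤hi = subst (mid ℚ.≤_) (trans (ℚ.*-distribʳ-+ ½ hi hi) (half+half hi))
      (ℚ.*-monoʳ-≤-nonNeg ½ (ℚ.+-monoˡ-≤ hi lo≤hi))

    width : ℚ
    width = hi ℚ.- lo

  open Bracket

  bisect : Bracket → Bracket
  bisect B with allPositive? (mid B)
  ... | yes good = record { lo = lo B ; hi = mid B ; lo-bad = lo-bad B ; hi-good = good ; lo≤hi = lo≤mid B }
  ... | no bad   = record { lo = mid B ; hi = hi B ; lo-bad = bad ; hi-good = hi-good B ; lo≤hi = mid≤hi B }

  bisect-width : ∀ B → width (bisect B) ≡ width B ℚ.* ½
  bisect-width B with allPositive? (mid B)
  ... | yes _ = solve 2 (λ a b → (a :+ b) :* con ½ :- a := (b :- a) :* con ½) refl (lo B) (hi B)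
    where open ℚ.+-*-Solver
  ... | no _  = solve 2 (λ a b → b :- (a :+ b) :* con ½ := (b :- a) :* con ½) refl (lo B) (hi B)
    where open ℚ.+-*-Solver

  bisect-lo : ∀ B → lo B ℚ.≤ lo (bisect B)
  bisect-lo B with allPositive? (mid B)
  ... | yes _ = ℚ.≤-refl
  ... | no _  = lo≤mid B

  bisect-hi : ∀ B → hi (bisect B) ℚ.≤ hi B
  bisect-hi B with allPositive? (mid B)
  ... | yes _ = mid≤hi B
  ... | no _  = ℚ.≤-refl

  bracket : ℕ → Bracket
  bracket zero    = record
    { lo = ℚ.- 2ℚ ; hi = 2ℚ ; lo-bad = -2-bad ; hi-good = 2-good ; lo≤hi = from-yes (ℚ.- 2ℚ ℚ.≤? 2ℚ) }
  bracket (suc k) = bisect (bracket k)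

  a b w : ℕ → ℚ
  a k = lo (bracket k)
  b k = hi (bracket k)
  w k = width (bracket k)

  a-mono : ∀ {i j} → i ℕ.≤ j → a i ℚ.≤ a j
  a-mono {i} {zero}  ℕ.z≤n = ℚ.≤-refl
  a-mono {i} {suc j} i≤j with ℕ.m≤n⇒m<n∨m≡n i≤j
  ... | inj₁ i<1+j = ℚ.≤-trans (a-mono (ℕ.s≤s⁻¹ i<1+j)) (bisect-lo (bracket j))
  ... | inj₂ refl  = ℚ.≤-refl

  b-anti : ∀ {i j} → i ℕ.≤ j → b j ℚ.≤ b i
  b-anti {i} {zero}  ℕ.z≤n = ℚ.≤-refl
  b-anti {i} {suc j} i≤j with ℕ.m≤n⇒m<n∨m≡n i≤j
  ... | inj₁ i<1+j = ℚ.≤-trans (bisect-hi (bracket j)) (b-anti (ℕ.s≤s⁻¹ i<1+j))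
  ... | inj₂ refl  = ℚ.≤-refl

  w-bound : ∀ k → w k ℚ.* (+ suc k ℚ./ 1) ℚ.≤ w 0
  w-bound zero    = ℚ.≤-reflexive (ℚ.*-identityʳ (w 0))
  w-bound (suc k) = ℚ.≤-trans
    (ℚ.≤-reflexive (cong (ℚ._* (+ (2 ℕ.+ k) ℚ./ 1)) (bisect-width (bracket k))))
    (ℚ.≤-trans (halving-bound (w k) k (p≤q⇒0≤q-p (lo≤hi (bracket k)))) (w-bound k))

  w-small : ∀ ε → 0ℚ ℚ.< ε → ∃[ N ] w N ℚ.< ε
  w-small ε 0<ε = let (N , h) = archimedean (w 0) ε 0<ε in
    N , ℚ.*-cancelʳ-<-nonNeg (+ suc N ℚ./ 1) {{ℚ.nonNegative (0≤ℕ/1 (suc N))}} (ℚ.≤-<-trans (w-bound N) h)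

  within : ∀ (x y : ℕ → ℚ) → (∀ k → a k ℚ.≤ x k × x k ℚ.≤ b k) → (∀ k → a k ℚ.≤ y k × y k ℚ.≤ b k) →
    ∀ ε → 0ℚ ℚ.< ε → ∃[ N ] ∀ i j → N ℕ.≤ i → N ℕ.≤ j → ∣ x i ℚ.- y j ∣ ℚ.< ε
  within x y hx hy ε 0<ε = let (N , wN) = w-small ε 0<ε in N , λ i j N≤i N≤j →
    ℚ.≤-<-trans (∣x-y∣≤b-a
      (ℚ.≤-trans (a-mono N≤i) (proj₁ (hx i))) (ℚ.≤-trans (proj₂ (hx i)) (b-anti N≤i))
      (ℚ.≤-trans (a-mono N≤j) (proj₁ (hy j))) (ℚ.≤-trans (proj₂ (hy j)) (b-anti N≤j))) wN

  a∈ : ∀ k → a k ℚ.≤ a k × a k ℚ.≤ b k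
  a∈ k = ℚ.≤-refl , lo≤hi (bracket k)

  b∈ : ∀ k → a k ℚ.≤ b k × b k ℚ.≤ b k
  b∈ k = lo≤hi (bracket k) , ℚ.≤-refl

  -- The root is represented by the upper ends, which satisfy `AllPositive` at every index. The
  -- equal real `a∞` transports the information carried by the bad lower ends.
  a∞ c : ℝ
  a∞ = mkℝ a (within a a a∈ a∈)
  c  = mkℝ b (within b b b∈ b∈)

  a∞≈c : a∞ ≈ c
  a∞≈c = mk≈ λ ε 0<ε → let (N , h) = within a b a∈ b∈ ε 0<ε in N , λ n N≤n → h n n N≤n N≤n

  ½^ : ℕ → ℚ
  ½^ zero    = 1ℚ
  ½^ (suc k) = ½^ k ℚ.* ½

  0<½^ : ∀ k → 0ℚ ℚ.< ½^ k
  0<½^ zero    = from-yes (0ℚ ℚ.<? 1ℚ)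
  0<½^ (suc k) = half-pos (0<½^ k)

  -- p k < x p (k+1) ≤ 2 p (k+1) as long as p (k+2) > 0.
  p-lower : ∀ n k → k ℕ.< m → ½^ k ℚ.≤ pℚ k (b n)
  p-lower n zero    _     = ℚ.≤-refl
  p-lower n (suc k) k+1<m = ℚ.≤-trans
    (ℚ.*-monoʳ-≤-nonNeg ½ (p-lower n k (ℕ.<-trans (ℕ.n<1+n k) k+1<m)))
    (begin
      pₖ ℚ.* ½                        ≡⟨ cong (ℚ._* ½) (ℚ.+-identityˡ pₖ) ⟨
      (0ℚ ℚ.+ pₖ) ℚ.* ½               ≤⟨ ℚ.*-monoʳ-≤-nonNeg ½ (ℚ.+-monoˡ-≤ pₖ (ℚ.<⇒≤ (hi-good (bracket n) {2 ℕ.+ k} (ℕ.s≤s k+1<m)))) ⟩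
      (b n ℚ.* q ℚ.- pₖ ℚ.+ pₖ) ℚ.* ½ ≡⟨ cong (ℚ._* ½) (cancel (b n ℚ.* q) pₖ) ⟩
      b n ℚ.* q ℚ.* ½                 ≤⟨ ℚ.*-monoʳ-≤-nonNeg ½ (ℚ.*-monoʳ-≤-nonNeg q {{ℚ.nonNegative 0≤q}} (b-anti {0} {n} ℕ.z≤n)) ⟩
      2ℚ ℚ.* q ℚ.* ½                  ≡⟨ solve 1 (λ q → con 2ℚ :* q :* con ½ := q) refl q ⟩
      q                               ∎)
    where
    pₖ = pℚ k (b n)
    q = pℚ (suc k) (b n)
    0≤q : 0ℚ ℚ.≤ q
    0≤q = ℚ.<⇒≤ (hi-good (bracket n) {suc k} (ℕ.s≤s (ℕ.<⇒≤ k+1<m)))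
    open ℚ.≤-Reasoning
    open ℚ.+-*-Solver
    cancel : ∀ x y → x ℚ.- y ℚ.+ y ≡ x
    cancel = solve 2 (λ x y → x :- y :+ y := x) refl

  p-c≉0 : ∀ k → k ℕ.< m → BoundedAway (pℝ k c)
  p-c≉0 k k<m = ½^ k , 0<½^ k , 0 , λ n _ →
    let h = p-lower n k k<m in
    subst (λ q → ½^ k ℚ.≤ ∣ q ∣) (sym (seq-p k c n))
      (subst (½^ k ℚ.≤_) (sym (ℚ.0≤p⇒∣p∣≡p (ℚ.≤-trans (ℚ.<⇒≤ (0<½^ k)) h))) h)

  p-c+2≉0 : BoundedAway (pℝ m-1 c +ℝ fromℕ 2)
  p-c+2≉0 = 2ℚ , from-yes (0ℚ ℚ.<? 2ℚ) , 0 , λ n _ →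
    let q = pℚ m-1 (b n)
        0≤q = ℚ.<⇒≤ (hi-good (bracket n) {m-1} (ℕ.s≤s (ℕ.n≤1+n m-1)))
        2≤q+2 = subst (ℚ._≤ q ℚ.+ 2ℚ) (ℚ.+-identityˡ 2ℚ) (ℚ.+-monoˡ-≤ 2ℚ 0≤q)
    in subst (λ r → 2ℚ ℚ.≤ ∣ r ℚ.+ 2ℚ ∣) (sym (seq-p m-1 c n))
         (subst (2ℚ ℚ.≤_) (sym (ℚ.0≤p⇒∣p∣≡p (ℚ.≤-trans (from-yes (0ℚ ℚ.≤? 2ℚ)) 2≤q+2))) 2≤q+2)

  p-a-close : ∀ k ε → 0ℚ ℚ.< ε → ∃[ N ] ∀ n → N ℕ.≤ n → ∣ pℚ k (a n) ℚ.- pℚ k (b n) ∣ ℚ.< ε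
  p-a-close k ε 0<ε = let (N , h) = close (pℝ-cong k a∞≈c) ε 0<ε in N , λ n N≤n →
    subst₂ (λ x y → ∣ x ℚ.- y ∣ ℚ.< ε) (seq-p k a∞ n) (seq-p k c n) (h n N≤n)

  -- At the upper end `p k` stays above a fixed power of ½, while its values at the two ends
  -- approach each other. The badness of a late lower end can then only be due to `p m`.
  p-a-positive : ∀ k → k ℕ.≤ m → ∃[ N ] ∀ n → N ℕ.≤ n → ∀ {j} → j ℕ.< k → 0ℚ ℚ.< pℚ j (a n)
  p-a-positive zero    _   = 0 , λ _ _ ()
  p-a-positive (suc k) k<m =
    let (N , h) = p-a-positive k (ℕ.<⇒≤ k<m)
        (M , h′) = p-a-close k (½^ k) (0<½^ k)
    in N ℕ.⊔ M , λ n le j<1+k → extend n (h n (ℕ.m⊔n≤o⇒m≤o N M le)) (h′ n (ℕ.m⊔n≤o⇒n≤o N M le))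
                                  (ℕ.m≤n⇒m<n∨m≡n (ℕ.s≤s⁻¹ j<1+k))
    where
    extend : ∀ n {j} → (∀ {j} → j ℕ.< k → 0ℚ ℚ.< pℚ j (a n)) → ∣ pℚ k (a n) ℚ.- pℚ k (b n) ∣ ℚ.< ½^ k →
      j ℕ.< k ⊎ j ≡ k → 0ℚ ℚ.< pℚ j (a n)
    extend n h _ (inj₁ j<k) = h j<k
    extend n _ h (inj₂ refl) = ℚ.≰⇒> λ pa≤0 → <⇒≱ h (begin
      ½^ k                                ≤⟨ p-lower n k k<m ⟩
      pℚ k (b n)                          ≡⟨ ℚ.+-identityʳ (pℚ k (b n)) ⟨
      pℚ k (b n) ℚ.- 0ℚ                   ≤⟨ ℚ.+-monoʳ-≤ (pℚ k (b n)) (ℚ.neg-antimono-≤ pa≤0) ⟩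
      pℚ k (b n) ℚ.- pℚ k (a n)           ≤⟨ q-p≤∣p-q∣ (pℚ k (a n)) (pℚ k (b n)) ⟩
      ∣ pℚ k (a n) ℚ.- pℚ k (b n) ∣       ∎)
      where open ℚ.≤-Reasoning

  -- At late lower ends `p m` is at most 0, at upper ends it is positive, and the gap between the
  -- two values tends to 0.
  p-c≈0 : pℝ m c ≈ 0ℝ
  p-c≈0 = mk≈ λ ε 0<ε →
    let (N , h) = p-a-positive m ℕ.≤-refl
        (M , h′) = p-a-close m ε 0<ε
    in N ℕ.⊔ M , λ n le →
      let pa≤0 : pℚ m (a n) ℚ.≤ 0ℚ
          pa≤0 = ℚ.≮⇒≥ λ 0<pa → lo-bad (bracket n) λ {j} j<1+m →
            last n (h n (ℕ.m⊔n≤o⇒m≤o N M le)) 0<pa (ℕ.m≤n⇒m<n∨m≡n (ℕ.s≤s⁻¹ j<1+m))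
      in subst (λ q → ∣ q ∣ ℚ.< ε) (sym (trans (p-0≡p _) (seq-p m c n)))
           (ℚ.≤-<-trans (bound n pa≤0) (h′ n (ℕ.m⊔n≤o⇒n≤o N M le)))
    where
    last : ∀ n {j} → (∀ {j} → j ℕ.< m → 0ℚ ℚ.< pℚ j (a n)) → 0ℚ ℚ.< pℚ m (a n) → j ℕ.< m ⊎ j ≡ m → 0ℚ ℚ.< pℚ j (a n)
    last n h _ (inj₁ j<m)  = h j<m
    last n _ h (inj₂ refl) = h
    open ℚ.≤-Reasoning
    bound : ∀ n → pℚ m (a n) ℚ.≤ 0ℚ → ∣ pℚ m (b n) ∣ ℚ.≤ ∣ pℚ m (a n) ℚ.- pℚ m (b n) ∣
    bound n pa≤0 = begin
      ∣ pℚ m (b n) ∣                      ≡⟨ ℚ.0≤p⇒∣p∣≡p (ℚ.<⇒≤ (hi-good (bracket n) {m} (ℕ.n<1+n m))) ⟩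
      pℚ m (b n)                          ≡⟨ ℚ.+-identityʳ (pℚ m (b n)) ⟨
      pℚ m (b n) ℚ.- 0ℚ                   ≤⟨ ℚ.+-monoʳ-≤ (pℚ m (b n)) (ℚ.neg-antimono-≤ pa≤0) ⟩
      pℚ m (b n) ℚ.- pℚ m (a n)           ≤⟨ q-p≤∣p-q∣ (pℚ m (a n)) (pℚ m (b n)) ⟩
      ∣ pℚ m (a n) ℚ.- pℚ m (b n) ∣       ∎

-- Walks and vertex counts in a graph

module GraphProperties (G : Graph) where

  open Graph G

  infixr 5 _++ʷ_

  _++ʷ_ : ∀ {u v w k l} → Walk u v k → Walk v w l → Walk u w (k ℕ.+ l)
  []      ++ʷ q = q
  (e ∷ p) ++ʷ q = e ∷ (p ++ʷ q)

  vertices-unique : Unique vertices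
  vertices-unique = Unique.map⁺ (λ {i} {j} e → trans (sym (Inverse.strictlyInverseʳ enum i))
    (trans (cong (Inverse.from enum) e) (Inverse.strictlyInverseʳ enum j))) (Unique.allFin⁺ order)

  ∈-vertices : ∀ v → v ∈ vertices
  ∈-vertices v = subst (_∈ vertices) (Inverse.strictlyInverseˡ enum v)
    (∈-map⁺ vertex (∈-allFin (Inverse.from enum v)))

  count≤1 : ∀ {P : Pred V 0ℓ} (P? : Decidable P) → (∀ u v → P u → P v → u ≡ v) → count P? ℕ.≤ 1
  count≤1 {P} P? uniq = go (filter P? vertices) (Unique.filter⁺ P? vertices-unique)
    (λ v∈ → proj₂ (∈-filter⁻ P? {xs = vertices} v∈))
    where
    go : ∀ xs → Unique xs → (∀ {v} → v ∈ xs → P v) → length xs ℕ.≤ 1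
    go []           _ _ = ℕ.z≤n
    go (x ∷ [])     _ _ = ℕ.s≤s ℕ.z≤n
    go (x ∷ y ∷ xs) ((x≢y ∷ _) ∷ _) h =
      contradiction (uniq x y (h (here refl)) (h (there (here refl)))) x≢y

  2≤count : ∀ {P : Pred V 0ℓ} (P? : Decidable P) {u v} → P u → P v → u ≢ v → 2 ℕ.≤ count P?
  2≤count P? {u} {v} pu pv u≢v =
    go (filter P? vertices) (∈-filter⁺ P? (∈-vertices u) pu) (∈-filter⁺ P? (∈-vertices v) pv)
    where
    go : ∀ xs → u ∈ xs → v ∈ xs → 2 ℕ.≤ length xs
    go (x ∷ [])     (here refl) (here refl) = contradiction refl u≢v
    go (x ∷ y ∷ xs) _ _ = ℕ.s≤s (ℕ.s≤s ℕ.z≤n)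

-- Walks in the product of two odd cycles as displacements on a torus

module TorusGraph (m : ℕ) (2≤m : 2 ℕ.≤ m) (5≤n : 5 ℕ.≤ suc (m ℕ.+ m)) where

  open Cyclic m
  open Graph (C⊗C n 5≤n)
  open GraphProperties (C⊗C n 5≤n)
  open ℤ.+-*-Solver

  data IsUnit : ℤ → Set where
    unit⁺ : IsUnit (+ 1)
    unit⁻ : IsUnit -[1+ 0 ]

  Next⇒≋ : ∀ {i j : Fin n} → Next i j → ι j ≋ ι i ℤ.+ + 1
  Next⇒≋ {i} (inj₁ e) = ≋-reflexive (trans (cong +_ (sym e)) (ℤ.+-comm (+ 1) (ι i)))
  Next⇒≋ {i} (inj₂ (e , z)) = ≋-trans (≋-reflexive (cong +_ z)) (≋-sym
    (≋-trans (≋-reflexive (trans (ℤ.+-comm (ι i) (+ 1)) (cong +_ e))) (+n≋ (+ 0))))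

  ≋⇒Next : ∀ {i j : Fin n} → ι j ≋ ι i ℤ.+ + 1 → Next i j
  ≋⇒Next {i} {j} h with suc (toℕ i) ℕ.≟ n
  ... | yes e = inj₂ (e , sym (ℤ.+-injective (≋-small {+ 0} {ι j}
          (≋-trans (≋-sym (+n≋ (+ 0))) (≋-trans (≋-reflexive (trans (cong +_ (sym e)) (ℤ.+-comm (+ 1) (ι i)))) (≋-sym h)))
          (∣a-b∣<n 0 (toℕ j) (ℕ.s≤s ℕ.z≤n) (Fin.toℕ<n j)))))
  ... | no ¬e = inj₁ (ℤ.+-injective (≋-small (≋-trans (≋-reflexive (ℤ.+-comm (+ 1) (ι i))) (≋-sym h))
          (∣a-b∣<n (suc (toℕ i)) (toℕ j) (ℕ.≤∧≢⇒< (Fin.toℕ<n i) ¬e) (Fin.toℕ<n j))))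

  Adjacent : Fin n → Fin n → Set
  Adjacent i j = Next i j ⊎ Next j i

  ≋⇒adjacent : ∀ {i j s} → IsUnit s → ι j ≋ ι i ℤ.+ s → Adjacent i j
  ≋⇒adjacent unit⁺ h = inj₁ (≋⇒Next h)
  ≋⇒adjacent {i} {j} unit⁻ h = inj₂ (≋⇒Next (≋-trans (≋-reflexive (e (ι i))) (≋-+ (≋-sym h) (≋-refl {+ 1}))))
    where
    e : ∀ i → i ≡ i ℤ.+ -[1+ 0 ] ℤ.+ + 1
    e = solve 1 (λ i → i := i :+ con -[1+ 0 ] :+ con (+ 1)) refl

  adjacent⇒≋ : ∀ {i j} → Adjacent i j → ∃[ s ] IsUnit s × ι j ≋ ι i ℤ.+ s
  adjacent⇒≋ (inj₁ h) = + 1 , unit⁺ , Next⇒≋ h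
  adjacent⇒≋ {i} {j} (inj₂ h) = -[1+ 0 ] , unit⁻ ,
    ≋-trans (≋-reflexive (e (ι j))) (≋-+ (≋-sym (Next⇒≋ h)) (≋-refl { -[1+ 0 ]}))
    where
    e : ∀ j → j ≡ j ℤ.+ + 1 ℤ.+ -[1+ 0 ]
    e = solve 1 (λ j → j := j :+ con (+ 1) :+ con -[1+ 0 ]) refl

  line : ∀ {s s′} → IsUnit s → IsUnit s′ → ∀ k {x y x′ y′} →
    ι x′ ≋ ι x ℤ.+ + k ℤ.* s → ι y′ ≋ ι y ℤ.+ + k ℤ.* s′ → Walk (x , y) (x′ , y′) k
  line {s} {s′} u u′ zero {x} {y} hx hy with ι-injective (≋-trans hx (≋-reflexive (ℤ.+-identityʳ (ι x))))
                                      | ι-injective (≋-trans hy (≋-reflexive (ℤ.+-identityʳ (ι y))))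
  ... | refl | refl = []
  line {s} {s′} u u′ (suc k) {x} {y} hx hy =
    (≋⇒adjacent u ι[ ι x ℤ.+ s ] , ≋⇒adjacent u′ ι[ ι y ℤ.+ s′ ]) ∷ line u u′ k (rest hx) (rest hy)
    where
    e : ∀ x k s → x ℤ.+ (+ 1 ℤ.+ k) ℤ.* s ≡ x ℤ.+ s ℤ.+ k ℤ.* s
    e = solve 3 (λ x k s → x :+ (con (+ 1) :+ k) :* s := x :+ s :+ k :* s) refl
    rest : ∀ {x x′ s} → ι x′ ≋ ι x ℤ.+ + suc k ℤ.* s → ι x′ ≋ ι [ ι x ℤ.+ s ] ℤ.+ + k ℤ.* s
    rest {x} {x′} {s} h = ≋-trans h (≋-trans (≋-reflexive (e (ι x) (+ k) s)) (≋-+ (≋-sym ι[ ι x ℤ.+ s ]) ≋-refl))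

  -- Displacements on the torus C n □ C n: a steps along (1 , 1) and b steps along (1 , -1).
  Displacement : V → V → ℤ → ℤ → Set
  Displacement (x , y) (x′ , y′) a b = ι x′ ≋ ι x ℤ.+ (a ℤ.+ b) × ι y′ ≋ ι y ℤ.+ (a ℤ.- b)

  polar : ∀ a → ∃[ s ] IsUnit s × IsUnit (ℤ.- s) × a ≡ + ℤ.∣ a ∣ ℤ.* s
  polar (+ k)    = + 1 , unit⁺ , unit⁻ , sym (ℤ.*-identityʳ (+ k))
  polar -[1+ k ] = -[1+ 0 ] , unit⁻ , unit⁺ , cong -[1+_] (sym (ℕ.*-identityʳ k))

  displacement⇒walk : ∀ P Q a b → Displacement P Q a b → Walk P Q (ℤ.∣ a ∣ ℕ.+ ℤ.∣ b ∣)
  displacement⇒walk (x , y) (x′ , y′) a b (hx , hy) with polar a | polar b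
  ... | s , u , _ , a≡ | r , v , v⁻ , b≡ = _++ʷ_ {v = x₁ , y₁}
      (line u u ℤ.∣ a ∣ (first x) (first y))
      (line v v⁻ ℤ.∣ b ∣
        (≋-trans hx (≋-trans (≋-reflexive (sym (ℤ.+-assoc (ι x) a b))) (≋-+ (≋-sym ι[ ι x ℤ.+ a ]) (≋-reflexive b≡))))
        (≋-trans hy (≋-trans (≋-reflexive (sym (ℤ.+-assoc (ι y) a (ℤ.- b)))) (≋-+ (≋-sym ι[ ι y ℤ.+ a ])
          (≋-reflexive (trans (cong ℤ.-_ b≡) (ℤ.neg-distribʳ-* (+ ℤ.∣ b ∣) r)))))))
    where
    x₁ = [ ι x ℤ.+ a ]
    y₁ = [ ι y ℤ.+ a ]
    first : ∀ x → ι [ ι x ℤ.+ a ] ≋ ι x ℤ.+ + ℤ.∣ a ∣ ℤ.* s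
    first x = ≋-trans ι[ ι x ℤ.+ a ] (≋-reflexive (cong (λ z → ι x ℤ.+ z) a≡))

  ∣a+unit∣≤ : ∀ a {s} → IsUnit s → ℤ.∣ a ℤ.+ s ∣ ℕ.≤ suc ℤ.∣ a ∣
  ∣a+unit∣≤ a {s} u = ℕ.≤-trans (ℤ.∣i+j∣≤∣i∣+∣j∣ a s) (ℕ.≤-reflexive (trans (cong (ℤ.∣ a ∣ ℕ.+_) (∣unit∣ u)) (ℕ.+-comm ℤ.∣ a ∣ 1)))
    where
    ∣unit∣ : ∀ {s} → IsUnit s → ℤ.∣ s ∣ ≡ 1
    ∣unit∣ unit⁺ = refl
    ∣unit∣ unit⁻ = refl

  units : ∀ {s s′} → IsUnit s → IsUnit s′ → s′ ≡ s ⊎ s′ ≡ ℤ.- s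
  units unit⁺ unit⁺ = inj₁ refl
  units unit⁺ unit⁻ = inj₂ refl
  units unit⁻ unit⁺ = inj₂ refl
  units unit⁻ unit⁻ = inj₁ refl

  -- An edge moves both coordinates by a unit. Equal units are a step in `a` and opposite units a
  -- step in `b`, so each edge raises the total by at most one.
  walk⇒displacement : ∀ {P Q k} → Walk P Q k → ∃[ a ] ∃[ b ] Displacement P Q a b × ℤ.∣ a ∣ ℕ.+ ℤ.∣ b ∣ ℕ.≤ k
  walk⇒displacement {x , y} [] = + 0 , + 0 ,
    (≋-reflexive (sym (ℤ.+-identityʳ (ι x))) , ≋-reflexive (sym (ℤ.+-identityʳ (ι y)))) , ℕ.z≤n
  walk⇒displacement {x , y} {x′ , y′} ((ex , ey) ∷ p)
    with walk⇒displacement p | adjacent⇒≋ ex | adjacent⇒≋ ey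
  ... | a , b , (hx , hy) , le | s , u , hx₁ | s′ , u′ , hy₁ with units u u′
  ... | inj₁ refl = a ℤ.+ s , b ,
          (≋-trans hx (≋-trans (≋-+ hx₁ (≋-refl {a ℤ.+ b})) (≋-reflexive (e₁ (ι x) s a b))) ,
           ≋-trans hy (≋-trans (≋-+ hy₁ (≋-refl {a ℤ.- b})) (≋-reflexive (e₂ (ι y) s a b)))) ,
          ℕ.≤-trans (ℕ.+-monoˡ-≤ ℤ.∣ b ∣ (∣a+unit∣≤ a u)) (ℕ.s≤s le)
    where
    e₁ : ∀ x s a b → x ℤ.+ s ℤ.+ (a ℤ.+ b) ≡ x ℤ.+ (a ℤ.+ s ℤ.+ b)
    e₁ = solve 4 (λ x s a b → x :+ s :+ (a :+ b) := x :+ (a :+ s :+ b)) refl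
    e₂ : ∀ x s a b → x ℤ.+ s ℤ.+ (a ℤ.- b) ≡ x ℤ.+ (a ℤ.+ s ℤ.- b)
    e₂ = solve 4 (λ x s a b → x :+ s :+ (a :- b) := x :+ (a :+ s :- b)) refl
  ... | inj₂ refl = a , b ℤ.+ s ,
          (≋-trans hx (≋-trans (≋-+ hx₁ (≋-refl {a ℤ.+ b})) (≋-reflexive (e₁ (ι x) s a b))) ,
           ≋-trans hy (≋-trans (≋-+ hy₁ (≋-refl {a ℤ.- b})) (≋-reflexive (e₂ (ι y) s a b)))) ,
          ℕ.≤-trans (ℕ.+-monoʳ-≤ ℤ.∣ a ∣ (∣a+unit∣≤ b u)) (ℕ.≤-trans (ℕ.≤-reflexive (ℕ.+-suc ℤ.∣ a ∣ ℤ.∣ b ∣)) (ℕ.s≤s le))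
    where
    e₁ : ∀ x s a b → x ℤ.+ s ℤ.+ (a ℤ.+ b) ≡ x ℤ.+ (a ℤ.+ (b ℤ.+ s))
    e₁ = solve 4 (λ x s a b → x :+ s :+ (a :+ b) := x :+ (a :+ (b :+ s))) refl
    e₂ : ∀ x s a b → x ℤ.- s ℤ.+ (a ℤ.- b) ≡ x ℤ.+ (a ℤ.- (b ℤ.+ s))
    e₂ = solve 4 (λ x s a b → x :- s :+ (a :- b) := x :+ (a :- (b :+ s))) refl

  ≋-cancelˡ : ∀ c {a b} → c ℤ.+ a ≋ c ℤ.+ b → a ≋ b
  ≋-cancelˡ c {a} {b} h = ≋-trans (≋-reflexive (e c a)) (≋-trans (≋-+ (≋-refl {ℤ.- c}) h) (≋-reflexive (sym (e c b))))
    where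
    e : ∀ c a → a ≡ ℤ.- c ℤ.+ (c ℤ.+ a)
    e = solve 2 (λ c a → a := :- c :+ (c :+ a)) refl

  -- The endpoints fix `a + b` and `a - b`, hence 2a and 2b; oddness of `n` allows division by 2.
  displacement-unique : ∀ P Q a b a′ b′ → Displacement P Q a b → Displacement P Q a′ b′ → a ≋ a′ × b ≋ b′
  displacement-unique (x , y) Q a b a′ b′ (hx , hy) (hx′ , hy′) =
    double-injective (≋-trans (≋-reflexive (e₁ a b)) (≋-trans (≋-+ h₊ h₋) (≋-reflexive (sym (e₁ a′ b′))))) ,
    double-injective (≋-trans (≋-reflexive (e₂ a b)) (≋-trans (≋-- h₊ h₋) (≋-reflexive (sym (e₂ a′ b′)))))
    where
    h₊ : a ℤ.+ b ≋ a′ ℤ.+ b′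
    h₊ = ≋-cancelˡ (ι x) (≋-trans (≋-sym hx) hx′)
    h₋ : a ℤ.- b ≋ a′ ℤ.- b′
    h₋ = ≋-cancelˡ (ι y) (≋-trans (≋-sym hy) hy′)
    e₁ : ∀ a b → a ℤ.+ a ≡ (a ℤ.+ b) ℤ.+ (a ℤ.- b)
    e₁ = solve 2 (λ a b → a :+ a := (a :+ b) :+ (a :- b)) refl
    e₂ : ∀ a b → b ℤ.+ b ≡ (a ℤ.+ b) ℤ.- (a ℤ.- b)
    e₂ = solve 2 (λ a b → b :+ b := (a :+ b) :- (a :- b)) refl

  -- Torus coordinates and the distance formula

  U W : V → ℤ
  U (x , y) = half (ι x ℤ.+ ι y)
  W (x , y) = half (ι x ℤ.- ι y)

  U+W≋ : ∀ x y → U (x , y) ℤ.+ W (x , y) ≋ ι x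
  U+W≋ x y = ≋-trans (≋-reflexive (e (+ suc m) (ι x) (ι y))) (half-double (ι x))
    where
    e : ∀ h x y → h ℤ.* (x ℤ.+ y) ℤ.+ h ℤ.* (x ℤ.- y) ≡ h ℤ.* (x ℤ.+ x)
    e = solve 3 (λ h x y → h :* (x :+ y) :+ h :* (x :- y) := h :* (x :+ x)) refl

  U-W≋ : ∀ x y → U (x , y) ℤ.- W (x , y) ≋ ι y
  U-W≋ x y = ≋-trans (≋-reflexive (e (+ suc m) (ι x) (ι y))) (half-double (ι y))
    where
    e : ∀ h x y → h ℤ.* (x ℤ.+ y) ℤ.- h ℤ.* (x ℤ.- y) ≡ h ℤ.* (y ℤ.+ y)
    e = solve 3 (λ h x y → h :* (x :+ y) :- h :* (x :- y) := h :* (y :+ y)) refl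

  coordinates : V ↔ (Fin n × Fin n)
  coordinates = mk↔ₛ′
    (λ P → [ U P ] , [ W P ])
    (λ (u , w) → [ ι u ℤ.+ ι w ] , [ ι u ℤ.- ι w ])
    (λ (u , w) → cong₂ _,_
      (residue (≋-trans (≋-* (+ suc m) (≋-+ ι[ ι u ℤ.+ ι w ] ι[ ι u ℤ.- ι w ]))
        (≋-trans (≋-reflexive (cong half (e₁ (ι u) (ι w)))) (half-double (ι u)))))
      (residue (≋-trans (≋-* (+ suc m) (≋-- ι[ ι u ℤ.+ ι w ] ι[ ι u ℤ.- ι w ]))
        (≋-trans (≋-reflexive (cong half (e₂ (ι u) (ι w)))) (half-double (ι w))))))
    (λ (x , y) → cong₂ _,_
      (residue (≋-trans (≋-+ ι[ U (x , y) ] ι[ W (x , y) ]) (U+W≋ x y)))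
      (residue (≋-trans (≋-- ι[ U (x , y) ] ι[ W (x , y) ]) (U-W≋ x y))))
    where
    residue : ∀ {z i} → z ≋ ι i → [ z ] ≡ i
    residue {z} h = ι-injective (≋-trans ι[ z ] h)
    e₁ : ∀ u w → (u ℤ.+ w) ℤ.+ (u ℤ.- w) ≡ u ℤ.+ u
    e₁ = solve 2 (λ u w → (u :+ w) :+ (u :- w) := u :+ u) refl
    e₂ : ∀ u w → (u ℤ.+ w) ℤ.- (u ℤ.- w) ≡ w ℤ.+ w
    e₂ = solve 2 (λ u w → (u :+ w) :- (u :- w) := w :+ w) refl

  coordinates⇒displacement : ∀ P Q {a b} → a ≋ U Q ℤ.- U P → b ≋ W Q ℤ.- W P → Displacement P Q a b
  coordinates⇒displacement (x , y) (x′ , y′) {a} {b} ha hb =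
    ≋-trans (≋-sym (U+W≋ x′ y′)) (≋-trans (≋-reflexive (e₁ u u′ w w′)) (≋-+ (U+W≋ x y) (≋-sym (≋-+ ha hb)))) ,
    ≋-trans (≋-sym (U-W≋ x′ y′)) (≋-trans (≋-reflexive (e₂ u u′ w w′)) (≋-+ (U-W≋ x y) (≋-sym (≋-- ha hb))))
    where
    u = U (x , y)
    u′ = U (x′ , y′)
    w = W (x , y)
    w′ = W (x′ , y′)
    e₁ : ∀ u u′ w w′ → u′ ℤ.+ w′ ≡ u ℤ.+ w ℤ.+ ((u′ ℤ.- u) ℤ.+ (w′ ℤ.- w))
    e₁ = solve 4 (λ u u′ w w′ → u′ :+ w′ := u :+ w :+ ((u′ :- u) :+ (w′ :- w))) refl
    e₂ : ∀ u u′ w w′ → u′ ℤ.- w′ ≡ u ℤ.- w ℤ.+ ((u′ ℤ.- u) ℤ.- (w′ ℤ.- w))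
    e₂ = solve 4 (λ u u′ w w′ → u′ :- w′ := u :- w :+ ((u′ :- u) :- (w′ :- w))) refl

  -- Negating outside `centre` keeps the argument `U P - U Q` in which `dist-coordinates` expresses
  -- the distance.
  ΔU ΔW : V → V → ℤ
  ΔU P Q = ℤ.- centre (U P ℤ.- U Q)
  ΔW P Q = ℤ.- centre (W P ℤ.- W Q)

  centred : ∀ P Q → Displacement P Q (ΔU P Q) (ΔW P Q)
  centred P Q = coordinates⇒displacement P Q (flip (U P) (U Q)) (flip (W P) (W Q))
    where
    flip : ∀ a b → ℤ.- centre (a ℤ.- b) ≋ b ℤ.- a
    flip a b = ≋-trans (≋-neg (centre≋ (a ℤ.- b))) (≋-reflexive (e a b))
      where
      e : ∀ a b → ℤ.- (a ℤ.- b) ≡ b ℤ.- a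
      e = solve 2 (λ a b → :- (a :- b) := b :- a) refl

  -- Abstract because comparing distances would otherwise unfold the search for
  -- a shortest walk.
  abstract
    connected : Connected
    connected P Q = _ , displacement⇒walk P Q (ΔU P Q) (ΔW P Q) (centred P Q)

  open Metric (C⊗C n 5≤n) connected using (dist)

  dist-walk : ∀ P Q → Walk P Q (dist P Q)
  dist-walk P Q = proj₁ (proj₂ (least (walk? P Q) (connected P Q)))

  dist-≤ : ∀ {P Q k} → Walk P Q k → dist P Q ℕ.≤ k
  dist-≤ {P} {Q} p = proj₂ (proj₂ (least (walk? P Q) (connected P Q))) _ p

  -- A shortest walk has some displacement congruent to (a , b) in each component, and `a`, `b`,
  -- being centred, have least absolute value in their classes.
  dist≡ : ∀ P Q a b → Displacement P Q a b → ℤ.∣ a ∣ ℕ.≤ m → ℤ.∣ b ∣ ℕ.≤ m → dist P Q ≡ ℤ.∣ a ∣ ℕ.+ ℤ.∣ b ∣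
  dist≡ P Q a b h a≤m b≤m = ℕ.≤-antisym (dist-≤ (displacement⇒walk P Q a b h)) (shortest (walk⇒displacement (dist-walk P Q)))
    where
    small : ∀ a a′ → ℤ.∣ a ∣ ℕ.≤ m → a ≋ a′ → ℤ.∣ a ∣ ℕ.≤ ℤ.∣ a′ ∣
    small a a′ a≤m e = subst (ℕ._≤ ℤ.∣ a′ ∣) (trans (δ-cong (≋-sym e)) (δ-small a a≤m)) δ≤∣ a′ ∣
    shortest : (∃[ a′ ] ∃[ b′ ] Displacement P Q a′ b′ × ℤ.∣ a′ ∣ ℕ.+ ℤ.∣ b′ ∣ ℕ.≤ dist P Q) →
      ℤ.∣ a ∣ ℕ.+ ℤ.∣ b ∣ ℕ.≤ dist P Q
    shortest (a′ , b′ , h′ , le) = let (ea , eb) = displacement-unique P Q a b a′ b′ h h′ in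
      ℕ.≤-trans (ℕ.+-mono-≤ (small a a′ a≤m ea) (small b b′ b≤m eb)) le

  dist-coordinates : ∀ P Q → Metric.dist (C⊗C n 5≤n) connected P Q ≡ δ (U P ℤ.- U Q) ℕ.+ δ (W P ℤ.- W Q)
  dist-coordinates P Q = trans
    (dist≡ P Q (ΔU P Q) (ΔW P Q) (centred P Q) (bound (U P ℤ.- U Q)) (bound (W P ℤ.- W Q)))
    (cong₂ ℕ._+_ (ℤ.∣-i∣≡∣i∣ (centre (U P ℤ.- U Q))) (ℤ.∣-i∣≡∣i∣ (centre (W P ℤ.- W Q))))
    where
    bound : ∀ z → ℤ.∣ ℤ.- centre z ∣ ℕ.≤ m
    bound z = subst (ℕ._≤ m) (sym (ℤ.∣-i∣≡∣i∣ (centre z))) (∣centre∣≤m z)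

  -- The diameter and the failure of distance-regularity

  point : ℤ → ℤ → V
  point x y = [ x ] , [ y ]

  point-displacement : ∀ x y x′ y′ a b → x′ ≡ x ℤ.+ (a ℤ.+ b) → y′ ≋ y ℤ.+ (a ℤ.- b) →
    Displacement (point x y) (point x′ y′) a b
  point-displacement x y x′ y′ a b ex hy =
    ≋-trans ι[ x′ ] (≋-trans (≋-reflexive ex) (≋-+ (≋-sym ι[ x ]) ≋-refl)) ,
    ≋-trans ι[ y′ ] (≋-trans hy (≋-+ (≋-sym ι[ y ]) ≋-refl))

  diameter : Metric.HasDiameter (C⊗C n 5≤n) connected (m ℕ.+ m)
  diameter = (λ P Q → subst (ℕ._≤ m ℕ.+ m) (sym (dist-coordinates P Q))
               (ℕ.+-mono-≤ (∣centre∣≤m (U P ℤ.- U Q)) (∣centre∣≤m (W P ℤ.- W Q)))) ,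
             -- The farthest displacement `a = b = m` changes the first coordinate by 2m and the
             -- second by 0.
             point (+ 0) (+ 0) , point (+ (m ℕ.+ m)) (+ 0) ,
             dist≡ (point (+ 0) (+ 0)) (point (+ (m ℕ.+ m)) (+ 0)) (+ m) (+ m) (point-displacement (+ 0) (+ 0) (+ (m ℕ.+ m)) (+ 0) (+ m) (+ m) refl
               (≋-reflexive (sym (trans (ℤ.+-identityˡ (+ m ℤ.- + m)) (ℤ.+-inverseʳ (+ m))))))
               ℕ.≤-refl ℕ.≤-refl

  -- Seen from `O`, the torus displacement is (2 , 0) for `A` and (1 , 1) for `B`.
  O A B : V
  O = point (+ 0) (+ 0)
  A = point (+ 2) (+ 2)
  B = point (+ 2) (+ 0)

  1≤m : 1 ℕ.≤ m
  1≤m = ℕ.<⇒≤ 2≤m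

  dist-OA : dist O A ≡ 2
  dist-OA = dist≡ O A (+ 2) (+ 0) (point-displacement (+ 0) (+ 0) (+ 2) (+ 2) (+ 2) (+ 0) refl ≋-refl) 2≤m ℕ.z≤n

  dist-OB : dist O B ≡ 2
  dist-OB = dist≡ O B (+ 1) (+ 1) (point-displacement (+ 0) (+ 0) (+ 2) (+ 0) (+ 1) (+ 1) refl ≋-refl) 1≤m 1≤m

  not-close : ∀ {a b} → ℤ.∣ a ℤ.- b ∣ ℕ.≤ 4 → a ≢ b → ¬ (a ≋ b)
  not-close le a≢b h = a≢b (≋-small h (ℕ.≤-trans (ℕ.s≤s le) 5≤n))

  -- The other combination of signs would give -1 ≋ 3, which is excluded because `n` is at least 5.
  between : ∀ {z} → Adjacent [ + 0 ] z → Adjacent [ + 2 ] z → ι z ≋ + 1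
  between {z} e₀ e₂ with adjacent⇒≋ e₀ | adjacent⇒≋ e₂
  ... | s , u , h₀ | s′ , u′ , h₂ = go u u′ (≋-trans h₀ (≋-+ ι[ + 0 ] (≋-refl {s}))) (≋-trans h₂ (≋-+ ι[ + 2 ] (≋-refl {s′})))
    where
    go : ∀ {s s′} → IsUnit s → IsUnit s′ → ι z ≋ + 0 ℤ.+ s → ι z ≋ + 2 ℤ.+ s′ → ι z ≋ + 1
    go unit⁺ _ h _ = h
    go unit⁻ unit⁻ _ h = h
    go unit⁻ unit⁺ h h′ = contradiction (≋-trans (≋-sym h) h′) (not-close ℕ.≤-refl λ ())

  -- Spelled as the predicate counted by `c` in `DistanceRegular` for `i = 2`, so that its constants
  -- apply to these counts directly.
  closer? : ∀ Q → Decidable (λ z → (Q ∼ z) × (suc (dist O z) ≡ 2))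
  closer? Q z = (Q ∼? z) ×-dec (suc (dist O z) ℕ.≟ 2)

  count-A : count (closer? A) ℕ.≤ 1
  count-A = count≤1 (closer? A) λ u v pu pv →
    let (ux , uy) = both u pu
        (vx , vy) = both v pv
    in cong₂ _,_ (ι-injective (≋-trans ux (≋-sym vx))) (ι-injective (≋-trans uy (≋-sym vy)))
    where
    edge : ∀ {u} → Walk O u 1 → O ∼ u
    edge (e ∷ []) = e
    both : ∀ u → (A ∼ u) × (suc (dist O u) ≡ 2) → ι (proj₁ u) ≋ + 1 × ι (proj₂ u) ≋ + 1
    both u ((ax , ay) , d) = let (ox , oy) = edge (subst (Walk O u) (ℕ.suc-injective d) (dist-walk O u)) in
      between ox ax , between oy ay

  count-B : 2 ℕ.≤ count (closer? B)
  count-B = 2≤count (closer? B) {point (+ 1) (+ 1)} {point (+ 1) -[1+ 0 ]}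
    ((step unit⁻ (+ 2) , step unit⁺ (+ 0)) ,
      cong suc (dist≡ O (point (+ 1) (+ 1)) (+ 1) (+ 0) (point-displacement (+ 0) (+ 0) (+ 1) (+ 1) (+ 1) (+ 0) refl ≋-refl) 1≤m ℕ.z≤n))
    ((step unit⁻ (+ 2) , step unit⁻ (+ 0)) ,
      cong suc (dist≡ O (point (+ 1) -[1+ 0 ]) (+ 0) (+ 1) (point-displacement (+ 0) (+ 0) (+ 1) -[1+ 0 ] (+ 0) (+ 1) refl ≋-refl) ℕ.z≤n 1≤m))
    (λ e → not-close {+ 1} { -[1+ 0 ]} (ℕ.s≤s (ℕ.s≤s ℕ.z≤n)) (λ ())
      (≋-trans (≋-sym ι[ + 1 ]) (≋-trans (≋-reflexive (cong (ι ∘ proj₂) e)) ι[ -[1+ 0 ] ])))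
    where
    step : ∀ {s} → IsUnit s → ∀ a → Adjacent [ a ] [ a ℤ.+ s ]
    step {s} u a = ≋⇒adjacent u (≋-trans ι[ a ℤ.+ s ] (≋-+ (≋-sym ι[ a ]) ≋-refl))

  not-distance-regular : ¬ Metric.DistanceRegular (C⊗C n 5≤n) connected
  not-distance-regular (_ , constants) = let (c , b , h) = constants 2 in
    ℕ.<⇒≱ count-B (ℕ.≤-trans (ℕ.≤-reflexive (trans (proj₁ (h O B dist-OB)) (sym (proj₁ (h O A dist-OA))))) count-A)

-- Assembly over the reals and the infinite family

ℝ-apartnessRing : ApartnessRing
ℝ-apartnessRing = record
  { ring      = ℝ-commutativeRing
  ; fromℤ     = fromℤ-homomorphism
  ; NonZero   = BoundedAway
  ; nz-cong   = boundedAway-cong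
  ; nz-*      = λ {x} {y} → boundedAway-* {x} {y}
  ; nz-*⁻ˡ    = λ {x} {y} → boundedAway-*ˡ {x} {y}
  ; nz-+⁻     = λ {x} {y} → boundedAway-+ {x} {y}
  ; ¬nz-0     = λ (ε , 0<ε , N , h) → <⇒≱ 0<ε (h N ℕ.≤-refl)
  ; nz-kz²+1  = boundedAway-kz²+1
  ; nz-cancel = ≈0-cancel
  }

-- A record rather than a synonym: type conversion then compares graphs instead
-- of unfolding distance matrices.
record HasDistanceSpectrum (k : ℕ) (G : Graph) (conn : Graph.Connected G) : Set where
  constructor spectrum-of
  field
    spectrum : HasExactlyDistinct k (Metric.IsDistanceEigenvalue G conn)

distance-spectrum : ∀ m-1 (G : Graph) (conn : Graph.Connected G) →
  let open Cyclic (suc m-1) in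
  (π : Graph.V G ↔ (Fin n × Fin n)) →
  (∀ P Q → Metric.dist G conn P Q ≡ δ (ι (proj₁ (Inverse.to π P)) ℤ.- ι (proj₁ (Inverse.to π Q)))
                                ℕ.+ δ (ι (proj₂ (Inverse.to π P)) ℤ.- ι (proj₂ (Inverse.to π Q)))) →
  Graph.V G → HasDistanceSpectrum (3 ℕ.+ m-1) G conn
distance-spectrum m-1 G conn π d≡ O =
  let (μ , μ-apart , eigen , complete) =
        ApartnessAlgebra.torus-spectrum ℝ-apartnessRing m-1 c (λ k → pℝ k c) ≈-refl ≈-refl (λ _ → ≈-refl)
          p-c≈0 p-c≉0 p-c+2≉0
          (π ↔-∘ Graph.enum G) (λ i j → Metric.dist G conn (Graph.vertex G i) (Graph.vertex G j))
          (λ i j → d≡ (Graph.vertex G i) (Graph.vertex G j)) (Inverse.from (Graph.enum G) O)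
  in spectrum-of (μ ,
    (λ i j i≢j → boundedAway⇒# {μ i} {μ j} (μ-apart i j i≢j)) ,
    (λ i → let (v , (P , h) , eig) = eigen i in v , (P , boundedAway⇒#0 {v P} h) , eig) ,
    (λ x (v , (P , h) , eig) → complete x (v , (P , #0⇒boundedAway {v P} h) , eig)))
  where open LargestRoot m-1 using (c; p-c≈0; p-c≉0; p-c+2≉0)

-- A view: matching on it turns `n` into `Cyclic.n (suc m-1)`, the form in which the cyclic
-- arithmetic is stated.
data OddAtLeast5 : ℕ → Set where
  odd : ∀ m-1 → 2 ℕ.≤ suc m-1 → OddAtLeast5 (Cyclic.n (suc m-1))

oddAtLeast5 : ∀ n → 5 ℕ.≤ n → ¬ (2 ℕ.∣ n) → OddAtLeast5 n
oddAtLeast5 n 5≤n 2∤n with parity n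
... | j , inj₁ e = contradiction (ℕ.divides j (trans e (double j))) 2∤n
  where
  double : ∀ j → j ℕ.+ j ≡ j ℕ.* 2
  double j = trans (cong (j ℕ.+_) (sym (ℕ.+-identityʳ j))) (ℕ.*-comm 2 j)
... | suc (suc j) , inj₂ refl = odd (suc j) (ℕ.s≤s (ℕ.s≤s ℕ.z≤n))
oddAtLeast5 n (ℕ.s≤s ()) _ | zero , inj₂ refl
oddAtLeast5 n (ℕ.s≤s (ℕ.s≤s (ℕ.s≤s ()))) _ | suc zero , inj₂ refl

[n+3]/2≡2+m : ∀ m → (suc (m ℕ.+ m) ℕ.+ 3) ℕ./ 2 ≡ 2 ℕ.+ m
[n+3]/2≡2+m m = trans (cong (ℕ._/ 2) (e m)) (ℕ.m*n/n≡m (2 ℕ.+ m) 2)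
  where
  open ℕ.+-*-Solver
  e : ∀ m → suc (m ℕ.+ m) ℕ.+ 3 ≡ (2 ℕ.+ m) ℕ.* 2
  e = solve 1 (λ m → con 1 :+ (m :+ m) :+ con 3 := (con 2 :+ m) :* con 2) refl

odd-unbounded : ∀ N → ∃[ n ] N ℕ.≤ n × 5 ℕ.≤ n × ¬ (2 ℕ.∣ n)
-- The witness is 2 (N + 2) + 1; the summand 2 guarantees the lower bound 5.
odd-unbounded N = suc (k ℕ.* 2) ,
  ℕ.≤-trans (ℕ.m≤n+m N 2) (ℕ.≤-trans (ℕ.m≤m*n k 2) (ℕ.n≤1+n _)) ,
  ℕ.s≤s (ℕ.*-monoˡ-≤ 2 (ℕ.m≤m+n 2 N)) ,
  λ 2∣ → contradiction (ℕ.∣m+n∣m⇒∣n (subst (2 ℕ.∣_) (ℕ.+-comm 1 (k ℕ.* 2)) 2∣) (ℕ.divides k refl)) λ 2∣1 → ℕ.<⇒≱ (ℕ.n<1+n 1) (ℕ.∣⇒≤ 2∣1)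
  where
  k = 2 ℕ.+ N

-- Counting both sides gives m² = n², and squaring is strictly increasing. Hence different cycles
-- yield non-isomorphic products.
order-injective : ∀ {m n} → (Fin m × Fin m) ↔ (Fin n × Fin n) → m ≡ n
order-injective {m} {n} f = square-injective (↔⇒≡ (↔-sym Fin.*↔× ↔-∘ (f ↔-∘ Fin.*↔×)))
  where
  square-injective : m ℕ.* m ≡ n ℕ.* n → m ≡ n
  square-injective e with ℕ.<-cmp m n
  ... | tri< m<n _ _ = contradiction e (ℕ.<⇒≢ (ℕ.*-mono-< m<n m<n))
  ... | tri≈ _ m≡n _ = m≡n
  ... | tri> _ _ n<m = contradiction (sym e) (ℕ.<⇒≢ (ℕ.*-mono-< n<m n<m))

open import Data.Nat using (_+_; _∸_; _/_; _≤_; _<_)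
open import Data.Nat.Divisibility using (_∣_)

OddCycleSquare : (n : ℕ) → 5 ≤ n → Set
OddCycleSquare n 5≤n = Σ[ conn ∈ Graph.Connected (C⊗C n 5≤n) ]
  Metric.HasDiameter (C⊗C n 5≤n) conn (n ∸ 1) ×
  ¬ Metric.DistanceRegular (C⊗C n 5≤n) conn ×
  HasDistanceSpectrum ((n + 3) / 2) (C⊗C n 5≤n) conn ×
  (n + 3) / 2 < n ×
  (n + 3) / 2 < (n ∸ 1) + 1

module _ (m-1 : ℕ) (2≤m : 2 ≤ suc m-1) (5≤n : 5 ≤ Cyclic.n (suc m-1)) where

  open Cyclic (suc m-1)
  open TorusGraph (suc m-1) 2≤m 5≤n

  distance-torus : ∀ P Q → Metric.dist (C⊗C n 5≤n) connected P Q ≡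
    δ (ι [ U P ] ℤ.- ι [ U Q ]) + δ (ι [ W P ] ℤ.- ι [ W Q ])
  distance-torus P Q = trans (dist-coordinates P Q) (cong₂ _+_
    (δ-cong (≋-sym (≋-- ι[ U P ] ι[ U Q ])))
    (δ-cong (≋-sym (≋-- ι[ W P ] ι[ W Q ]))))

  -- For n = 2m + 1 the left side is m + 2, which is at most 2m as `m` is at least 2.
  few : (n + 3) / 2 < n
  few = ℕ.s≤s (ℕ.≤-trans (ℕ.≤-reflexive ([n+3]/2≡2+m (suc m-1))) (ℕ.+-monoˡ-≤ (suc m-1) 2≤m))

  oddCycleSquare : OddCycleSquare n 5≤n
  oddCycleSquare = connected , diameter , not-distance-regular ,
    subst (λ k → HasDistanceSpectrum k (C⊗C n 5≤n) connected)
      (sym ([n+3]/2≡2+m (suc m-1)))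
      (distance-spectrum m-1 (C⊗C n 5≤n) connected coordinates distance-torus O) ,
    few , subst ((n + 3) / 2 <_) (ℕ.+-comm 1 (suc m-1 + suc m-1)) few

C⊗C-odd : ∀ {n} → OddAtLeast5 n → (5≤n : 5 ≤ n) → OddCycleSquare n 5≤n
C⊗C-odd (odd m-1 2≤m) 5≤n = oddCycleSquare m-1 2≤m 5≤n

mainTheorem7 : ((n : ℕ) (5≤n : 5 ≤ n) → ¬ (2 ∣ n) →
    Σ[ conn ∈ Graph.Connected (C⊗C n 5≤n) ]
    let open Metric (C⊗C n 5≤n) conn in
    HasDiameter (n ∸ 1) ×
    ¬ DistanceRegular ×
    HasExactlyDistinct ((n + 3) / 2) IsDistanceEigenvalue ×
    (n + 3) / 2 < n ×
    (n + 3) / 2 < (n ∸ 1) + 1)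
    ×
    (((n : ℕ) (5≤n : 5 ≤ n) → ¬ (2 ∣ n) →
    Σ[ conn ∈ Graph.Connected (C⊗C n 5≤n) ]
    Metric.NotDistanceRegularWithFewDistanceEigenvalues (C⊗C n 5≤n) conn)
    × ((N : ℕ) → ∃[ n ] N ≤ n × 5 ≤ n × ¬ (2 ∣ n))
    × ((m n : ℕ) (5≤m : 5 ≤ m) (5≤n : 5 ≤ n) → ¬ (2 ∣ m) → ¬ (2 ∣ n) →
    C⊗C m 5≤m ≅ C⊗C n 5≤n → m ≡ n))
mainTheorem7 =
  (λ n 5≤n 2∤n →
    let (conn , diam , ¬dr , spectrum-of spec , few , few′) = C⊗C-odd (oddAtLeast5 n 5≤n 2∤n) 5≤n in
    conn , diam , ¬dr , spec , few , few′) ,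
  (λ n 5≤n 2∤n →
    let (conn , diam , ¬dr , spectrum-of spec , _ , few) = C⊗C-odd (oddAtLeast5 n 5≤n 2∤n) 5≤n in
    conn , ¬dr , n ∸ 1 , diam , (n + 3) / 2 , spec , few) ,
  odd-unbounded ,
  (λ m n 5≤m 5≤n _ _ (f , _) → order-injective f)
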